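{- Let $D>1$ be a squarefree integer and $F=\mathbb{Q}(\sqrt{D})$. If there exists a universal ternary quadratic $\mathcal{O}_F$-lattice, then \[ D\in\{2,3,5,6,7,10,13,17,21,33,41,65,77\}. \]
   Context: $\mathcal{O}_F$ is the ring of integers of $F$ and $\mathcal{O}_F^+$ the set of totally positive elements of $\mathcal{O}_F$ (positive in both real embeddings). For a quadratic space $(V,Q)$ over $F$ let $\mathcal{B}(v,w)=\frac12(Q(v+w)-Q(v)-Q(w))$. A quadratic $\mathcal{O}_F$-lattice is a finitely generated $\mathcal{O}_F$-submodule $L$ of $V$ with $Q(L)\subseteq\mathcal{O}_F$ (it need not be classical, i.e. $\mathcal{B}(L,L)$ may only lie in $\frac12\mathcal{O}_F$); its rank is $\dim_F FL$, and it is ternary if its rank is $3$. $L$ is universal if it is totally positive definite (i.e. $Q(v)\in\mathcal{O}_F^+$ for all nonzero $v\in L$) and $Q(L\setminus\{0\})=\mathcal{O}_F^+$. -}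

module Defs where

open import Data.Nat as ℕ using (ℕ; _%_)
open import Data.Integer as ℤ using (ℤ; +_)
open import Data.Rational as ℚ using (ℚ; 0ℚ; 1ℚ; ½)
open import Data.Fin using (Fin; zero; suc)
open import Data.Product using (Σ; ∃; _×_; _,_)
open import Relation.Nullary using (¬_)
open import Relation.Binary.PropositionalEquality using (_≡_)

record QF : Set where
  constructor _+_√
  field
    re : ℚ
    im : ℚ
open QF public

module QuadField (D : ℕ) where

  Dℚ : ℚ
  Dℚ = (+ D) ℚ./ 1

  0F : QF
  0F = 0ℚ + 0ℚ √

  1F : QF
  1F = 1ℚ + 0ℚ √

  infixl 6 _+F_
  infixl 7 _*F_

  _+F_ : QF → QF → QF
  (a + b √) +F (c + d √) = (a ℚ.+ c) + (b ℚ.+ d) √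

  _*F_ : QF → QF → QF
  (a + b √) *F (c + d √) = (a ℚ.* c ℚ.+ Dℚ ℚ.* (b ℚ.* d)) + (a ℚ.* d ℚ.+ b ℚ.* c) √

  ℤ→F : ℤ → QF
  ℤ→F n = (n ℚ./ 1) + 0ℚ √

  -- ω = (1 + √D)/2 if D ≡ 1 (mod 4), and ω = √D otherwise, so that O_F = ℤ[ω].
  ω : QF
  ω with D % 4
  ... | 1 = ½ + ½ √
  ... | _ = 0ℚ + 1ℚ √

  IsIntegral : QF → Set
  IsIntegral x = Σ ℤ λ a → Σ ℤ λ b → x ≡ ℤ→F a +F ℤ→F b *F ω

  -- totally positive: both real embeddings x ± y√D are positive,
  -- i.e. (for D > 0) x > 0 and x² - D y² > 0.
  TotallyPositive : QF → Set
  TotallyPositive (x + y √) = (0ℚ ℚ.< x) × (Dℚ ℚ.* (y ℚ.* y) ℚ.< x ℚ.* x)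

  IsTotPosInt : QF → Set
  IsTotPosInt x = IsIntegral x × TotallyPositive x

  Vec3 : Set
  Vec3 = Fin 3 → QF

  sumFin : (n : ℕ) → (Fin n → QF) → QF
  sumFin ℕ.zero    f = 0F
  sumFin (ℕ.suc n) f = f zero +F sumFin n (λ k → f (suc k))

  QuadForm : Set
  QuadForm = Fin 3 → Fin 3 → QF

  evalQ : QuadForm → Vec3 → QF
  evalQ a v = sumFin 3 λ i → sumFin 3 λ j → a i j *F v i *F v j

  comb : (n : ℕ) → (Fin n → QF) → (Fin n → Vec3) → Vec3
  comb n c g i = sumFin n λ k → c k *F g k i

  IsZeroVec : Vec3 → Set
  IsZeroVec v = ∀ i → v i ≡ 0F

  -- L = O_F g_1 + ... + O_F g_n ⊂ F³, with quadratic form Q given by a.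
  -- Element of L: comb n c g with all c k ∈ O_F.
  IntCoeffs : (n : ℕ) → (Fin n → QF) → Set
  IntCoeffs n c = ∀ k → IsIntegral (c k)

  IsQuadraticLattice : QuadForm → (n : ℕ) → (Fin n → Vec3) → Set
  IsQuadraticLattice a n g =
    ∀ c → IntCoeffs n c → IsIntegral (evalQ a (comb n c g))

  HasRank3 : (n : ℕ) → (Fin n → Vec3) → Set
  HasRank3 n g = ∀ (w : Vec3) → Σ (Fin n → QF) λ f → ∀ i → comb n f g i ≡ w i

  IsTotPosDef : QuadForm → (n : ℕ) → (Fin n → Vec3) → Set
  IsTotPosDef a n g =
    ∀ c → IntCoeffs n c → ¬ IsZeroVec (comb n c g) → IsTotPosInt (evalQ a (comb n c g))

  -- universal: totally positive definite and Q(L \ {0}) = O_F^+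
  -- (the inclusion ⊆ is the positive definiteness; ⊇ is below)
  IsUniversal : QuadForm → (n : ℕ) → (Fin n → Vec3) → Set
  IsUniversal a n g =
    IsTotPosDef a n g ×
    (∀ α → IsTotPosInt α →
      Σ (Fin n → QF) λ c → IntCoeffs n c × ¬ IsZeroVec (comb n c g) × evalQ a (comb n c g) ≡ α)

  ExistsUniversalTernary : Set
  ExistsUniversalTernary =
    Σ QuadForm λ a → Σ ℕ λ n → Σ (Fin n → Vec3) λ g →
      IsQuadraticLattice a n g × HasRank3 n g × IsUniversal a n g

SquareFree : ℕ → Set
SquareFree D = ∀ (m : ℕ) → (m ℕ.* m) Data.Nat.Divisibility.∣ D → m ≡ 1
  where import Data.Nat.Divisibility

{-# OPTIONS --safe #-}

-- Let L be a universal ternary lattice over O_F and let v₁, v₂ ∈ L have Q(v₁) = 1 and Q(v₂) = α₂.  Write T for the polar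
-- form Q(x + y) - Q(x) - Q(y).  Since L has rank 3, the determinants of the 3 × 3 matrices of T on (v₁, v₂, x) × (v₁, v₂, y)
-- form a matrix of rank one in x, y (Cauchy–Binet); clearing v₁ and then v₂, twice such a determinant is
-- K(x, y) = N(v₂) M(x, y) - M(v₂, x) M(v₂, y) with M(x, y) = 2 T(x, y) - T(v₁, x) T(v₁, y) and N(x) = M(x, x).  So K(x, y)² = K(x, x) K(y, y).
-- The Cauchy–Schwarz inequality in both real embeddings leaves finitely many possible values of T on vectors of given norms.
--
-- If the discriminant d of F exceeds 1720, then for Q(v₂) = 2, Q(v₃) ∈ {3, 5} and Q(w) = α the least totally positive element
-- of the form a + ω, all values of T on v₁, v₂, v₃, w are rational integers.  Then K(v₃, w) and K(v₃, v₃) ≠ 0 are rational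
-- but K(w, w) is not, which contradicts K(v₃, w)² = K(v₃, v₃) K(w, w).
--
-- For the remaining D outside the list, a finite search shows that every choice of values of T on v₁, v₂, v₃ makes
-- some totally positive integer unrepresentable.

module Submission where

-- No basis and no Gram matrix of the lattice is at hand, only vectors of prescribed norms and
-- bounds on the values of `T` between them. An irrational coordinate is expensive: `T² ≤ β` in both
-- embeddings gives `d y² ≤ 2 tr β` for the irrational coordinate `y` of `T`. The largest bound used
-- is `β = 4 · 5 · α`, so `40 tr α < d` makes all these values rational. Since `tr α` exceeds the
-- integer square root of `d` by at most 2, this holds as soon as `d > 1720`. Below that bound, once
-- the values of `T` on v₁, v₂ and on v₃, w with v₁, v₂ are fixed, K(v₃, w) is a square root of the
-- known K(v₃, v₃) K(w, w). For a further vector w′ the exchange K(v₃, w) K(v₃, w′) = K(v₃, v₃) K(w,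
-- w′) determines T(w, w′) when K(v₃, v₃) and N(v₂) are non-zero. A configuration dies if a value of
-- `T` obtained in this way fails to be integral. The tests are necessary conditions only, so their
-- correctness means that they accept every configuration coming from a lattice.

open import Defs
open import Data.Nat using (ℕ; _<_)
open import Data.List using (List; _∷_; [])
open import Data.List.Membership.Propositional using (_∈_)

open import Algebra.Bundles using (CommutativeRing)
import Algebra.Properties.Group
import Algebra.Properties.Ring as RingProps
import Algebra.Properties.Semiring.Mult as Mult
import Algebra.Solver.Ring as RingSolver
import Algebra.Solver.Ring.AlmostCommutativeRing as ACR
open import Data.Bool as Bool using (Bool; true; false; _∧_; _∨_; not; if_then_else_)
open import Data.Bool.ListAction using (all; any)
open import Data.Empty using (⊥; ⊥-elim)
open import Data.Fin using (Fin; zero; suc)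
import Data.Fin.Properties as Finₚ
open import Data.Integer as ℤ using (ℤ; +_; -[1+_]; +0; +[1+_]; +≤+; +<+; ∣_∣)
import Data.Integer.Properties as ℤₚ
open import Data.List using (map; concatMap; upTo; _++_)
open import Data.List.Membership.Propositional.Properties using (∈-concatMap⁺; ∈-map⁺; ∈-upTo⁺; ∈-++⁺ˡ; ∈-++⁺ʳ)
open import Data.List.Relation.Unary.All as All using (All; []; _∷_)
open import Data.List.Relation.Unary.Any as Any using (here; there)
open import Data.Maybe using (Maybe; just; nothing)
open import Data.Nat as ℕ using (zero; suc; z≤n; s≤s; _≡ᵇ_; NonZero)
open import Data.Nat.Divisibility using (m%n≡0⇒n∣m)
open import Data.Nat.DivMod using (_/_; _%_; m≡m%n+[m/n]*n; m%n<n; m/n<m; /-monoˡ-≤; m*n%n≡0; m*n/n≡m; m/n*n≤m)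
import Data.Nat.Properties as ℕₚ
open import Data.Nat.Solver using (module +-*-Solver)
open import Data.Product using (Σ; _×_; _,_; proj₁; proj₂)
open import Data.Rational as ℚ using (ℚ; 0ℚ; 1ℚ; ½)
import Data.Rational.Properties as ℚₚ
open import Data.Rational.Unnormalised as ℚᵘ using (mkℚᵘ; *≡*; *<*)
import Data.Rational.Unnormalised.Properties as ℚᵘₚ
open import Data.Sum using (_⊎_; inj₁; inj₂; [_,_]′)
open import Function using (id)
open import Level using (0ℓ)
import Relation.Binary.Reasoning.Setoid as SetoidReasoning
open import Relation.Binary.PropositionalEquality as ≡
  using (_≡_; _≢_; refl; sym; trans; cong; cong₂; subst; subst₂; module ≡-Reasoning)
open import Relation.Binary.PropositionalEquality.Properties using (isEquivalence)
open import Relation.Nullary using (¬_; yes; no; Dec)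
open import Relation.Nullary.Decidable using (map′; _×-dec_)

-- Rings

-- A ring solver with integer coefficients: unlike coefficients taken in R itself, these decide that a cancelled coefficient is 0.
module IntegerSolver {c ℓ} (R : CommutativeRing c ℓ) where
  open CommutativeRing R renaming (refl to ≈-refl; sym to ≈-sym; trans to ≈-trans)
  open RingProps ring
  open Mult semiring using (×-homo-+; ×1-homo-*) renaming (_×_ to _×′_)
  open SetoidReasoning setoid

  ⟦_⟧ : ℤ → Carrier
  ⟦ + n ⟧      = n ×′ 1#
  ⟦ -[1+ n ] ⟧ = - (suc n ×′ 1#)

  ⟦⟧-neg : ∀ i → ⟦ ℤ.- i ⟧ ≈ - ⟦ i ⟧
  ⟦⟧-neg (+ zero)   = ≈-sym -0#≈0#
  ⟦⟧-neg (+ suc n)  = ≈-refl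
  ⟦⟧-neg -[1+ n ]   = ≈-sym (-‿involutive _)

  cancel-common : ∀ x a b → (x + a) - (x + b) ≈ a - b
  cancel-common x a b = begin
    (x + a) - (x + b)         ≈⟨ +-congˡ (≈-sym (-‿+-comm x b)) ⟩
    (x + a) + (- x + - b)     ≈⟨ +-congʳ (+-comm x a) ⟩
    (a + x) + (- x + - b)     ≈⟨ +-assoc a x _ ⟩
    a + (x + (- x + - b))     ≈⟨ +-congˡ (≈-sym (+-assoc x (- x) (- b))) ⟩
    a + ((x - x) + - b)       ≈⟨ +-congˡ (+-congʳ (-‿inverseʳ x)) ⟩
    a + (0# + - b)            ≈⟨ +-congˡ (+-identityˡ _) ⟩
    a - b                     ∎

  ⟦⟧-⊖ : ∀ m n → ⟦ m ℤ.⊖ n ⟧ ≈ m ×′ 1# - n ×′ 1#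
  ⟦⟧-⊖ m       zero    = ≈-sym (≈-trans (+-congˡ -0#≈0#) (+-identityʳ _))
  ⟦⟧-⊖ zero    (suc n) = ≈-sym (+-identityˡ _)
  ⟦⟧-⊖ (suc m) (suc n) = begin
    ⟦ suc m ℤ.⊖ suc n ⟧              ≡⟨ ≡.cong ⟦_⟧ (ℤₚ.[1+m]⊖[1+n]≡m⊖n m n) ⟩
    ⟦ m ℤ.⊖ n ⟧                      ≈⟨ ⟦⟧-⊖ m n ⟩
    m ×′ 1# - n ×′ 1#                ≈⟨ ≈-sym (cancel-common 1# _ _) ⟩
    suc m ×′ 1# - suc n ×′ 1#        ∎

  ⟦⟧-+ : ∀ i j → ⟦ i ℤ.+ j ⟧ ≈ ⟦ i ⟧ + ⟦ j ⟧
  ⟦⟧-+ (+ m)    (+ n)    = ×-homo-+ 1# m n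
  ⟦⟧-+ (+ m)    -[1+ n ] = ⟦⟧-⊖ m (suc n)
  ⟦⟧-+ -[1+ m ] (+ n)    = ≈-trans (⟦⟧-⊖ n (suc m)) (+-comm _ _)
  ⟦⟧-+ -[1+ m ] -[1+ n ] = begin
    - (suc (suc (m ℕ.+ n)) ×′ 1#)        ≡⟨ ≡.cong (λ k → - (k ×′ 1#)) (≡.cong suc (≡.sym (ℕ+-suc m n))) ⟩
    - ((suc m ℕ.+ suc n) ×′ 1#)          ≈⟨ -‿cong (×-homo-+ 1# (suc m) (suc n)) ⟩
    - (suc m ×′ 1# + suc n ×′ 1#)         ≈⟨ ≈-sym (-‿+-comm _ _) ⟩
    - (suc m ×′ 1#) + - (suc n ×′ 1#)     ∎
    where
    ℕ+-suc : ∀ m n → m ℕ.+ suc n ≡ suc (m ℕ.+ n)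
    ℕ+-suc zero    n = ≡.refl
    ℕ+-suc (suc m) n = ≡.cong suc (ℕ+-suc m n)

  ⟦⟧-*-+ : ∀ m j → ⟦ + m ℤ.* j ⟧ ≈ ⟦ + m ⟧ * ⟦ j ⟧
  ⟦⟧-*-+ m (+ n) = ≈-trans (reflexive (≡.cong ⟦_⟧ (≡.sym (ℤₚ.pos-* m n)))) (×1-homo-* m n)
  ⟦⟧-*-+ m -[1+ n ] = begin
    ⟦ + m ℤ.* -[1+ n ] ⟧          ≡⟨ ≡.cong ⟦_⟧ (≡.sym (ℤₚ.neg-distribʳ-* (+ m) (+ suc n))) ⟩
    ⟦ ℤ.- (+ m ℤ.* + suc n) ⟧     ≈⟨ ⟦⟧-neg (+ m ℤ.* + suc n) ⟩
    - ⟦ + m ℤ.* + suc n ⟧         ≈⟨ -‿cong (⟦⟧-*-+ m (+ suc n)) ⟩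
    - (⟦ + m ⟧ * ⟦ + suc n ⟧)     ≈⟨ -‿distribʳ-* _ _ ⟩
    ⟦ + m ⟧ * ⟦ -[1+ n ] ⟧        ∎

  ⟦⟧-* : ∀ i j → ⟦ i ℤ.* j ⟧ ≈ ⟦ i ⟧ * ⟦ j ⟧
  ⟦⟧-* (+ m)    j = ⟦⟧-*-+ m j
  ⟦⟧-* -[1+ m ] j = begin
    ⟦ -[1+ m ] ℤ.* j ⟧            ≡⟨ ≡.cong ⟦_⟧ (≡.sym (ℤₚ.neg-distribˡ-* (+ suc m) j)) ⟩
    ⟦ ℤ.- (+ suc m ℤ.* j) ⟧       ≈⟨ ⟦⟧-neg (+ suc m ℤ.* j) ⟩
    - ⟦ + suc m ℤ.* j ⟧           ≈⟨ -‿cong (⟦⟧-*-+ (suc m) j) ⟩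
    - (⟦ + suc m ⟧ * ⟦ j ⟧)       ≈⟨ -‿distribˡ-* _ _ ⟩
    ⟦ -[1+ m ] ⟧ * ⟦ j ⟧          ∎

  morphism : ℤ.+-*-rawRing ACR.-Raw-AlmostCommutative⟶ ACR.fromCommutativeRing R
  morphism = record
    { ⟦_⟧ = ⟦_⟧ ; +-homo = ⟦⟧-+ ; *-homo = ⟦⟧-* ; -‿homo = ⟦⟧-neg
    ; 0-homo = ≈-refl ; 1-homo = +-identityʳ 1# }

  ⟦⟧-≟ : ∀ i j → Maybe (⟦ i ⟧ ≈ ⟦ j ⟧)
  ⟦⟧-≟ i j with i ℤ.≟ j
  ... | yes i≡j = just (reflexive (≡.cong ⟦_⟧ i≡j))
  ... | no  _   = nothing

  open RingSolver ℤ.+-*-rawRing (ACR.fromCommutativeRing R) morphism ⟦⟧-≟ public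
    using (solve; Polynomial; con; _:=_; _:+_; _:*_; _:-_; :-_)

module ℤS = IntegerSolver ℤₚ.+-*-commutativeRing
module ℚS = IntegerSolver ℚₚ.+-*-commutativeRing

-- Integers inside the rationals

ι : ℤ → ℚ
ι n = n ℚ./ 1

toℚᵘ-ι : ∀ n → ℚ.toℚᵘ (ι n) ℚᵘ.≃ mkℚᵘ n 0
toℚᵘ-ι n = ℚₚ.toℚᵘ-fromℚᵘ (mkℚᵘ n 0)

ι-injective : ∀ {m n} → ι m ≡ ι n → m ≡ n
ι-injective {m} {n} eq with ℚᵘₚ.≃-trans (ℚᵘₚ.≃-sym (toℚᵘ-ι m)) (ℚᵘₚ.≃-trans (ℚᵘₚ.≃-reflexive (cong ℚ.toℚᵘ eq)) (toℚᵘ-ι n))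
... | *≡* e = trans (sym (ℤₚ.*-identityʳ m)) (trans e (ℤₚ.*-identityʳ n))

ι-+ : ∀ m n → ι (m ℤ.+ n) ≡ ι m ℚ.+ ι n
ι-+ m n = ℚₚ.toℚᵘ-injective (ℚᵘₚ.≃-trans (toℚᵘ-ι (m ℤ.+ n)) (ℚᵘₚ.≃-trans
  (*≡* (ℤS.solve 2 (λ m n → (m ℤS.:+ n) ℤS.:* ℤS.con (+ 1) ℤS.:= (m ℤS.:* ℤS.con (+ 1) ℤS.:+ n ℤS.:* ℤS.con (+ 1)) ℤS.:* ℤS.con (+ 1)) refl m n))
  (ℚᵘₚ.≃-sym (ℚᵘₚ.≃-trans (ℚₚ.toℚᵘ-homo-+ (ι m) (ι n)) (ℚᵘₚ.+-cong (toℚᵘ-ι m) (toℚᵘ-ι n))))))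

ι-* : ∀ m n → ι (m ℤ.* n) ≡ ι m ℚ.* ι n
ι-* m n = ℚₚ.toℚᵘ-injective (ℚᵘₚ.≃-trans (toℚᵘ-ι (m ℤ.* n)) (ℚᵘₚ.≃-sym
  (ℚᵘₚ.≃-trans (ℚₚ.toℚᵘ-homo-* (ι m) (ι n)) (ℚᵘₚ.*-cong (toℚᵘ-ι m) (toℚᵘ-ι n)))))

ι-cancel-< : ∀ {m n} → ι m ℚ.< ι n → m ℤ.< n
ι-cancel-< {m} {n} lt with ℚᵘₚ.<-respˡ-≃ (toℚᵘ-ι m) (ℚᵘₚ.<-respʳ-≃ (toℚᵘ-ι n) (ℚₚ.toℚᵘ-mono-< lt))
... | *<* e = subst₂ ℤ._<_ (ℤₚ.*-identityʳ m) (ℤₚ.*-identityʳ n) e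

ι-mono-< : ∀ {m n} → m ℤ.< n → ι m ℚ.< ι n
ι-mono-< {m} {n} lt = ℚₚ.toℚᵘ-cancel-< (ℚᵘₚ.<-respˡ-≃ (ℚᵘₚ.≃-sym (toℚᵘ-ι m)) (ℚᵘₚ.<-respʳ-≃ (ℚᵘₚ.≃-sym (toℚᵘ-ι n))
  (*<* (subst₂ ℤ._<_ (sym (ℤₚ.*-identityʳ m)) (sym (ℤₚ.*-identityʳ n)) lt))))

-- The quadratic field as a commutative ring

module QFRing (D : ℕ) where
  open QuadField D
  open ℚS

  -F_ : QF → QF
  -F (a + b √) = (ℚ.- a) + (ℚ.- b) √

  QF-commutativeRing : CommutativeRing 0ℓ 0ℓ
  QF-commutativeRing = record
    { Carrier = QF ; _≈_ = _≡_ ; _+_ = _+F_ ; _*_ = _*F_ ; -_ = -F_ ; 0# = 0F ; 1# = 1F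
    ; isCommutativeRing = record
      { isRing = record
        { +-isAbelianGroup = record
          { isGroup = record
            { isMonoid = record
              { isSemigroup = record
                { isMagma = record { isEquivalence = isEquivalence ; ∙-cong = cong₂ _+F_ }
                ; assoc = λ (a + b √) (c + d √) (e + f √) → cong₂ _+_√ (ℚₚ.+-assoc a c e) (ℚₚ.+-assoc b d f) }
              ; identity = (λ (a + b √) → cong₂ _+_√ (ℚₚ.+-identityˡ a) (ℚₚ.+-identityˡ b))
                         , (λ (a + b √) → cong₂ _+_√ (ℚₚ.+-identityʳ a) (ℚₚ.+-identityʳ b)) }
            ; inverse = (λ (a + b √) → cong₂ _+_√ (ℚₚ.+-inverseˡ a) (ℚₚ.+-inverseˡ b))
                      , (λ (a + b √) → cong₂ _+_√ (ℚₚ.+-inverseʳ a) (ℚₚ.+-inverseʳ b))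
            ; ⁻¹-cong = cong -F_ }
          ; comm = λ (a + b √) (c + d √) → cong₂ _+_√ (ℚₚ.+-comm a c) (ℚₚ.+-comm b d) }
        ; *-cong = cong₂ _*F_
        ; *-assoc = λ (a + b √) (c + d √) (e + f √) → cong₂ _+_√
            (solve 7 (λ a b c d e f D → (a :* c :+ D :* (b :* d)) :* e :+ D :* ((a :* d :+ b :* c) :* f)
                                     := a :* (c :* e :+ D :* (d :* f)) :+ D :* (b :* (c :* f :+ d :* e))) refl a b c d e f Dℚ)
            (solve 7 (λ a b c d e f D → (a :* c :+ D :* (b :* d)) :* f :+ (a :* d :+ b :* c) :* e
                                     := a :* (c :* f :+ d :* e) :+ b :* (c :* e :+ D :* (d :* f))) refl a b c d e f Dℚ)
        ; *-identity = (λ (a + b √) → cong₂ _+_√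
                          (solve 3 (λ a b D → con (+ 1) :* a :+ D :* (con (+ 0) :* b) := a) refl a b Dℚ)
                          (solve 2 (λ a b → con (+ 1) :* b :+ con (+ 0) :* a := b) refl a b))
                     , (λ (a + b √) → cong₂ _+_√
                          (solve 3 (λ a b D → a :* con (+ 1) :+ D :* (b :* con (+ 0)) := a) refl a b Dℚ)
                          (solve 2 (λ a b → a :* con (+ 0) :+ b :* con (+ 1) := b) refl a b))
        ; distrib = (λ (a + b √) (c + d √) (e + f √) → cong₂ _+_√
                       (solve 7 (λ a b c d e f D → a :* (c :+ e) :+ D :* (b :* (d :+ f))
                                                := (a :* c :+ D :* (b :* d)) :+ (a :* e :+ D :* (b :* f))) refl a b c d e f Dℚ)
                       (solve 6 (λ a b c d e f → a :* (d :+ f) :+ b :* (c :+ e)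
                                              := (a :* d :+ b :* c) :+ (a :* f :+ b :* e)) refl a b c d e f))
                  , (λ (a + b √) (c + d √) (e + f √) → cong₂ _+_√
                       (solve 7 (λ a b c d e f D → (c :+ e) :* a :+ D :* ((d :+ f) :* b)
                                                := (c :* a :+ D :* (d :* b)) :+ (e :* a :+ D :* (f :* b))) refl a b c d e f Dℚ)
                       (solve 6 (λ a b c d e f → (c :+ e) :* b :+ (d :+ f) :* a
                                              := (c :* b :+ d :* a) :+ (e :* b :+ f :* a)) refl a b c d e f))
        }
      ; *-comm = λ (a + b √) (c + d √) → cong₂ _+_√
            (solve 5 (λ a b c d D → a :* c :+ D :* (b :* d) := c :* a :+ D :* (d :* b)) refl a b c d Dℚ)
            (solve 4 (λ a b c d → a :* d :+ b :* c := c :* b :+ d :* a) refl a b c d)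
      }
    }

-- The order spanned by 1 and ω, and its embedding into the field

private
  module ℤG = Algebra.Properties.Group (CommutativeRing.+-group ℤₚ.+-*-commutativeRing)

-- Without η, arithmetic on variables of type O does not unfold to its coordinates during type checking.
record O : Set where
  no-eta-equality
  pattern
  constructor _+_·ω
  field
    rat : ℤ
    irr : ℤ
open O public

infix 5 _+_·ω

-- Here ω² = t ω + c.
module Order (t c : ℤ) where
  open ℤS

  infixl 6 _⊕_ _⊝_
  infixl 7 _⊗_

  _⊕_ _⊗_ _⊝_ : O → O → O
  (a + b ·ω) ⊕ (a′ + b′ ·ω) = (a ℤ.+ a′) + (b ℤ.+ b′) ·ω
  (a + b ·ω) ⊗ (a′ + b′ ·ω) = (a ℤ.* a′ ℤ.+ c ℤ.* (b ℤ.* b′)) + (a ℤ.* b′ ℤ.+ b ℤ.* a′ ℤ.+ t ℤ.* (b ℤ.* b′)) ·ω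

  ⊖_ : O → O
  ⊖ (a + b ·ω) = (ℤ.- a) + (ℤ.- b) ·ω

  x ⊝ y = x ⊕ (⊖ y)

  int : ℤ → O
  int n = n + + 0 ·ω

  O-commutativeRing : CommutativeRing 0ℓ 0ℓ
  O-commutativeRing = record
    { Carrier = O ; _≈_ = _≡_ ; _+_ = _⊕_ ; _*_ = _⊗_ ; -_ = ⊖_ ; 0# = int (+ 0) ; 1# = int (+ 1)
    ; isCommutativeRing = record
      { isRing = record
        { +-isAbelianGroup = record
          { isGroup = record
            { isMonoid = record
              { isSemigroup = record
                { isMagma = record { isEquivalence = isEquivalence ; ∙-cong = cong₂ _⊕_ }
                ; assoc = λ { (a + b ·ω) (a′ + b′ ·ω) (a″ + b″ ·ω) → cong₂ _+_·ω (ℤₚ.+-assoc a a′ a″) (ℤₚ.+-assoc b b′ b″) } }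
              ; identity = (λ { (a + b ·ω) → cong₂ _+_·ω (ℤₚ.+-identityˡ a) (ℤₚ.+-identityˡ b) })
                         , (λ { (a + b ·ω) → cong₂ _+_·ω (ℤₚ.+-identityʳ a) (ℤₚ.+-identityʳ b) }) }
            ; inverse = (λ { (a + b ·ω) → cong₂ _+_·ω (ℤₚ.+-inverseˡ a) (ℤₚ.+-inverseˡ b) })
                      , (λ { (a + b ·ω) → cong₂ _+_·ω (ℤₚ.+-inverseʳ a) (ℤₚ.+-inverseʳ b) })
            ; ⁻¹-cong = cong ⊖_ }
          ; comm = λ { (a + b ·ω) (a′ + b′ ·ω) → cong₂ _+_·ω (ℤₚ.+-comm a a′) (ℤₚ.+-comm b b′) } }
        ; *-cong = cong₂ _⊗_
        ; *-assoc = λ { (a + b ·ω) (d + e ·ω) (f + g ·ω) → cong₂ _+_·ω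
            (solve 8 (λ a b d e f g t c →
              (a :* d :+ c :* (b :* e)) :* f :+ c :* ((a :* e :+ b :* d :+ t :* (b :* e)) :* g)
              := a :* (d :* f :+ c :* (e :* g)) :+ c :* (b :* (d :* g :+ e :* f :+ t :* (e :* g)))) refl a b d e f g t c)
            (solve 8 (λ a b d e f g t c →
              (a :* d :+ c :* (b :* e)) :* g :+ (a :* e :+ b :* d :+ t :* (b :* e)) :* f
                :+ t :* ((a :* e :+ b :* d :+ t :* (b :* e)) :* g)
              := a :* (d :* g :+ e :* f :+ t :* (e :* g)) :+ b :* (d :* f :+ c :* (e :* g))
                :+ t :* (b :* (d :* g :+ e :* f :+ t :* (e :* g)))) refl a b d e f g t c) }
        ; *-identity = (λ { (a + b ·ω) → cong₂ _+_·ω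
                          (solve 3 (λ a b c → con (+ 1) :* a :+ c :* (con (+ 0) :* b) := a) refl a b c)
                          (solve 3 (λ a b t → con (+ 1) :* b :+ con (+ 0) :* a :+ t :* (con (+ 0) :* b) := b) refl a b t) })
                     , (λ { (a + b ·ω) → cong₂ _+_·ω
                          (solve 3 (λ a b c → a :* con (+ 1) :+ c :* (b :* con (+ 0)) := a) refl a b c)
                          (solve 3 (λ a b t → a :* con (+ 0) :+ b :* con (+ 1) :+ t :* (b :* con (+ 0)) := b) refl a b t) })
        ; distrib = (λ { (a + b ·ω) (d + e ·ω) (f + g ·ω) → cong₂ _+_·ω
                       (solve 7 (λ a b d e f g c → a :* (d :+ f) :+ c :* (b :* (e :+ g))
                                                := (a :* d :+ c :* (b :* e)) :+ (a :* f :+ c :* (b :* g))) refl a b d e f g c)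
                       (solve 7 (λ a b d e f g t → a :* (e :+ g) :+ b :* (d :+ f) :+ t :* (b :* (e :+ g))
                                                := (a :* e :+ b :* d :+ t :* (b :* e)) :+ (a :* g :+ b :* f :+ t :* (b :* g)))
                              refl a b d e f g t) })
                  , (λ { (a + b ·ω) (d + e ·ω) (f + g ·ω) → cong₂ _+_·ω
                       (solve 7 (λ a b d e f g c → (d :+ f) :* a :+ c :* ((e :+ g) :* b)
                                                := (d :* a :+ c :* (e :* b)) :+ (f :* a :+ c :* (g :* b))) refl a b d e f g c)
                       (solve 7 (λ a b d e f g t → (d :+ f) :* b :+ (e :+ g) :* a :+ t :* ((e :+ g) :* b)
                                                := (d :* b :+ e :* a :+ t :* (e :* b)) :+ (f :* b :+ g :* a :+ t :* (g :* b)))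
                              refl a b d e f g t) })
        }
      ; *-comm = λ { (a + b ·ω) (d + e ·ω) → cong₂ _+_·ω
            (solve 5 (λ a b d e c → a :* d :+ c :* (b :* e) := d :* a :+ c :* (e :* b)) refl a b d e c)
            (solve 5 (λ a b d e t → a :* e :+ b :* d :+ t :* (b :* e) := d :* b :+ e :* a :+ t :* (e :* b)) refl a b d e t) }
      }
    }

  module OS = IntegerSolver O-commutativeRing

  tr : O → ℤ
  tr (a + b ·ω) = + 2 ℤ.* a ℤ.+ t ℤ.* b

  Δ : ℤ
  Δ = t ℤ.* t ℤ.+ + 4 ℤ.* c

  -- The real embeddings of `z` are `(tr z ± irr z √Δ) / 2`. Their signs are controlled by their sum
  -- and their product, which makes both notions conditions over ℤ.
  Positive NonNegative : O → Set
  Positive z    = + 0 ℤ.< tr z × Δ ℤ.* (irr z ℤ.* irr z) ℤ.< tr z ℤ.* tr z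
  NonNegative z = + 0 ℤ.≤ tr z × Δ ℤ.* (irr z ℤ.* irr z) ℤ.≤ tr z ℤ.* tr z

-- ω = (t + s √D) / 2
module Embedding (D : ℕ) (s t c : ℤ) (0<s : + 0 ℤ.< s) (s²D : s ℤ.* s ℤ.* + D ≡ t ℤ.* t ℤ.+ + 4 ℤ.* c)
  (re-ω : re (QuadField.ω D) ℚ.+ re (QuadField.ω D) ≡ ι t)
  (im-ω : im (QuadField.ω D) ℚ.+ im (QuadField.ω D) ≡ ι s) where
  open QuadField D
  open QFRing D
  open Order t c
  module QFS = IntegerSolver QF-commutativeRing

  private
    r = re ω
    q = im ω

  φ : O → QF
  φ (a + b ·ω) = ℤ→F a +F ℤ→F b *F ω

  halve : ∀ {x y : ℚ} → x ℚ.+ x ≡ y ℚ.+ y → x ≡ y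
  halve {x} {y} eq = trans (sym (h x)) (trans (cong (½ ℚ.*_) eq) (h y))
    where
    h : ∀ x → ½ ℚ.* (x ℚ.+ x) ≡ x
    h x = trans (ℚₚ.*-distribˡ-+ ½ x x) (trans (sym (ℚₚ.*-distribʳ-+ x ½ ½)) (ℚₚ.*-identityˡ x))

  ℤ→F-+ : ∀ m n → ℤ→F (m ℤ.+ n) ≡ ℤ→F m +F ℤ→F n
  ℤ→F-+ m n = cong₂ _+_√ (ι-+ m n) (sym (ℚₚ.+-identityˡ 0ℚ))

  ℤ→F-* : ∀ m n → ℤ→F (m ℤ.* n) ≡ ℤ→F m *F ℤ→F n
  ℤ→F-* m n = cong₂ _+_√
    (trans (ι-* m n) (ℚS.solve 3 (λ a b D → a ℚS.:* b ℚS.:= a ℚS.:* b ℚS.:+ D ℚS.:* (ℚS.con (+ 0) ℚS.:* ℚS.con (+ 0))) refl (ι m) (ι n) Dℚ))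
    (ℚS.solve 2 (λ a b → ℚS.con (+ 0) ℚS.:= a ℚS.:* ℚS.con (+ 0) ℚS.:+ ℚS.con (+ 0) ℚS.:* b) refl (ι m) (ι n))

  -- Only the doubles of `re ω` and `im ω` are given as integers, so the rational parts are compared
  -- after multiplication by 4.
  ω² : ω *F ω ≡ ℤ→F t *F ω +F ℤ→F c
  ω² = cong₂ _+_√ (halve (halve re²)) im²
    where
    open ≡-Reasoning
    disc : ι s ℚ.* ι s ℚ.* Dℚ ≡ ι t ℚ.* ι t ℚ.+ ι (+ 4) ℚ.* ι c
    disc = begin
      ι s ℚ.* ι s ℚ.* Dℚ              ≡⟨ cong (ℚ._* Dℚ) (sym (ι-* s s)) ⟩
      ι (s ℤ.* s) ℚ.* Dℚ              ≡⟨ sym (ι-* (s ℤ.* s) (+ D)) ⟩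
      ι (s ℤ.* s ℤ.* + D)             ≡⟨ cong ι s²D ⟩
      ι (t ℤ.* t ℤ.+ + 4 ℤ.* c)       ≡⟨ ι-+ (t ℤ.* t) (+ 4 ℤ.* c) ⟩
      ι (t ℤ.* t) ℚ.+ ι (+ 4 ℤ.* c)   ≡⟨ cong₂ ℚ._+_ (ι-* t t) (ι-* (+ 4) c) ⟩
      ι t ℚ.* ι t ℚ.+ ι (+ 4) ℚ.* ι c ∎
    open ℚS
    re² : ((r ℚ.* r ℚ.+ Dℚ ℚ.* (q ℚ.* q)) ℚ.+ (r ℚ.* r ℚ.+ Dℚ ℚ.* (q ℚ.* q)))
            ℚ.+ ((r ℚ.* r ℚ.+ Dℚ ℚ.* (q ℚ.* q)) ℚ.+ (r ℚ.* r ℚ.+ Dℚ ℚ.* (q ℚ.* q)))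
        ≡ (((ι t ℚ.* r ℚ.+ Dℚ ℚ.* (0ℚ ℚ.* q)) ℚ.+ ι c) ℚ.+ ((ι t ℚ.* r ℚ.+ Dℚ ℚ.* (0ℚ ℚ.* q)) ℚ.+ ι c))
            ℚ.+ (((ι t ℚ.* r ℚ.+ Dℚ ℚ.* (0ℚ ℚ.* q)) ℚ.+ ι c) ℚ.+ ((ι t ℚ.* r ℚ.+ Dℚ ℚ.* (0ℚ ℚ.* q)) ℚ.+ ι c))
    re² = begin
      _ ≡⟨ solve 3 (λ r q D → ((r :* r :+ D :* (q :* q)) :+ (r :* r :+ D :* (q :* q)))
             :+ ((r :* r :+ D :* (q :* q)) :+ (r :* r :+ D :* (q :* q)))
             := (r :+ r) :* (r :+ r) :+ (q :+ q) :* (q :+ q) :* D) refl r q Dℚ ⟩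
      (r ℚ.+ r) ℚ.* (r ℚ.+ r) ℚ.+ (q ℚ.+ q) ℚ.* (q ℚ.+ q) ℚ.* Dℚ ≡⟨ cong₂ ℚ._+_ (cong ((r ℚ.+ r) ℚ.*_) re-ω) (trans (cong (λ z → z ℚ.* z ℚ.* Dℚ) im-ω) disc) ⟩
      (r ℚ.+ r) ℚ.* ι t ℚ.+ (ι t ℚ.* ι t ℚ.+ ι (+ 4) ℚ.* ι c)  ≡⟨ cong (λ z → (r ℚ.+ r) ℚ.* ι t ℚ.+ (z ℚ.* ι t ℚ.+ ι (+ 4) ℚ.* ι c)) (sym re-ω) ⟩
      (r ℚ.+ r) ℚ.* ι t ℚ.+ ((r ℚ.+ r) ℚ.* ι t ℚ.+ ι (+ 4) ℚ.* ι c)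
        ≡⟨ solve 5 (λ r t c q D → (r :+ r) :* t :+ ((r :+ r) :* t :+ con (+ 4) :* c)
             := (((t :* r :+ D :* (con (+ 0) :* q)) :+ c) :+ ((t :* r :+ D :* (con (+ 0) :* q)) :+ c))
              :+ (((t :* r :+ D :* (con (+ 0) :* q)) :+ c) :+ ((t :* r :+ D :* (con (+ 0) :* q)) :+ c)))
             refl r (ι t) (ι c) q Dℚ ⟩
      _ ∎
    im² : r ℚ.* q ℚ.+ q ℚ.* r ≡ (ι t ℚ.* q ℚ.+ 0ℚ ℚ.* r) ℚ.+ 0ℚ
    im² = trans (solve 2 (λ r q → r :* q :+ q :* r := ((r :+ r) :* q :+ con (+ 0) :* r) :+ con (+ 0)) refl r q)
                (cong (λ z → (z ℚ.* q ℚ.+ 0ℚ ℚ.* r) ℚ.+ 0ℚ) re-ω)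

  φ-⊕ : ∀ x y → φ (x ⊕ y) ≡ φ x +F φ y
  φ-⊕ (a + b ·ω) (a′ + b′ ·ω) = trans (cong₂ (λ u v → u +F v *F ω) (ℤ→F-+ a a′) (ℤ→F-+ b b′))
    (solve 5 (λ a b a′ b′ ω → (a :+ a′) :+ (b :+ b′) :* ω := (a :+ b :* ω) :+ (a′ :+ b′ :* ω)) refl
      (ℤ→F a) (ℤ→F b) (ℤ→F a′) (ℤ→F b′) ω)
    where open QFS

  φ-⊗ : ∀ x y → φ (x ⊗ y) ≡ φ x *F φ y
  φ-⊗ (a + b ·ω) (a′ + b′ ·ω) = begin
    φ ((a + b ·ω) ⊗ (a′ + b′ ·ω))
      ≡⟨ cong₂ (λ u v → u +F v *F ω)
           (trans (ℤ→F-+ (a ℤ.* a′) (c ℤ.* (b ℤ.* b′))) (cong₂ _+F_ (ℤ→F-* a a′) (trans (ℤ→F-* c (b ℤ.* b′)) (cong (ℤ→F c *F_) (ℤ→F-* b b′)))))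
           (trans (ℤ→F-+ (a ℤ.* b′ ℤ.+ b ℤ.* a′) (t ℤ.* (b ℤ.* b′))) (cong₂ _+F_ (trans (ℤ→F-+ (a ℤ.* b′) (b ℤ.* a′)) (cong₂ _+F_ (ℤ→F-* a b′) (ℤ→F-* b a′)))
             (trans (ℤ→F-* t (b ℤ.* b′)) (cong (ℤ→F t *F_) (ℤ→F-* b b′))))) ⟩
    (ℤ→F a *F ℤ→F a′ +F ℤ→F c *F (ℤ→F b *F ℤ→F b′))
      +F (ℤ→F a *F ℤ→F b′ +F ℤ→F b *F ℤ→F a′ +F ℤ→F t *F (ℤ→F b *F ℤ→F b′)) *F ω
      ≡⟨ solve 7 (λ a b a′ b′ c t w →
           (a :* a′ :+ c :* (b :* b′)) :+ (a :* b′ :+ b :* a′ :+ t :* (b :* b′)) :* w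
           := a :* a′ :+ (a :* b′ :+ b :* a′) :* w :+ b :* b′ :* (t :* w :+ c)) refl
           (ℤ→F a) (ℤ→F b) (ℤ→F a′) (ℤ→F b′) (ℤ→F c) (ℤ→F t) ω ⟩
    ℤ→F a *F ℤ→F a′ +F (ℤ→F a *F ℤ→F b′ +F ℤ→F b *F ℤ→F a′) *F ω +F ℤ→F b *F ℤ→F b′ *F (ℤ→F t *F ω +F ℤ→F c)
      ≡⟨ cong (ℤ→F a *F ℤ→F a′ +F (ℤ→F a *F ℤ→F b′ +F ℤ→F b *F ℤ→F a′) *F ω +F_) (cong (ℤ→F b *F ℤ→F b′ *F_) (sym ω²)) ⟩
    ℤ→F a *F ℤ→F a′ +F (ℤ→F a *F ℤ→F b′ +F ℤ→F b *F ℤ→F a′) *F ω +F ℤ→F b *F ℤ→F b′ *F (ω *F ω)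
      ≡⟨ solve 5 (λ a b a′ b′ w →
           a :* a′ :+ (a :* b′ :+ b :* a′) :* w :+ b :* b′ :* (w :* w) := (a :+ b :* w) :* (a′ :+ b′ :* w)) refl
           (ℤ→F a) (ℤ→F b) (ℤ→F a′) (ℤ→F b′) ω ⟩
    φ (a + b ·ω) *F φ (a′ + b′ ·ω) ∎
    where
    open QFS
    open ≡-Reasoning

  φ-⊖ : ∀ x → φ (⊖ x) ≡ -F φ x
  φ-⊖ x = begin
    φ (⊖ x)                           ≡⟨ solve 2 (λ u v → u := (u :+ v) :+ :- v) refl (φ (⊖ x)) (φ x) ⟩
    (φ (⊖ x) +F φ x) +F (-F φ x)      ≡⟨ cong (_+F (-F φ x)) (sym (φ-⊕ (⊖ x) x)) ⟩
    φ (⊖ x ⊕ x) +F (-F φ x)           ≡⟨ cong (λ z → φ z +F (-F φ x)) (CommutativeRing.-‿inverseˡ O-commutativeRing x) ⟩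
    φ (int (+ 0)) +F (-F φ x)         ≡⟨ solve 2 (λ w v → (con (+ 0) :+ con (+ 0) :* w) :+ :- v := :- v) refl ω (φ x) ⟩
    -F φ x ∎
    where
    open QFS
    open ≡-Reasoning

  re-φ : ∀ z → re (φ z) ℚ.+ re (φ z) ≡ ι (tr z)
  re-φ (a + b ·ω) = begin
    re (φ (a + b ·ω)) ℚ.+ re (φ (a + b ·ω))
      ≡⟨ solve 5 (λ a b r q D → (a :+ (b :* r :+ D :* (con (+ 0) :* q))) :+ (a :+ (b :* r :+ D :* (con (+ 0) :* q)))
           := con (+ 2) :* a :+ (r :+ r) :* b) refl (ι a) (ι b) r q Dℚ ⟩
    ι (+ 2) ℚ.* ι a ℚ.+ (r ℚ.+ r) ℚ.* ι b  ≡⟨ cong (λ z → ι (+ 2) ℚ.* ι a ℚ.+ z ℚ.* ι b) re-ω ⟩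
    ι (+ 2) ℚ.* ι a ℚ.+ ι t ℚ.* ι b        ≡⟨ sym (cong₂ ℚ._+_ (ι-* (+ 2) a) (ι-* t b)) ⟩
    ι (+ 2 ℤ.* a) ℚ.+ ι (t ℤ.* b)          ≡⟨ sym (ι-+ (+ 2 ℤ.* a) (t ℤ.* b)) ⟩
    ι (tr (a + b ·ω)) ∎
    where
    open ℚS
    open ≡-Reasoning

  im-φ : ∀ z → im (φ z) ℚ.+ im (φ z) ≡ ι (s ℤ.* irr z)
  im-φ (a + b ·ω) = begin
    im (φ (a + b ·ω)) ℚ.+ im (φ (a + b ·ω))
      ≡⟨ solve 3 (λ b r q → (con (+ 0) :+ (b :* q :+ con (+ 0) :* r)) :+ (con (+ 0) :+ (b :* q :+ con (+ 0) :* r))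
           := (q :+ q) :* b) refl (ι b) r q ⟩
    (q ℚ.+ q) ℚ.* ι b  ≡⟨ cong (ℚ._* ι b) im-ω ⟩
    ι s ℚ.* ι b        ≡⟨ sym (ι-* s b) ⟩
    ι (s ℤ.* b) ∎
    where
    open ℚS
    open ≡-Reasoning

  -- Doubled, the two coordinates of `φ z` are `tr z` and `s · irr z`; cancelling `s` gives `irr z`,
  -- and then the trace gives `rat z`.
  φ-injective : ∀ {x y} → φ x ≡ φ y → x ≡ y
  φ-injective {a + b ·ω} {a′ + b′ ·ω} eq = cong₂ _+_·ω a≡ b≡
    where
    b≡ : b ≡ b′
    b≡ = ℤₚ.*-cancelˡ-≡ s b b′ {{ℤ.≢-nonZero (λ e → ℤₚ.<-irrefl (sym e) 0<s)}}
      (ι-injective (trans (sym (im-φ (a + b ·ω))) (trans (cong (λ z → im z ℚ.+ im z) eq) (im-φ (a′ + b′ ·ω)))))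
    tr≡ : tr (a + b ·ω) ≡ tr (a′ + b′ ·ω)
    tr≡ = ι-injective (trans (sym (re-φ (a + b ·ω))) (trans (cong (λ z → re z ℚ.+ re z) eq) (re-φ (a′ + b′ ·ω))))
    a≡ : a ≡ a′
    a≡ = ℤₚ.*-cancelˡ-≡ (+ 2) a a′
      (ℤG.∙-cancelʳ (t ℤ.* b) (+ 2 ℤ.* a) (+ 2 ℤ.* a′) (trans tr≡ (cong (λ z → + 2 ℤ.* a′ ℤ.+ t ℤ.* z) (sym b≡))))

  double-< : ∀ {x y} → x ℚ.< y → x ℚ.+ x ℚ.< y ℚ.+ y
  double-< lt = ℚₚ.+-mono-< lt lt

  halve-< : ∀ {x y} → x ℚ.+ x ℚ.< y ℚ.+ y → x ℚ.< y
  halve-< {x} {y} lt = ℚₚ.≰⇒> (λ y≤x → ℚₚ.<-irrefl refl (ℚₚ.<-≤-trans lt (ℚₚ.+-mono-≤ y≤x y≤x)))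

  private
    quadruple-im : ∀ z → let y = im (φ z) ; u = Dℚ ℚ.* (y ℚ.* y) in
      (u ℚ.+ u) ℚ.+ (u ℚ.+ u) ≡ ι (Δ ℤ.* (irr z ℤ.* irr z))
    quadruple-im z@(a + b ·ω) = begin
      _ ≡⟨ solve 2 (λ D y → (D :* (y :* y) :+ D :* (y :* y)) :+ (D :* (y :* y) :+ D :* (y :* y)) := (y :+ y) :* (y :+ y) :* D) refl Dℚ (im (φ z)) ⟩
      (im (φ z) ℚ.+ im (φ z)) ℚ.* (im (φ z) ℚ.+ im (φ z)) ℚ.* Dℚ ≡⟨ cong (λ w → w ℚ.* w ℚ.* Dℚ) (im-φ z) ⟩
      ι (s ℤ.* b) ℚ.* ι (s ℤ.* b) ℚ.* Dℚ            ≡⟨ cong (ℚ._* Dℚ) (sym (ι-* (s ℤ.* b) (s ℤ.* b))) ⟩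
      ι ((s ℤ.* b) ℤ.* (s ℤ.* b)) ℚ.* ι (+ D)       ≡⟨ sym (ι-* ((s ℤ.* b) ℤ.* (s ℤ.* b)) (+ D)) ⟩
      ι ((s ℤ.* b) ℤ.* (s ℤ.* b) ℤ.* + D)           ≡⟨ cong ι (ℤS.solve 3 (λ s b D → (s ℤS.:* b) ℤS.:* (s ℤS.:* b) ℤS.:* D ℤS.:= s ℤS.:* s ℤS.:* D ℤS.:* (b ℤS.:* b)) refl s b (+ D)) ⟩
      ι (s ℤ.* s ℤ.* + D ℤ.* (b ℤ.* b))             ≡⟨ cong (λ w → ι (w ℤ.* (b ℤ.* b))) s²D ⟩
      ι (Δ ℤ.* (b ℤ.* b)) ∎
      where
      open ℚS
      open ≡-Reasoning

    quadruple-re : ∀ z → let x = re (φ z) ; u = x ℚ.* x in (u ℚ.+ u) ℚ.+ (u ℚ.+ u) ≡ ι (tr z ℤ.* tr z)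
    quadruple-re z = begin
      _ ≡⟨ solve 1 (λ x → (x :* x :+ x :* x) :+ (x :* x :+ x :* x) := (x :+ x) :* (x :+ x)) refl (re (φ z)) ⟩
      (re (φ z) ℚ.+ re (φ z)) ℚ.* (re (φ z) ℚ.+ re (φ z)) ≡⟨ cong (λ w → w ℚ.* w) (re-φ z) ⟩
      ι (tr z) ℚ.* ι (tr z)  ≡⟨ sym (ι-* (tr z) (tr z)) ⟩
      ι (tr z ℤ.* tr z) ∎
      where
      open ℚS
      open ≡-Reasoning

  φ-reflects-positive : ∀ z → TotallyPositive (φ z) → Positive z
  φ-reflects-positive z (0<re , lt) =
    ι-cancel-< (subst (0ℚ ℚ.<_) (re-φ z) (double-< 0<re)) ,
    ι-cancel-< (subst₂ ℚ._<_ (quadruple-im z) (quadruple-re z) (double-< (double-< lt)))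

  φ-preserves-positive : ∀ z → Positive z → IsTotPosInt (φ z)
  φ-preserves-positive z@(a + b ·ω) (0<tr , lt) = (a , b , refl) ,
    halve-< (subst (0ℚ ℚ.<_) (sym (re-φ z)) (ι-mono-< 0<tr)) ,
    halve-< (halve-< (subst₂ ℚ._<_ (sym (quadruple-im z)) (sym (quadruple-re z)) (ι-mono-< lt)))

-- Ternary quadratic forms and Gram determinants

pattern 0′ = zero
pattern 1′ = suc zero
pattern 2′ = suc (suc zero)

module Ternary {c ℓ} (R : CommutativeRing c ℓ) where
  open CommutativeRing R renaming (refl to ≈-refl; sym to ≈-sym; trans to ≈-trans)
  open IntegerSolver R

  Vec Mat : Set c
  Vec = Fin 3 → Carrier
  Mat = Fin 3 → Fin 3 → Carrier

  sum₃ : Vec → Carrier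
  sum₃ f = f 0′ + (f 1′ + (f 2′ + 0#))

  sum₃-cong : ∀ {f g} → (∀ i → f i ≈ g i) → sum₃ f ≈ sum₃ g
  sum₃-cong eq = +-cong (eq 0′) (+-cong (eq 1′) (+-congʳ (eq 2′)))

  quad : Mat → Vec → Carrier
  quad a v = sum₃ λ i → sum₃ λ j → a i j * v i * v j

  polar : Mat → Vec → Vec → Carrier
  polar a v w = sum₃ λ i → sum₃ λ j → (a i j + a j i) * v i * w j

  quad-cong : ∀ a {v w} → (∀ i → v i ≈ w i) → quad a v ≈ quad a w
  quad-cong a eq = sum₃-cong λ i → sum₃-cong λ j → *-cong (*-congˡ {a i j} (eq i)) (eq j)

  polar-congʳ : ∀ a v {w u} → (∀ i → w i ≈ u i) → polar a v w ≈ polar a v u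
  polar-congʳ a v eq = sum₃-cong λ i → sum₃-cong λ j → *-congˡ {(a i j + a j i) * v i} (eq j)

  private
    sum₃ᴾ : ∀ {n} → (Fin 3 → Polynomial n) → Polynomial n
    sum₃ᴾ f = f 0′ :+ (f 1′ :+ (f 2′ :+ con (+ 0)))

    quadᴾ : ∀ {n} → (Fin 3 → Fin 3 → Polynomial n) → (Fin 3 → Polynomial n) → Polynomial n
    quadᴾ a v = sum₃ᴾ λ i → sum₃ᴾ λ j → a i j :* v i :* v j

    polarᴾ : ∀ {n} → (Fin 3 → Fin 3 → Polynomial n) → (v w : Fin 3 → Polynomial n) → Polynomial n
    polarᴾ a v w = sum₃ᴾ λ i → sum₃ᴾ λ j → (a i j :+ a j i) :* v i :* w j

    vecᴾ : ∀ {A : Set} → A → A → A → Fin 3 → A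
    vecᴾ x y z 0′ = x
    vecᴾ x y z 1′ = y
    vecᴾ x y z 2′ = z

    matᴾ : ∀ {A : Set} → A → A → A → A → A → A → A → A → A → Fin 3 → Fin 3 → A
    matᴾ a b c d e f g h i = vecᴾ′ (vecᴾ a b c) (vecᴾ d e f) (vecᴾ g h i)
      where
      vecᴾ′ : ∀ {A : Set} → A → A → A → Fin 3 → A
      vecᴾ′ = vecᴾ

  quad-comb : ∀ a x v y w → quad a (λ i → x * v i + y * w i) ≈ x * x * quad a v + x * y * polar a v w + y * y * quad a w
  quad-comb a x v y w = solve 17 (λ a₀₀ a₀₁ a₀₂ a₁₀ a₁₁ a₁₂ a₂₀ a₂₁ a₂₂ x v₀ v₁ v₂ y w₀ w₁ w₂ →
      let A = matᴾ a₀₀ a₀₁ a₀₂ a₁₀ a₁₁ a₁₂ a₂₀ a₂₁ a₂₂ ; V = vecᴾ v₀ v₁ v₂ ; W = vecᴾ w₀ w₁ w₂ in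
      quadᴾ A (λ i → x :* V i :+ y :* W i) := x :* x :* quadᴾ A V :+ x :* y :* polarᴾ A V W :+ y :* y :* quadᴾ A W) ≈-refl
    (a 0′ 0′) (a 0′ 1′) (a 0′ 2′) (a 1′ 0′) (a 1′ 1′) (a 1′ 2′) (a 2′ 0′) (a 2′ 1′) (a 2′ 2′)
    x (v 0′) (v 1′) (v 2′) y (w 0′) (w 1′) (w 2′)

  polar-comb : ∀ a x v y w u → polar a u (λ i → x * v i + y * w i) ≈ x * polar a u v + y * polar a u w
  polar-comb a x v y w u = solve 20 (λ a₀₀ a₀₁ a₀₂ a₁₀ a₁₁ a₁₂ a₂₀ a₂₁ a₂₂ x v₀ v₁ v₂ y w₀ w₁ w₂ u₀ u₁ u₂ →
      let A = matᴾ a₀₀ a₀₁ a₀₂ a₁₀ a₁₁ a₁₂ a₂₀ a₂₁ a₂₂ ; V = vecᴾ v₀ v₁ v₂ ; W = vecᴾ w₀ w₁ w₂ ; U = vecᴾ u₀ u₁ u₂ in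
      polarᴾ A U (λ i → x :* V i :+ y :* W i) := x :* polarᴾ A U V :+ y :* polarᴾ A U W) ≈-refl
    (a 0′ 0′) (a 0′ 1′) (a 0′ 2′) (a 1′ 0′) (a 1′ 1′) (a 1′ 2′) (a 2′ 0′) (a 2′ 1′) (a 2′ 2′)
    x (v 0′) (v 1′) (v 2′) y (w 0′) (w 1′) (w 2′) (u 0′) (u 1′) (u 2′)

  polar-sym : ∀ a v w → polar a v w ≈ polar a w v
  polar-sym a v w = solve 15 (λ a₀₀ a₀₁ a₀₂ a₁₀ a₁₁ a₁₂ a₂₀ a₂₁ a₂₂ v₀ v₁ v₂ w₀ w₁ w₂ →
      let A = matᴾ a₀₀ a₀₁ a₀₂ a₁₀ a₁₁ a₁₂ a₂₀ a₂₁ a₂₂ ; V = vecᴾ v₀ v₁ v₂ ; W = vecᴾ w₀ w₁ w₂ in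
      polarᴾ A V W := polarᴾ A W V) ≈-refl
    (a 0′ 0′) (a 0′ 1′) (a 0′ 2′) (a 1′ 0′) (a 1′ 1′) (a 1′ 2′) (a 2′ 0′) (a 2′ 1′) (a 2′ 2′)
    (v 0′) (v 1′) (v 2′) (w 0′) (w 1′) (w 2′)

  polar-self : ∀ a v → polar a v v ≈ quad a v + quad a v
  polar-self a v = solve 12 (λ a₀₀ a₀₁ a₀₂ a₁₀ a₁₁ a₁₂ a₂₀ a₂₁ a₂₂ v₀ v₁ v₂ →
      let A = matᴾ a₀₀ a₀₁ a₀₂ a₁₀ a₁₁ a₁₂ a₂₀ a₂₁ a₂₂ ; V = vecᴾ v₀ v₁ v₂ in
      polarᴾ A V V := quadᴾ A V :+ quadᴾ A V) ≈-refl
    (a 0′ 0′) (a 0′ 1′) (a 0′ 2′) (a 1′ 0′) (a 1′ 1′) (a 1′ 2′) (a 2′ 0′) (a 2′ 1′) (a 2′ 2′)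
    (v 0′) (v 1′) (v 2′)

  det : Mat → Carrier
  det m = m 0′ 0′ * (m 1′ 1′ * m 2′ 2′ - m 1′ 2′ * m 2′ 1′)
        - m 0′ 1′ * (m 1′ 0′ * m 2′ 2′ - m 1′ 2′ * m 2′ 0′)
        + m 0′ 2′ * (m 1′ 0′ * m 2′ 1′ - m 1′ 1′ * m 2′ 0′)

  det-cong : ∀ {m n} → (∀ i j → m i j ≈ n i j) → det m ≈ det n
  det-cong e =
    +-cong (+-cong (*-cong (e 0′ 0′) (-‿cong₂ (*-cong (e 1′ 1′) (e 2′ 2′)) (*-cong (e 1′ 2′) (e 2′ 1′))))
                   (-‿cong (*-cong (e 0′ 1′) (-‿cong₂ (*-cong (e 1′ 0′) (e 2′ 2′)) (*-cong (e 1′ 2′) (e 2′ 0′))))))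
           (*-cong (e 0′ 2′) (-‿cong₂ (*-cong (e 1′ 0′) (e 2′ 1′)) (*-cong (e 1′ 1′) (e 2′ 0′))))
    where
    -‿cong₂ : ∀ {x y u v} → x ≈ u → y ≈ v → x - y ≈ u - v
    -‿cong₂ p q = +-cong p (-‿cong q)

  infixl 7 _·_
  _·_ : Mat → Mat → Mat
  (m · n) i j = m i 0′ * n 0′ j + m i 1′ * n 1′ j + m i 2′ * n 2′ j

  private
    detᴾ : ∀ {n} → (Fin 3 → Fin 3 → Polynomial n) → Polynomial n
    detᴾ m = m 0′ 0′ :* (m 1′ 1′ :* m 2′ 2′ :- m 1′ 2′ :* m 2′ 1′)
           :- m 0′ 1′ :* (m 1′ 0′ :* m 2′ 2′ :- m 1′ 2′ :* m 2′ 0′)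
           :+ m 0′ 2′ :* (m 1′ 0′ :* m 2′ 1′ :- m 1′ 1′ :* m 2′ 0′)

  det-· : ∀ m n → det (m · n) ≈ det m * det n
  det-· m n = solve 18 (λ a b c d e f g h i a′ b′ c′ d′ e′ f′ g′ h′ i′ →
      let M = matᴾ a b c d e f g h i ; N = matᴾ a′ b′ c′ d′ e′ f′ g′ h′ i′ in
      detᴾ (λ i j → M i 0′ :* N 0′ j :+ M i 1′ :* N 1′ j :+ M i 2′ :* N 2′ j) := detᴾ M :* detᴾ N) ≈-refl
    (m 0′ 0′) (m 0′ 1′) (m 0′ 2′) (m 1′ 0′) (m 1′ 1′) (m 1′ 2′) (m 2′ 0′) (m 2′ 1′) (m 2′ 2′)
    (n 0′ 0′) (n 0′ 1′) (n 0′ 2′) (n 1′ 0′) (n 1′ 1′) (n 1′ 2′) (n 2′ 0′) (n 2′ 1′) (n 2′ 2′)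

  gram : Mat → (x y : Fin 3 → Vec) → Mat
  gram a x y i j = polar a (x i) (y j)

  -- The Gram matrix of two triples is the coordinate matrix of `x` times the symmetrised form times
  -- the transposed coordinate matrix of `y`. All three are square because the ambient dimension is
  -- 3.
  det-gram : ∀ a x y → det (gram a x y) ≈ det x * (det (λ i j → a i j + a j i) * det (λ i j → y j i))
  det-gram a x y = ≈-trans (det-cong gram≈) (≈-trans (det-· x (S · yᵀ)) (*-congˡ (det-· S yᵀ)))
    where
    S yᵀ : Mat
    S i j = a i j + a j i
    yᵀ i j = y j i
    gram≈ : ∀ i j → gram a x y i j ≈ (x · (S · yᵀ)) i j
    gram≈ i j = solve 15 (λ a₀₀ a₀₁ a₀₂ a₁₀ a₁₁ a₁₂ a₂₀ a₂₁ a₂₂ v₀ v₁ v₂ w₀ w₁ w₂ →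
      let A = matᴾ a₀₀ a₀₁ a₀₂ a₁₀ a₁₁ a₁₂ a₂₀ a₂₁ a₂₂ ; V = vecᴾ v₀ v₁ v₂ ; W = vecᴾ w₀ w₁ w₂
          SW = λ i → (A i 0′ :+ A 0′ i) :* W 0′ :+ (A i 1′ :+ A 1′ i) :* W 1′ :+ (A i 2′ :+ A 2′ i) :* W 2′ in
      polarᴾ A V W := V 0′ :* SW 0′ :+ V 1′ :* SW 1′ :+ V 2′ :* SW 2′) ≈-refl
      (a 0′ 0′) (a 0′ 1′) (a 0′ 2′) (a 1′ 0′) (a 1′ 1′) (a 1′ 2′) (a 2′ 0′) (a 2′ 1′) (a 2′ 2′)
      (x i 0′) (x i 1′) (x i 2′) (y j 0′) (y j 1′) (y j 2′)

  -- By `det-gram` a Gram determinant is a factor depending on the left triple times a factor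
  -- depending on the right triple, so the right triples of two determinants may be interchanged.
  det-gram-exchange : ∀ a x y u w →
    det (gram a x y) * det (gram a u w) ≈ det (gram a x w) * det (gram a u y)
  det-gram-exchange a x y u w =
    ≈-trans (*-cong (det-gram a x y) (det-gram a u w))
      (≈-trans (solve 5 (λ p q r s t → (p :* (q :* r)) :* (s :* (q :* t)) := (p :* (q :* t)) :* (s :* (q :* r))) ≈-refl
                 (det x) (det (λ i j → a i j + a j i)) (det (λ i j → y j i)) (det u) (det (λ i j → w j i)))
        (≈-sym (*-cong (det-gram a x w) (det-gram a u y))))

module GramTransport {c ℓ c′ ℓ′} (R : CommutativeRing c ℓ) (S : CommutativeRing c′ ℓ′)
  (φ : CommutativeRing.Carrier R → CommutativeRing.Carrier S)
  (φ-injective : ∀ {x y} → CommutativeRing._≈_ S (φ x) (φ y) → CommutativeRing._≈_ R x y)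
  (φ-+ : ∀ x y → CommutativeRing._≈_ S (φ (CommutativeRing._+_ R x y)) (CommutativeRing._+_ S (φ x) (φ y)))
  (φ-* : ∀ x y → CommutativeRing._≈_ S (φ (CommutativeRing._*_ R x y)) (CommutativeRing._*_ S (φ x) (φ y)))
  (φ-neg : ∀ x → CommutativeRing._≈_ S (φ (CommutativeRing.-_ R x)) (CommutativeRing.-_ S (φ x)))
  where
  private
    module R = CommutativeRing R
    module S = CommutativeRing S
    module TR = Ternary R
    module TS = Ternary S

  φ-sub : ∀ x y → φ (x R.- y) S.≈ φ x S.- φ y
  φ-sub x y = S.trans (φ-+ x (R.- y)) (S.+-congˡ (φ-neg y))

  φ-det : ∀ m → φ (TR.det m) S.≈ TS.det (λ i j → φ (m i j))
  φ-det m = S.trans (φ-+ _ _)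
    (S.+-cong (S.trans (φ-sub _ _) (S.+-cong (minor 0′ 0′ 1′ 1′ 2′ 2′) (S.-‿cong (minor 0′ 1′ 1′ 0′ 2′ 2′)))) (minor 0′ 2′ 1′ 0′ 2′ 1′))
    where
    minor : ∀ i j k l p q →
      φ (m i j R.* (m k l R.* m p q R.- m k q R.* m p l)) S.≈ φ (m i j) S.* (φ (m k l) S.* φ (m p q) S.- φ (m k q) S.* φ (m p l))
    minor i j k l p q = S.trans (φ-* _ _)
      (S.*-congˡ (S.trans (φ-sub _ _) (S.+-cong (φ-* _ _) (S.-‿cong (φ-* _ _)))))

  -- The vectors have coordinates in `S` only, while the values of `T` lie in `R`. The identity is
  -- therefore proved in `S` and pulled back along the injection `φ`.
  det-gram-exchange : ∀ {v} {V : Set v} (a : TS.Mat) (vec : V → TS.Vec) (T : V → V → R.Carrier) →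
    (∀ v w → φ (T v w) S.≈ TS.polar a (vec v) (vec w)) → (x y u w : Fin 3 → V) →
    TR.det (λ i j → T (x i) (y j)) R.* TR.det (λ i j → T (u i) (w j)) R.≈ TR.det (λ i j → T (x i) (w j)) R.* TR.det (λ i j → T (u i) (y j))
  det-gram-exchange a vec T φ-T x y u w = φ-injective (S.trans (step x y u w)
    (S.trans (TS.det-gram-exchange a (λ i → vec (x i)) (λ i → vec (y i)) (λ i → vec (u i)) (λ i → vec (w i))) (S.sym (step x w u y))))
    where
    φ-gram : ∀ x y → φ (TR.det (λ i j → T (x i) (y j))) S.≈ TS.det (TS.gram a (λ i → vec (x i)) (λ i → vec (y i)))
    φ-gram x y = S.trans (φ-det (λ i j → T (x i) (y j))) (TS.det-cong (λ i j → φ-T (x i) (y j)))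
    step : ∀ x y u w → φ (TR.det (λ i j → T (x i) (y j)) R.* TR.det (λ i j → T (u i) (w j)))
      S.≈ TS.det (TS.gram a (λ i → vec (x i)) (λ i → vec (y i))) S.* TS.det (TS.gram a (λ i → vec (u i)) (λ i → vec (w i)))
    step x y u w = S.trans (φ-* _ _) (S.*-cong (φ-gram x y) (φ-gram u w))

-- Total positivity

0≤*0≤ : ∀ {i j} → + 0 ℤ.≤ i → + 0 ℤ.≤ j → + 0 ℤ.≤ i ℤ.* j
0≤*0≤ {+ m} {+ n} _ _ = subst (+ 0 ℤ.≤_) (ℤₚ.pos-* m n) (+≤+ z≤n)

0<*0< : ∀ {i j} → + 0 ℤ.< i → + 0 ℤ.< j → + 0 ℤ.< i ℤ.* j
0<*0< {+[1+ m ]} {+[1+ n ]} _ _ = +<+ (s≤s z≤n)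
0<*0< {+0} (+<+ ())
0<*0< {+[1+ _ ]} {+0} _ (+<+ ())

0≤i² : ∀ i → + 0 ℤ.≤ i ℤ.* i
0≤i² (+ n)    = 0≤*0≤ {+ n} {+ n} (+≤+ z≤n) (+≤+ z≤n)
0≤i² -[1+ n ] = +≤+ z≤n

≤-squares⁻¹ : ∀ {i j} → + 0 ℤ.≤ j → i ℤ.* i ℤ.≤ j ℤ.* j → i ℤ.≤ j
≤-squares⁻¹ { -[1+ _ ]} {+ _} _ _ = ℤ.-≤+
≤-squares⁻¹ {+ m} {+ n} _ le = +≤+ (m≤n m n (ℤₚ.drop‿+≤+ (subst₂ ℤ._≤_ (sym (ℤₚ.pos-* m m)) (sym (ℤₚ.pos-* n n)) le)))
  where
  m≤n : ∀ m n → m ℕ.* m ℕ.≤ n ℕ.* n → m ℕ.≤ n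
  m≤n m n mm≤nn = ℕₚ.≮⇒≥ (λ n<m → ℕₚ.<⇒≱ (ℕₚ.*-mono-< n<m n<m) mm≤nn)

0≤-cancelˡ : ∀ n {i} → + 0 ℤ.< n → + 0 ℤ.≤ n ℤ.* i → + 0 ℤ.≤ i
0≤-cancelˡ n {i} 0<n le = ℤₚ.*-cancelˡ-≤-pos (+ 0) i n {{ℤ.positive 0<n}} (subst (ℤ._≤ n ℤ.* i) (sym (ℤₚ.*-zeroʳ n)) le)

0<-cancelˡ : ∀ n {i} → + 0 ℤ.≤ n → + 0 ℤ.< n ℤ.* i → + 0 ℤ.< i
0<-cancelˡ n {i} 0≤n lt = ℤₚ.*-cancelˡ-<-nonNeg n {{ℤ.nonNegative 0≤n}} (subst (ℤ._< n ℤ.* i) (sym (ℤₚ.*-zeroʳ n)) lt)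

module Positivity (t c : ℤ) where
  open Order t c

  -- Four times the field norm, a scaling that avoids halves and accounts for the factor 4 in
  -- `nm-⊗`.
  nm : O → ℤ
  nm z = tr z ℤ.* tr z ℤ.- Δ ℤ.* (irr z ℤ.* irr z)

  conj : O → O
  conj (a + b ·ω) = (a ℤ.+ t ℤ.* b) + (ℤ.- b) ·ω

  tr-⊗ : ∀ z w → + 2 ℤ.* tr (z ⊗ w) ≡ tr z ℤ.* tr w ℤ.+ Δ ℤ.* (irr z ℤ.* irr w)
  tr-⊗ (a + b ·ω) (a′ + b′ ·ω) = solve 6 (λ a b a′ b′ t c →
      con (+ 2) :* (con (+ 2) :* (a :* a′ :+ c :* (b :* b′)) :+ t :* (a :* b′ :+ b :* a′ :+ t :* (b :* b′)))
      := (con (+ 2) :* a :+ t :* b) :* (con (+ 2) :* a′ :+ t :* b′) :+ (t :* t :+ con (+ 4) :* c) :* (b :* b′)) refl a b a′ b′ t c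
    where open ℤS

  nm-⊗ : ∀ z w → + 4 ℤ.* nm (z ⊗ w) ≡ nm z ℤ.* nm w
  nm-⊗ (a + b ·ω) (a′ + b′ ·ω) = solve 6 (λ a b a′ b′ t c →
      let T = λ a b → con (+ 2) :* a :+ t :* b
          D = t :* t :+ con (+ 4) :* c
          N = λ a b → T a b :* T a b :- D :* (b :* b) in
      con (+ 4) :* N (a :* a′ :+ c :* (b :* b′)) (a :* b′ :+ b :* a′ :+ t :* (b :* b′)) := N a b :* N a′ b′) refl a b a′ b′ t c
    where open ℤS

  NonNegative⇒0≤nm : ∀ {z} → NonNegative z → + 0 ℤ.≤ nm z
  NonNegative⇒0≤nm (_ , le) = ℤₚ.i≤j⇒0≤j-i le

  mkNonNegative : ∀ {z} → + 0 ℤ.≤ tr z → + 0 ℤ.≤ nm z → NonNegative z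
  mkNonNegative 0≤tr 0≤nm = 0≤tr , ℤₚ.0≤i-j⇒j≤i 0≤nm

  Positive⇒NonNegative : ∀ z → Positive z → NonNegative z
  Positive⇒NonNegative z (p , q) = ℤₚ.<⇒≤ p , ℤₚ.<⇒≤ q

  module _ (0≤Δ : + 0 ℤ.≤ Δ) where

    -- The norm is multiplicative. For the trace, multiplying the two discriminant inequalities
    -- gives `(Δ b b′)² ≤ (X Y)²`, so the cross term in `tr-⊗` cannot outweigh `X Y`.
    NonNegative-⊗ : ∀ z w → NonNegative z → NonNegative w → NonNegative (z ⊗ w)
    NonNegative-⊗ z w pz@(0≤z , zz) pw@(0≤w , ww) = mkNonNegative {z ⊗ w}
      (0≤-cancelˡ (+ 2) (+<+ (s≤s z≤n)) (subst (+ 0 ℤ.≤_) (sym (trans (tr-⊗ z w) shuffle)) (ℤₚ.i≤j⇒0≤j-i cross≤)))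
      (0≤-cancelˡ (+ 4) (+<+ (s≤s z≤n)) (subst (+ 0 ℤ.≤_) (sym (nm-⊗ z w)) (0≤*0≤ (NonNegative⇒0≤nm {z} pz) (NonNegative⇒0≤nm {w} pw))))
      where
      X = tr z ; Y = tr w ; b = irr z ; b′ = irr w
      shuffle : X ℤ.* Y ℤ.+ Δ ℤ.* (b ℤ.* b′) ≡ X ℤ.* Y ℤ.- ℤ.- (Δ ℤ.* (b ℤ.* b′))
      shuffle = ℤS.solve 2 (λ u v → u ℤS.:+ v ℤS.:= u ℤS.:- (ℤS.:- v)) refl (X ℤ.* Y) (Δ ℤ.* (b ℤ.* b′))
      cross≤ : ℤ.- (Δ ℤ.* (b ℤ.* b′)) ℤ.≤ X ℤ.* Y
      cross≤ = ≤-squares⁻¹ (0≤*0≤ 0≤z 0≤w) (subst₂ ℤ._≤_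
        (ℤS.solve 3 (λ D b b′ → (D ℤS.:* (b ℤS.:* b)) ℤS.:* (D ℤS.:* (b′ ℤS.:* b′)) ℤS.:= (ℤS.:- (D ℤS.:* (b ℤS.:* b′))) ℤS.:* (ℤS.:- (D ℤS.:* (b ℤS.:* b′)))) refl Δ b b′)
        (ℤS.solve 2 (λ X Y → (X ℤS.:* X) ℤS.:* (Y ℤS.:* Y) ℤS.:= (X ℤS.:* Y) ℤS.:* (X ℤS.:* Y)) refl X Y)
        (ℤₚ.≤-trans (ℤₚ.*-monoʳ-≤-nonNeg (Δ ℤ.* (b′ ℤ.* b′)) {{ℤ.nonNegative (0≤*0≤ 0≤Δ (0≤i² b′))}} zz)
                    (ℤₚ.*-monoˡ-≤-nonNeg (X ℤ.* X) {{ℤ.nonNegative (0≤i² X)}} ww)))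

    -- Multiplying by the conjugate of `q` replaces the factor `q` by its norm `N`, a positive
    -- integer, which then cancels from the trace and, squared, from the norm.
    NonNegative-cancelˡ : ∀ q x → Positive q → NonNegative (q ⊗ x) → NonNegative x
    NonNegative-cancelˡ q@(a + b ·ω) x@(d + e ·ω) (0<q , qq) qx = mkNonNegative {x} 0≤trx 0≤nmx
      where
      open ℤS
      N = a ℤ.* a ℤ.+ t ℤ.* (a ℤ.* b) ℤ.- c ℤ.* (b ℤ.* b)
      tr-conj : tr (conj q) ≡ tr q
      tr-conj = solve 3 (λ a b t → con (+ 2) :* (a :+ t :* b) :+ t :* (:- b) := con (+ 2) :* a :+ t :* b) refl a b t
      conj-nonNeg : NonNegative (conj q)
      conj-nonNeg = subst (+ 0 ℤ.≤_) (sym tr-conj) (ℤₚ.<⇒≤ 0<q) ,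
        subst₂ ℤ._≤_ (solve 2 (λ D b → D :* (b :* b) := D :* ((:- b) :* (:- b))) refl Δ b) (cong (λ u → u ℤ.* u) (sym tr-conj)) (ℤₚ.<⇒≤ qq)
      4N : + 4 ℤ.* N ≡ nm q
      4N = solve 4 (λ a b t c → con (+ 4) :* (a :* a :+ t :* (a :* b) :- c :* (b :* b))
             := (con (+ 2) :* a :+ t :* b) :* (con (+ 2) :* a :+ t :* b) :- (t :* t :+ con (+ 4) :* c) :* (b :* b)) refl a b t c
      0<N : + 0 ℤ.< N
      0<N = 0<-cancelˡ (+ 4) (+≤+ z≤n) (subst (+ 0 ℤ.<_) (sym 4N) (subst (ℤ._< nm q) (ℤₚ.+-inverseʳ (Δ ℤ.* (b ℤ.* b))) (ℤₚ.+-monoˡ-< (ℤ.- (Δ ℤ.* (b ℤ.* b))) qq)))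
      Nx = NonNegative-⊗ (conj q) (q ⊗ x) conj-nonNeg qx
      trNx : tr (conj q ⊗ (q ⊗ x)) ≡ N ℤ.* tr x
      trNx = solve 6 (λ a b d e t c →
        let P₁ = a :* d :+ c :* (b :* e) ; P₂ = a :* e :+ b :* d :+ t :* (b :* e) ; C₁ = a :+ t :* b ; C₂ = :- b in
        con (+ 2) :* (C₁ :* P₁ :+ c :* (C₂ :* P₂)) :+ t :* (C₁ :* P₂ :+ C₂ :* P₁ :+ t :* (C₂ :* P₂))
        := (a :* a :+ t :* (a :* b) :- c :* (b :* b)) :* (con (+ 2) :* d :+ t :* e)) refl a b d e t c
      nmNx : nm (conj q ⊗ (q ⊗ x)) ≡ (N ℤ.* N) ℤ.* nm x
      nmNx = trans (cong₂ (λ u v → u ℤ.* u ℤ.- Δ ℤ.* (v ℤ.* v)) trNx imNx)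
        (solve 4 (λ N u D v → (N :* u) :* (N :* u) :- D :* ((N :* v) :* (N :* v)) := (N :* N) :* (u :* u :- D :* (v :* v))) refl N (tr x) Δ e)
        where
        imNx : irr (conj q ⊗ (q ⊗ x)) ≡ N ℤ.* e
        imNx = solve 6 (λ a b d e t c →
          let P₁ = a :* d :+ c :* (b :* e) ; P₂ = a :* e :+ b :* d :+ t :* (b :* e) ; C₁ = a :+ t :* b ; C₂ = :- b in
          C₁ :* P₂ :+ C₂ :* P₁ :+ t :* (C₂ :* P₂) := (a :* a :+ t :* (a :* b) :- c :* (b :* b)) :* e) refl a b d e t c
      0≤trx : + 0 ℤ.≤ tr x
      0≤trx = 0≤-cancelˡ N 0<N (subst (+ 0 ℤ.≤_) trNx (proj₁ Nx))
      0≤nmx : + 0 ℤ.≤ nm x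
      0≤nmx = 0≤-cancelˡ (N ℤ.* N) (0<*0< 0<N 0<N) (subst (+ 0 ℤ.≤_) nmNx (NonNegative⇒0≤nm {conj q ⊗ (q ⊗ x)} Nx))

  open Ternary O-commutativeRing using (det)

  -- The properties of the lattice from which the contradiction is derived, with all values in the
  -- order. Elements of `V` play the role of coefficient tuples, several of which may give the same
  -- vector; the second case of `Q-pos` is that of a tuple giving the zero vector. Universality is
  -- `repr`, and the dimension 3 enters through `gram-exchange`.
  record Model : Set₁ where
    field
      V      : Set
      Q      : V → O
      T      : V → V → O
      T-sym  : ∀ v w → T v w ≡ T w v
      T-self : ∀ v → T v v ≡ Q v ⊕ Q v
      lin    : O → V → O → V → V
      Q-lin  : ∀ x v y w → Q (lin x v y w) ≡ x ⊗ x ⊗ Q v ⊕ x ⊗ y ⊗ T v w ⊕ y ⊗ y ⊗ Q w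
      T-lin  : ∀ u x v y w → T u (lin x v y w) ≡ x ⊗ T u v ⊕ y ⊗ T u w
      Q-pos  : ∀ v → Positive (Q v) ⊎ (Q v ≡ int (+ 0) × (∀ w → T w v ≡ int (+ 0)))
      repr   : ∀ α → Positive α → Σ V λ v → Q v ≡ α
      gram-exchange : (x y u w : Fin 3 → V) →
        det (λ i j → T (x i) (y j)) ⊗ det (λ i j → T (u i) (w j)) ≡ det (λ i j → T (x i) (w j)) ⊗ det (λ i j → T (u i) (y j))

-- Cauchy-Schwarz and the rank-one identity in a model

module ModelFacts (t c : ℤ) (0≤Δ : + 0 ℤ.≤ Order.Δ t c) (𝓜 : Positivity.Model t c) where
  open Order t c
  open Positivity t c
  open Model 𝓜
  private
    module TO = Ternary O-commutativeRing
    open TO using (det; det-cong)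
    open OS using (solve; _:=_; _:+_; _:*_; _:-_; :-_; con)

  NonNegative-0 : NonNegative (int (+ 0))
  NonNegative-0 = ℤₚ.≤-reflexive (sym (ℤS.solve 1 (λ t → ℤS.con (+ 2) ℤS.:* ℤS.con (+ 0) ℤS.:+ t ℤS.:* ℤS.con (+ 0) ℤS.:= ℤS.con (+ 0)) refl t)) ,
    ℤₚ.≤-reflexive (ℤS.solve 2 (λ t D → D ℤS.:* (ℤS.con (+ 0) ℤS.:* ℤS.con (+ 0))
      ℤS.:= (ℤS.con (+ 2) ℤS.:* ℤS.con (+ 0) ℤS.:+ t ℤS.:* ℤS.con (+ 0)) ℤS.:* (ℤS.con (+ 2) ℤS.:* ℤS.con (+ 0) ℤS.:+ t ℤS.:* ℤS.con (+ 0))) refl t Δ)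

  Q-nonNegative : ∀ v → NonNegative (Q v)
  Q-nonNegative v with Q-pos v
  ... | inj₁ p       = Positive⇒NonNegative (Q v) p
  ... | inj₂ (e , _) = subst NonNegative (sym e) NonNegative-0

  cauchySchwarz : ∀ v w → NonNegative (int (+ 4) ⊗ Q v ⊗ Q w ⊝ T v w ⊗ T v w)
  cauchySchwarz v w with Q-pos v
  ... | inj₂ (Qv≡0 , Tv≡0) = subst NonNegative (sym zero-diff) NonNegative-0
    where
    zero-diff : int (+ 4) ⊗ Q v ⊗ Q w ⊝ T v w ⊗ T v w ≡ int (+ 0)
    zero-diff = trans (cong₂ (λ q b → int (+ 4) ⊗ q ⊗ Q w ⊝ b ⊗ b) Qv≡0 (trans (T-sym v w) (Tv≡0 w)))
      (solve 1 (λ q → con (+ 4) :* con (+ 0) :* q :- con (+ 0) :* con (+ 0) := con (+ 0)) refl (Q w))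
  ... | inj₁ Qv>0 = NonNegative-cancelˡ 0≤Δ (Q v) (int (+ 4) ⊗ Q v ⊗ Q w ⊝ T v w ⊗ T v w) Qv>0 (subst NonNegative Qu≡ (Q-nonNegative u))
    where
    x = int (+ 2) ⊗ Q v
    -- The component of `w` orthogonal to `v`, scaled by `2 Q v` so that it stays in the lattice.
    -- Its norm is `Q v` times the difference in question.
    u = lin x w (⊖ T v w) v
    Qu≡ : Q u ≡ Q v ⊗ (int (+ 4) ⊗ Q v ⊗ Q w ⊝ T v w ⊗ T v w)
    Qu≡ = trans (Q-lin x w (⊖ T v w) v) (trans (cong (λ b → x ⊗ x ⊗ Q w ⊕ x ⊗ (⊖ T v w) ⊗ b ⊕ (⊖ T v w) ⊗ (⊖ T v w) ⊗ Q v) (T-sym w v))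
      (solve 3 (λ q r b → (con (+ 2) :* q) :* (con (+ 2) :* q) :* r :+ (con (+ 2) :* q) :* (:- b) :* b :+ (:- b) :* (:- b) :* q
        := q :* (con (+ 4) :* q :* r :- b :* b)) refl (Q v) (Q w) (T v w)))

  module Unit (v₁ : V) (Qv₁ : Q v₁ ≡ int (+ 1)) where

    B : V → O
    B v = T v₁ v

    N : V → O
    N v = int (+ 4) ⊗ Q v ⊝ B v ⊗ B v

    N-nonNegative : ∀ v → NonNegative (N v)
    N-nonNegative v = subst NonNegative (trans (cong (λ q → int (+ 4) ⊗ q ⊗ Q v ⊝ B v ⊗ B v) Qv₁)
      (solve 2 (λ q b → con (+ 4) :* con (+ 1) :* q :- b :* b := con (+ 4) :* q :- b :* b) refl (Q v) (B v))) (cauchySchwarz v₁ v)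

    M : V → V → O
    M v w = int (+ 2) ⊗ T v w ⊝ B v ⊗ B w

    private
      -- twice the projection of v onto the orthogonal complement of v₁
      proj : V → V
      proj v = lin (int (+ 2)) v (⊖ B v) v₁

      Tv₁v₁ : T v₁ v₁ ≡ int (+ 2)
      Tv₁v₁ = trans (T-self v₁) (cong₂ _⊕_ Qv₁ Qv₁)

      Q-proj : ∀ v → Q (proj v) ≡ N v
      Q-proj v = trans (Q-lin (int (+ 2)) v (⊖ B v) v₁)
        (trans (cong₂ (λ b q → int (+ 2) ⊗ int (+ 2) ⊗ Q v ⊕ int (+ 2) ⊗ (⊖ B v) ⊗ b ⊕ (⊖ B v) ⊗ (⊖ B v) ⊗ q) (T-sym v v₁) Qv₁)
          (solve 2 (λ q b → con (+ 2) :* con (+ 2) :* q :+ con (+ 2) :* (:- b) :* b :+ (:- b) :* (:- b) :* con (+ 1) := con (+ 4) :* q :- b :* b) refl (Q v) (B v)))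

      T-proj : ∀ v w → T (proj v) (proj w) ≡ int (+ 2) ⊗ M v w
      T-proj v w = trans (T-lin (proj v) (int (+ 2)) w (⊖ B w) v₁)
        (trans (cong₂ (λ x y → int (+ 2) ⊗ x ⊕ (⊖ B w) ⊗ y) (T-projˡ w) (T-projˡ v₁))
          (trans (cong₂ (λ x y → int (+ 2) ⊗ (int (+ 2) ⊗ x ⊕ (⊖ B v) ⊗ T w v₁) ⊕ (⊖ B w) ⊗ (int (+ 2) ⊗ B v ⊕ (⊖ B v) ⊗ y)) (T-sym w v) Tv₁v₁)
            (trans (cong (λ x → int (+ 2) ⊗ (int (+ 2) ⊗ T v w ⊕ (⊖ B v) ⊗ x) ⊕ (⊖ B w) ⊗ (int (+ 2) ⊗ B v ⊕ (⊖ B v) ⊗ int (+ 2))) (T-sym w v₁))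
              (solve 3 (λ x b b′ → con (+ 2) :* (con (+ 2) :* x :+ (:- b) :* b′) :+ (:- b′) :* (con (+ 2) :* b :+ (:- b) :* con (+ 2))
                := con (+ 2) :* (con (+ 2) :* x :- b :* b′)) refl (T v w) (B v) (B w)))))
        where
        T-projˡ : ∀ u → T (proj v) u ≡ int (+ 2) ⊗ T u v ⊕ (⊖ B v) ⊗ T u v₁
        T-projˡ u = trans (T-sym (proj v) u) (T-lin u (int (+ 2)) v (⊖ B v) v₁)

    -- This is Cauchy-Schwarz for `proj v` and `proj w`, whose norms are `N v` and `N w` and whose
    -- polar value is `2 M v w`; a common factor 4 cancels.
    M²≤NN : ∀ v w → NonNegative (N v ⊗ N w ⊝ M v w ⊗ M v w)
    M²≤NN v w = NonNegative-cancelˡ 0≤Δ (int (+ 4)) (N v ⊗ N w ⊝ M v w ⊗ M v w) Positive-4 (subst NonNegative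
      (trans (cong₂ (λ x y → int (+ 4) ⊗ x ⊗ y ⊝ T (proj v) (proj w) ⊗ T (proj v) (proj w)) (Q-proj v) (Q-proj w))
        (trans (cong (λ x → int (+ 4) ⊗ N v ⊗ N w ⊝ x ⊗ x) (T-proj v w))
          (solve 3 (λ x y m → con (+ 4) :* x :* y :- (con (+ 2) :* m) :* (con (+ 2) :* m) := con (+ 4) :* (x :* y :- m :* m)) refl (N v) (N w) (M v w))))
      (cauchySchwarz (proj v) (proj w)))
      where
      tr4 : tr (int (+ 4)) ≡ + 8
      tr4 = ℤS.solve 1 (λ t → ℤS.con (+ 2) ℤS.:* ℤS.con (+ 4) ℤS.:+ t ℤS.:* ℤS.con (+ 0) ℤS.:= ℤS.con (+ 8)) refl t
      Positive-4 : Positive (int (+ 4))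
      Positive-4 = subst (+ 0 ℤ.<_) (sym tr4) (+<+ (s≤s z≤n)) ,
        subst₂ ℤ._<_ (sym (ℤₚ.*-zeroʳ Δ)) (cong (λ u → u ℤ.* u) (sym tr4)) (+<+ (s≤s z≤n))

    module Second (v₂ : V) where

      K : V → V → O
      K v w = N v₂ ⊗ M v w ⊝ M v₂ v ⊗ M v₂ w

      M-self : ∀ v → M v v ≡ N v
      M-self v = trans (cong (λ x → int (+ 2) ⊗ x ⊝ B v ⊗ B v) (T-self v))
        (solve 2 (λ q b → con (+ 2) :* (q :+ q) :- b :* b := con (+ 4) :* q :- b :* b) refl (Q v) (B v))

      Kvv : ∀ v → K v v ≡ N v₂ ⊗ N v ⊝ M v₂ v ⊗ M v₂ v
      Kvv v = cong (λ x → N v₂ ⊗ x ⊝ M v₂ v ⊗ M v₂ v) (M-self v)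

      K-sym : ∀ v w → K v w ≡ K w v
      K-sym v w = trans (cong (λ x → N v₂ ⊗ (int (+ 2) ⊗ x ⊝ B v ⊗ B w) ⊝ M v₂ v ⊗ M v₂ w) (T-sym v w))
        (solve 6 (λ n x b b′ m m′ → n :* (con (+ 2) :* x :- b :* b′) :- m :* m′ := n :* (con (+ 2) :* x :- b′ :* b) :- m′ :* m) refl
          (N v₂) (T w v) (B v) (B w) (M v₂ v) (M v₂ w))

      private
        triple : V → Fin 3 → V
        triple v 0′ = v₁
        triple v 1′ = v₂
        triple v 2′ = v

        E : V → V → O
        E v w = det (λ i j → T (triple v i) (triple w j))

        matrix : V → V → TO.Mat
        matrix v w 0′ 0′ = int (+ 2)
        matrix v w 0′ 1′ = B v₂
        matrix v w 0′ 2′ = B w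
        matrix v w 1′ 0′ = B v₂
        matrix v w 1′ 1′ = Q v₂ ⊕ Q v₂
        matrix v w 1′ 2′ = T v₂ w
        matrix v w 2′ 0′ = B v
        matrix v w 2′ 1′ = T v₂ v
        matrix v w 2′ 2′ = T v w

        matrix≡ : ∀ v w i j → T (triple v i) (triple w j) ≡ matrix v w i j
        matrix≡ v w 0′ 0′ = Tv₁v₁
        matrix≡ v w 0′ 1′ = refl
        matrix≡ v w 0′ 2′ = refl
        matrix≡ v w 1′ 0′ = T-sym v₂ v₁
        matrix≡ v w 1′ 1′ = T-self v₂
        matrix≡ v w 1′ 2′ = refl
        matrix≡ v w 2′ 0′ = T-sym v v₁
        matrix≡ v w 2′ 1′ = T-sym v v₂
        matrix≡ v w 2′ 2′ = refl

      -- Chio condensation with the pivots 2 = T v₁ v₁ and N v₂.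
      K≡2E : ∀ v w → K v w ≡ int (+ 2) ⊗ E v w
      K≡2E v w = sym (trans (cong (int (+ 2) ⊗_) (det-cong (matrix≡ v w)))
        (solve 7 (λ b₂ q b b′ x x′ y →
           con (+ 2) :* (con (+ 2) :* ((q :+ q) :* y :- x′ :* x) :- b₂ :* (b₂ :* y :- x′ :* b) :+ b′ :* (b₂ :* x :- (q :+ q) :* b))
           := (con (+ 4) :* q :- b₂ :* b₂) :* (con (+ 2) :* y :- b :* b′) :- (con (+ 2) :* x :- b₂ :* b) :* (con (+ 2) :* x′ :- b₂ :* b′)) refl
           (B v₂) (Q v₂) (B v) (B w) (T v₂ v) (T v₂ w) (T v w)))

      -- Two specialisations matter. One makes `K v w` a square root of `K v v ⊗ K w w`; the other
      -- recovers `K w u` from `K v w`, `K v u` and a non-zero `K v v`.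
      K-exchange : ∀ v w x y → K v w ⊗ K x y ≡ K v y ⊗ K x w
      K-exchange v w x y = trans (cong₂ _⊗_ (K≡2E v w) (K≡2E x y))
        (trans (double (E v w) (E x y)) (trans (cong (int (+ 4) ⊗_) (gram-exchange (triple v) (triple w) (triple x) (triple y)))
          (sym (trans (cong₂ _⊗_ (K≡2E v y) (K≡2E x w)) (double (E v y) (E x w))))))
        where
        double : ∀ e f → (int (+ 2) ⊗ e) ⊗ (int (+ 2) ⊗ f) ≡ int (+ 4) ⊗ (e ⊗ f)
        double = solve 2 (λ e f → (con (+ 2) :* e) :* (con (+ 2) :* f) := con (+ 4) :* (e :* f)) refl

-- From a universal lattice to a model

module FromLattice (D : ℕ) (s t c : ℤ) (0<s : + 0 ℤ.< s) (s²D : s ℤ.* s ℤ.* + D ≡ t ℤ.* t ℤ.+ + 4 ℤ.* c)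
  (re-ω : re (QuadField.ω D) ℚ.+ re (QuadField.ω D) ≡ ι t)
  (im-ω : im (QuadField.ω D) ℚ.+ im (QuadField.ω D) ≡ ι s) where
  open QuadField D
  open QFRing D
  open Order t c
  open Embedding D s t c 0<s s²D re-ω im-ω
  open Positivity t c
  private
    module TF = Ternary QF-commutativeRing
    module GT = GramTransport O-commutativeRing QF-commutativeRing φ φ-injective φ-⊕ φ-⊗ φ-⊖

  φ-⊝ : ∀ x y → φ (x ⊝ y) ≡ φ x +F (-F φ y)
  φ-⊝ x y = trans (φ-⊕ x (⊖ y)) (cong (φ x +F_) (φ-⊖ y))

  φ-η : ∀ z → φ z ≡ ℤ→F (rat z) +F ℤ→F (irr z) *F ω
  φ-η (_ + _ ·ω) = refl

  φ-0 : φ (int (+ 0)) ≡ 0F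
  φ-0 = solve 1 (λ w → con (+ 0) :+ con (+ 0) :* w := con (+ 0)) refl ω
    where open QFS

  sumFin-comb : ∀ n (x y : QF) (f h g : Fin n → QF) →
    sumFin n (λ k → (x *F f k +F y *F h k) *F g k) ≡ x *F sumFin n (λ k → f k *F g k) +F y *F sumFin n (λ k → h k *F g k)
  sumFin-comb zero    x y f h g = solve 2 (λ x y → con (+ 0) := x :* con (+ 0) :+ y :* con (+ 0)) refl x y
    where open QFS
  sumFin-comb (suc n) x y f h g = trans
    (cong ((x *F f zero +F y *F h zero) *F g zero +F_) (sumFin-comb n x y (λ k → f (suc k)) (λ k → h (suc k)) (λ k → g (suc k))))
    (solve 7 (λ x y f h g F H → (x :* f :+ y :* h) :* g :+ (x :* F :+ y :* H) := x :* (f :* g :+ F) :+ y :* (h :* g :+ H)) refl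
      x y (f zero) (h zero) (g zero) (sumFin n (λ k → f (suc k) *F g (suc k))) (sumFin n (λ k → h (suc k) *F g (suc k))))
    where open QFS

  _≟F_ : (x y : QF) → Dec (x ≡ y)
  (a + b √) ≟F (a′ + b′ √) = map′ (λ (p , q) → cong₂ _+_√ p q) (λ e → cong re e , cong im e) ((a ℚₚ.≟ a′) ×-dec (b ℚₚ.≟ b′))

  module _ (a : QuadForm) (n : ℕ) (g : Fin n → Vec3) (isLattice : IsQuadraticLattice a n g) (isUniversal : IsUniversal a n g) where
    private
      L : Set
      L = Σ (Fin n → QF) (IntCoeffs n)

      vec : L → Vec3
      vec (f , _) = comb n f g

      QL : L → O
      QL (f , f∈) = let (p , q , _) = isLattice f f∈ in p + q ·ω

      φ-Q : ∀ v → φ (QL v) ≡ TF.quad a (vec v)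
      φ-Q (f , f∈) = let (_ , _ , e) = isLattice f f∈ in sym e

      linL : O → L → O → L → L
      linL x (f , f∈) y (h , h∈) = (λ k → φ x *F f k +F φ y *F h k) , λ k →
        let (p , q , e) = f∈ k ; (p′ , q′ , e′) = h∈ k
            z = x ⊗ (p + q ·ω) ⊕ y ⊗ (p′ + q′ ·ω) in
        rat z , irr z , trans (cong₂ (λ u v → φ x *F u +F φ y *F v) e e′)
          (trans (sym (trans (φ-⊕ (x ⊗ (p + q ·ω)) (y ⊗ (p′ + q′ ·ω))) (cong₂ _+F_ (φ-⊗ x (p + q ·ω)) (φ-⊗ y (p′ + q′ ·ω))))) (φ-η z))

      vec-lin : ∀ x v y w i → vec (linL x v y w) i ≡ φ x *F vec v i +F φ y *F vec w i
      vec-lin x (f , _) y (h , _) i = sumFin-comb n (φ x) (φ y) f h (λ k → g k i)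

      quad-lin : ∀ x v y w → φ (QL (linL x v y w)) ≡
        φ x *F φ x *F TF.quad a (vec v) +F φ x *F φ y *F TF.polar a (vec v) (vec w) +F φ y *F φ y *F TF.quad a (vec w)
      quad-lin x v y w = trans (φ-Q (linL x v y w))
        (trans (TF.quad-cong a (vec-lin x v y w)) (TF.quad-comb a (φ x) (vec v) (φ y) (vec w)))

      1O : O
      1O = int (+ 1)

      -- The entries of the form `a` need not be integral. Defining the polar form through `QL`
      -- shows at once that its values lie in the order, also for lattices that are not classical.
      TL : L → L → O
      TL v w = QL (linL 1O v 1O w) ⊝ (QL v ⊕ QL w)

      φ-T : ∀ v w → φ (TL v w) ≡ TF.polar a (vec v) (vec w)
      φ-T v w = trans (φ-⊝ (QL (linL 1O v 1O w)) (QL v ⊕ QL w))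
        (trans (cong₂ (λ u z → u +F (-F z)) (quad-lin 1O v 1O w) (trans (φ-⊕ (QL v) (QL w)) (cong₂ _+F_ (φ-Q v) (φ-Q w))))
          -- `o` is what `φ 1O` unfolds to, which is why `ω` appears among the variables.
          (solve 4 (λ q p r w → let o = con (+ 1) :+ con (+ 0) :* w in
             (o :* o :* q :+ o :* o :* p :+ o :* o :* r) :- (q :+ r) := p) refl
             (TF.quad a (vec v)) (TF.polar a (vec v) (vec w)) (TF.quad a (vec w)) ω))
        where open QFS

      φ-T-lin : ∀ u x v y w → φ (TL u (linL x v y w)) ≡ φ x *F TF.polar a (vec u) (vec v) +F φ y *F TF.polar a (vec u) (vec w)
      φ-T-lin u x v y w = trans (φ-T u (linL x v y w))
        (trans (TF.polar-congʳ a (vec u) (vec-lin x v y w)) (TF.polar-comb a (φ x) (vec v) (φ y) (vec w) (vec u)))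

      -- The generators may be dependent, so a non-zero tuple can give the zero vector. Writing that
      -- vector as `0 v + 0 v` reduces both claims to `quad-comb` and `polar-comb`.
      zero-quad : ∀ v → IsZeroVec (vec v) → QL v ≡ int (+ 0) × (∀ w → TL w v ≡ int (+ 0))
      zero-quad v v≡0 =
        φ-injective (trans (φ-Q v) (trans (TF.quad-cong a as-comb) (trans (TF.quad-comb a 0F (vec v) 0F (vec v))
          (trans (solve 2 (λ q p → con (+ 0) :* con (+ 0) :* q :+ con (+ 0) :* con (+ 0) :* p :+ con (+ 0) :* con (+ 0) :* q := con (+ 0)) refl
            (TF.quad a (vec v)) (TF.polar a (vec v) (vec v))) (sym φ-0))))) ,
        λ w → φ-injective (trans (φ-T w v) (trans (TF.polar-congʳ a (vec w) as-comb) (trans (TF.polar-comb a 0F (vec v) 0F (vec v) (vec w))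
          (trans (solve 1 (λ p → con (+ 0) :* p :+ con (+ 0) :* p := con (+ 0)) refl (TF.polar a (vec w) (vec v))) (sym φ-0)))))
        where
        open QFS
        as-comb : ∀ i → vec v i ≡ 0F *F vec v i +F 0F *F vec v i
        as-comb i = trans (v≡0 i) (solve 1 (λ x → con (+ 0) := con (+ 0) :* x :+ con (+ 0) :* x) refl (vec v i))

      φ-⊗₃ : ∀ x y z {z′} → φ z ≡ z′ → φ (x ⊗ y ⊗ z) ≡ φ x *F φ y *F z′
      φ-⊗₃ x y z e = trans (φ-⊗ (x ⊗ y) z) (cong₂ _*F_ (φ-⊗ x y) e)

      Q-pos-cases : ∀ v → Dec (IsZeroVec (vec v)) → Positive (QL v) ⊎ (QL v ≡ int (+ 0) × (∀ w → TL w v ≡ int (+ 0)))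
      Q-pos-cases v            (yes v≡0) = inj₂ (zero-quad v v≡0)
      Q-pos-cases v@(f , f∈) (no v≢0)  =
        inj₁ (φ-reflects-positive (QL v) (subst TotallyPositive (sym (φ-Q v)) (proj₂ (proj₁ isUniversal f f∈ v≢0))))

      Q-posL : ∀ v → Positive (QL v) ⊎ (QL v ≡ int (+ 0) × (∀ w → TL w v ≡ int (+ 0)))
      Q-posL v = Q-pos-cases v (Finₚ.all? (λ i → vec v i ≟F 0F))

      T-symL : ∀ v w → TL v w ≡ TL w v
      T-symL v w = φ-injective (trans (φ-T v w) (trans (TF.polar-sym a (vec v) (vec w)) (sym (φ-T w v))))

      T-selfL : ∀ v → TL v v ≡ QL v ⊕ QL v
      T-selfL v = φ-injective (trans (φ-T v v) (trans (TF.polar-self a (vec v))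
          (sym (trans (φ-⊕ (QL v) (QL v)) (cong₂ _+F_ (φ-Q v) (φ-Q v))))))

      T-linL : ∀ u x v y w → TL u (linL x v y w) ≡ x ⊗ TL u v ⊕ y ⊗ TL u w
      T-linL u x v y w = φ-injective (trans (φ-T-lin u x v y w) (sym
          (trans (φ-⊕ (x ⊗ TL u v) (y ⊗ TL u w)) (cong₂ _+F_
            (trans (φ-⊗ x (TL u v)) (cong (φ x *F_) (φ-T u v))) (trans (φ-⊗ y (TL u w)) (cong (φ y *F_) (φ-T u w)))))))

      reprL : ∀ α → Positive α → Σ L λ v → QL v ≡ α
      reprL α α>0 = let (f , f∈ , _ , e) = proj₂ isUniversal (φ α) (φ-preserves-positive α α>0) in
          (f , f∈) , φ-injective (trans (φ-Q (f , f∈)) e)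

      Q-linL : ∀ x v y w → QL (linL x v y w) ≡ x ⊗ x ⊗ QL v ⊕ x ⊗ y ⊗ TL v w ⊕ y ⊗ y ⊗ QL w
      Q-linL x v y w = φ-injective (trans (quad-lin x v y w) (sym
          (trans (φ-⊕ (x ⊗ x ⊗ QL v ⊕ x ⊗ y ⊗ TL v w) (y ⊗ y ⊗ QL w)) (cong₂ _+F_
            (trans (φ-⊕ (x ⊗ x ⊗ QL v) (x ⊗ y ⊗ TL v w)) (cong₂ _+F_ (φ-⊗₃ x x (QL v) (φ-Q v)) (φ-⊗₃ x y (TL v w) (φ-T v w))))
            (φ-⊗₃ y y (QL w) (φ-Q w))))))

    latticeModel : Model
    latticeModel = record
      { V = L ; Q = QL ; T = TL ; lin = linL ; T-sym = T-symL ; T-self = T-selfL ; Q-lin = Q-linL ; T-lin = T-linL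
      ; Q-pos = Q-posL ; repr = reprL ; gram-exchange = GT.det-gram-exchange a vec TL φ-T }

-- The finite search

sqrtStep : ℕ → ℕ → ℕ
sqrtStep n r = if suc r ℕ.* suc r ℕ.≤ᵇ n then suc r else r

-- The first argument is fuel; any fuel ≥ n suffices.
sqrtFuel : ℕ → ℕ → ℕ
sqrtFuel zero    n = 0
sqrtFuel (suc f) n = if n ≡ᵇ 0 then 0 else sqrtStep n (2 ℕ.* sqrtFuel f (n / 4))

isqrt : ℕ → ℕ
isqrt n = sqrtFuel n n

when : {A : Set} → Bool → List A → List A
when true  xs = xs
when false xs = []

±_ : ℕ → List ℤ
± n = if n ≡ᵇ 0 then + 0 ∷ [] else + n ∷ ℤ.- (+ n) ∷ []

-- What the search records of a vector w relative to v₁ and v₂: `b` is T(v₁, w), `m` is M(v₂, w) and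
-- `δ` is K(w, w).
record Candidate : Set where
  constructor cand
  field
    b m δ : O

-- An entry excludes the lattices with T(v₁, v₂) = b₂: for every admissible v₃ with Q(v₃) = α₃, some element of leaves is
-- not represented, possibly only after vectors representing the elements of branches have been adjoined.
record Entry : Set where
  constructor entry
  field
    b₂     : O
    α₃     : O
    leaves branches : List O

record Certificate : Set where
  constructor certificate
  field
    α₂      : O
    entries : List Entry

module Checker (t c : ℤ) (d : ℕ) .{{_ : NonZero d}} where
  open Order t c hiding (Δ)

  nonNegative? : O → Bool
  nonNegative? z = go (tr z) (irr z)
    where
    go : ℤ → ℤ → Bool
    go x y = (+ 0 ℤ.≤ᵇ x) ∧ (+ d ℤ.* (y ℤ.* y) ℤ.≤ᵇ x ℤ.* x)

  positive? : O → Bool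
  positive? z = (+ 1 ℤ.≤ᵇ tr z) ∧ (+ 1 ℤ.+ + d ℤ.* (irr z ℤ.* irr z) ℤ.≤ᵇ tr z ℤ.* tr z)

  zero? : O → Bool
  zero? z = (∣ rat z ∣ ≡ᵇ 0) ∧ (∣ irr z ∣ ≡ᵇ 0)

  boxRow : ℕ → ℕ → List O
  boxRow h y = concatMap (λ k → map (λ b → (k ℤ.⊖ h) + b ·ω) (± y)) (upTo (suc (2 ℕ.* h)))

  -- Here `n` bounds `(tr z)² + d y²`, where `y` is the absolute value of the irrational coordinate
  -- `b`. Hence `y² ≤ n / d` and `(tr z)² ≤ n - d y²`. The rational coordinate `a` satisfies
  -- `2 a = tr z - t b` with `∣ t ∣ ≤ 1`, which explains the summand `y` and the division by 2.
  boxUpTo : ℕ → List O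
  boxUpTo n = concatMap (λ y → boxRow ((isqrt (n ℕ.∸ d ℕ.* (y ℕ.* y)) ℕ.+ y) / 2) y) (upTo (suc (isqrt (n / d))))

  -- contains every z with β - z² ≥ 0 in both embeddings
  box : O → List O
  box β = boxUpTo ∣ + 2 ℤ.* tr β ∣

  norm : O → ℤ
  norm (a + b ·ω) = a ℤ.* a ℤ.+ t ℤ.* (a ℤ.* b) ℤ.- c ℤ.* (b ℤ.* b)

  conj : O → O
  conj (a + b ·ω) = (a ℤ.+ t ℤ.* b) + (ℤ.- b) ·ω

  dividesℕ? : ℕ → ℕ → Bool
  dividesℕ? zero    n = true
  dividesℕ? (suc m) n = n % suc m ≡ᵇ 0

  -- The quotient of `z` by `x` is `z ⊗ conj x` divided by the integer `norm x`. For `x = 0` the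
  -- numerator is 0 as well and the test succeeds, so a vanishing denominator excludes nothing.
  divides? : O → O → Bool
  divides? x z = go ∣ norm x ∣ (z ⊗ conj x)
    where
    go : ℕ → O → Bool
    go n (a + b ·ω) = dividesℕ? n ∣ a ∣ ∧ dividesℕ? n ∣ b ∣

  ifRoot : O → O → List O
  ifRoot z k = when (zero? (k ⊗ k ⊝ z)) (k ∷ [])

  -- `p` and `q` stand for the absolute values of `tr k` and `irr k`. As twice the rational
  -- coordinate is `tr k - t · irr k`, the unknown signs leave two possible absolute values for it;
  -- `ifRoot` removes the spurious combinations.
  rootsFrom : O → ℕ → ℕ → List O
  rootsFrom z p q =
    concatMap (λ h → concatMap (λ a → concatMap (λ b → ifRoot z (a + b ·ω)) (± q)) (± h))
      (ℤ.∣ + p ℤ.+ t ℤ.* + q ∣ / 2 ∷ ∣ + p ℤ.- t ℤ.* + q ∣ / 2 ∷ [])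

  rootsSplit : O → ℕ → ℕ → List O
  rootsSplit z u v = go (isqrt u) (isqrt (v / d))
    where
    go : ℕ → ℕ → List O
    go p q = when ((p ℕ.* p ≡ᵇ u) ∧ (d ℕ.* (q ℕ.* q) ≡ᵇ v)) (rootsFrom z p q)

  -- If k² = z, then tr k and the irrational part y of k satisfy {(tr k)², d y²} = {tr z + s, tr z - s}, where s² = (tr z)² - d (irr z)².
  roots : O → List O
  roots z = go (tr z) ∣ tr z ℤ.* tr z ℤ.- + d ℤ.* (irr z ℤ.* irr z) ∣
    where
    split : ℕ → ℕ → List O
    split u v = rootsSplit z u v ++ rootsSplit z v u
    go₂ : ℤ → ℕ → ℕ → List O
    go₂ x n s = when (s ℕ.* s ≡ᵇ n) (split ∣ x ℤ.+ + s ∣ ∣ x ℤ.- + s ∣)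
    go : ℤ → ℕ → List O
    go x n = go₂ x n (isqrt n)

  lexPositive? : O → Bool
  lexPositive? (a + b ·ω) = if ∣ a ∣ ≡ᵇ 0 then + 0 ℤ.≤ᵇ b else + 0 ℤ.≤ᵇ a

  -- Since w and -w have the same norm, w may be chosen so that the first non-zero one of T(v₁, w)
  -- and T(v₂, w) is lexicographically positive. This roughly halves the lists of candidates.
  normalised? : O → O → Bool
  normalised? x y = if zero? x then lexPositive? y else lexPositive? x

  module Search (α₂ b₂ n₂ : O) where

    candidatesT : O → O → O → O → List Candidate
    candidatesT b n x m = go (n₂ ⊗ n ⊝ m ⊗ m)
      where
      go : O → List Candidate
      go δ = when (normalised? b x ∧ nonNegative? δ) (cand b m δ ∷ [])

    candidatesB : List O → O → O → List Candidate
    candidatesB xs b n = when (nonNegative? n) (concatMap (λ x → candidatesT b n x (int (+ 2) ⊗ x ⊝ b₂ ⊗ b)) xs)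

    -- The outer box comes from N(w) ≥ 0 and bounds T(v₁, w); the inner one comes from
    -- Cauchy-Schwarz for v₂ and w and bounds T(v₂, w). The condition on `δ` is Cauchy-Schwarz for
    -- the projections of v₂ and w.
    candidates : O → List Candidate
    candidates α = go (box (int (+ 4) ⊗ α₂ ⊗ α))
      where
      go : List O → List Candidate
      go xs = concatMap (λ b → candidatesB xs b (int (+ 4) ⊗ α ⊝ b ⊗ b)) (box (int (+ 4) ⊗ α))

    -- The possible values of K(v₃, w): square roots of K(v₃, v₃) K(w, w) for which the definition
    -- of K, solved for T(v₃, w), has a solution in the order. The divisor is the coefficient of T
    -- in K.
    linked : Candidate → Candidate → List O
    linked (cand b₃ m₃ δ₃) (cand b m δ) =
      concatMap (λ k → when (divides? (int (+ 2) ⊗ n₂) (k ⊕ (m₃ ⊗ m ⊕ n₂ ⊗ (b₃ ⊗ b)))) (k ∷ [])) (roots (δ₃ ⊗ δ))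

    -- The exchange identity gives δ₃ K(w, w′) = k k′. Solving for T(w, w′) then brings in the
    -- denominator 2 n₂ δ₃, and the quotient has to be integral.
    compatible? : Candidate → Candidate × O → Candidate × O → Bool
    compatible? (cand _ _ δ₃) (cand b m _ , k) (cand b′ m′ _ , k′) =
      divides? (int (+ 2) ⊗ n₂ ⊗ δ₃) (k ⊗ k′ ⊕ δ₃ ⊗ (m ⊗ m′ ⊕ n₂ ⊗ (b ⊗ b′)))

    -- The parameter `dead?` is the fate of a pair that survives all compatibility tests: constantly
    -- false for a leaf, which must have no survivor, and the recursive refutation for a branch.
    noneOf? : Candidate → List (Candidate × O) → List Candidate → (Candidate × O → Bool) → Bool
    noneOf? v₃ chosen W dead? =
      all (λ w → all (λ k → not (all (compatible? v₃ (w , k)) chosen) ∨ dead? (w , k)) (linked v₃ w)) W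

    -- At each depth one leaf without survivors is enough. Otherwise every survivor of the next
    -- branch is adjoined in turn, which makes the compatibility tests on the leaves stricter.
    refute : Candidate → List (Candidate × O) → List (List Candidate) → List (List Candidate) → Bool
    refute v₃ chosen leaves []             = any (λ W → noneOf? v₃ chosen W (λ _ → false)) leaves
    refute v₃ chosen leaves (W ∷ branches) =
      any (λ W → noneOf? v₃ chosen W (λ _ → false)) leaves
      ∨ noneOf? v₃ chosen W (λ wk → refute v₃ (wk ∷ chosen) leaves branches)

    refuteAll : O → List O → List O → Bool
    refuteAll α₃ leaves branches = go (map candidates leaves) (map candidates branches)
      where
      go : List (List Candidate) → List (List Candidate) → Bool
      go ls bs = all (λ v₃ → refute v₃ [] ls bs) (candidates α₃)

  checkEntry : O → O → Entry → Bool
  checkEntry α₂ b₂ (entry b₂′ α₃ leaves branches) =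
    zero? (b₂ ⊝ b₂′) ∧ all positive? (α₃ ∷ leaves ++ branches) ∧ Search.refuteAll α₂ b₂ (int (+ 4) ⊗ α₂ ⊝ b₂ ⊗ b₂) α₃ leaves branches

  check : Certificate → Bool
  check (certificate α₂ entries) = positive? α₂ ∧
    all (λ b₂ → not (lexPositive? b₂) ∨ not (nonNegative? (int (+ 4) ⊗ α₂ ⊝ b₂ ⊗ b₂)) ∨ any (checkEntry α₂ b₂) entries) (box (int (+ 4) ⊗ α₂))

-- Soundness of the finite search

T⇒≡true : ∀ {b} → Bool.T b → b ≡ true
T⇒≡true {true} _ = refl

≡true⇒T : ∀ {b} → b ≡ true → Bool.T b
≡true⇒T refl = _

∧-true : ∀ {a b} → a ∧ b ≡ true → a ≡ true × b ≡ true
∧-true {true} e = refl , e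

∨-true : ∀ {a b} → a ∨ b ≡ true → a ≡ true ⊎ b ≡ true
∨-true {true}  e = inj₁ refl
∨-true {false} e = inj₂ e

not-true : ∀ {a} → not a ≡ true → a ≡ true → ⊥
not-true {false} _ ()

≡ᵇ-refl : ∀ n → (n ≡ᵇ n) ≡ true
≡ᵇ-refl n = T⇒≡true (ℕₚ.≡⇒≡ᵇ n n refl)

≡⇒≡ᵇ-true : ∀ {m n} → m ≡ n → (m ≡ᵇ n) ≡ true
≡⇒≡ᵇ-true {m} refl = ≡ᵇ-refl m

all-true : ∀ {A : Set} (p : A → Bool) {xs x} → all p xs ≡ true → x ∈ xs → p x ≡ true
all-true p e (here refl) = proj₁ (∧-true e)
all-true p e (there x∈) = all-true p (proj₂ (∧-true e)) x∈

any-true : ∀ {A : Set} (p : A → Bool) xs → any p xs ≡ true → Σ A λ x → x ∈ xs × p x ≡ true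
any-true p (x ∷ xs) e with ∨-true {p x} e
... | inj₁ px = x , here refl , px
... | inj₂ e′ = let (y , y∈ , py) = any-true p xs e′ in y , there y∈ , py

∈-when : ∀ {A : Set} {b} {xs : List A} {x} → b ≡ true → x ∈ xs → x ∈ when b xs
∈-when refl x∈ = x∈

∈-concatMap : ∀ {A B : Set} (f : A → List B) {xs x y} → x ∈ xs → y ∈ f x → y ∈ concatMap f xs
∈-concatMap f x∈ y∈ = ∈-concatMap⁺ f (Any.map (λ { refl → y∈ }) x∈)

sqrtStep-floor : ∀ n r → r ℕ.* r ℕ.≤ n → n ℕ.< (2 ℕ.+ r) ℕ.* (2 ℕ.+ r) →
  sqrtStep n r ℕ.* sqrtStep n r ℕ.≤ n × n ℕ.< suc (sqrtStep n r) ℕ.* suc (sqrtStep n r)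
sqrtStep-floor n r lo hi with suc r ℕ.* suc r ℕ.≤ᵇ n in eq
... | true  = ℕₚ.≤ᵇ⇒≤ _ _ (≡true⇒T eq) , hi
... | false = lo , ℕₚ.≰⇒> (λ le → subst Bool.T eq (ℕₚ.≤⇒≤ᵇ le))

-- If `r` is the integer root of `n / 4`, then `2 r` squared is at most `n` and `2 r + 2` squared
-- exceeds it. The root of `n` is thus `2 r` or `2 r + 1`, and `sqrtStep` decides which.
sqrtFuel-floor : ∀ f n → n ℕ.≤ f →
  sqrtFuel f n ℕ.* sqrtFuel f n ℕ.≤ n × n ℕ.< suc (sqrtFuel f n) ℕ.* suc (sqrtFuel f n)
sqrtFuel-floor zero    zero    _ = z≤n , s≤s z≤n
sqrtFuel-floor (suc f) zero    _ = z≤n , s≤s z≤n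
sqrtFuel-floor (suc f) n@(suc n-1) (s≤s n-1≤f) = sqrtStep-floor n (2 ℕ.* r)
  (ℕₚ.≤-trans (ℕₚ.≤-reflexive (four r)) (ℕₚ.≤-trans (ℕₚ.*-monoˡ-≤ 4 lo) (m/n*n≤m n 4)))
  (ℕₚ.≤-trans n<4q (ℕₚ.≤-trans (ℕₚ.*-monoˡ-≤ 4 hi) (ℕₚ.≤-reflexive (four′ r))))
  where
  r = sqrtFuel f (n / 4)
  q≤f : n / 4 ℕ.≤ f
  q≤f = ℕₚ.≤-pred (ℕₚ.≤-trans (m/n<m n 4 (s≤s (s≤s z≤n))) (s≤s n-1≤f))
  lo = proj₁ (sqrtFuel-floor f (n / 4) q≤f)
  hi = proj₂ (sqrtFuel-floor f (n / 4) q≤f)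
  open +-*-Solver
  four : ∀ r → (2 ℕ.* r) ℕ.* (2 ℕ.* r) ≡ r ℕ.* r ℕ.* 4
  four = solve 1 (λ r → (con 2 :* r) :* (con 2 :* r) := r :* r :* con 4) refl
  four′ : ∀ r → suc r ℕ.* suc r ℕ.* 4 ≡ (2 ℕ.+ 2 ℕ.* r) ℕ.* (2 ℕ.+ 2 ℕ.* r)
  four′ = solve 1 (λ r → (con 1 :+ r) :* (con 1 :+ r) :* con 4 := (con 2 :+ con 2 :* r) :* (con 2 :+ con 2 :* r)) refl
  n<4q : n ℕ.< suc (n / 4) ℕ.* 4
  n<4q = subst (ℕ._< suc (n / 4) ℕ.* 4) (sym (m≡m%n+[m/n]*n n 4)) (ℕₚ.+-monoˡ-< (n / 4 ℕ.* 4) (m%n<n n 4))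

≤-squares⁻¹-ℕ : ∀ {m n} → m ℕ.* m ℕ.< suc n ℕ.* suc n → m ℕ.≤ n
≤-squares⁻¹-ℕ lt = ℕₚ.≮⇒≥ (λ n<m → ℕₚ.<⇒≱ lt (ℕₚ.*-mono-≤ n<m n<m))

m*m≤n⇒m≤isqrt : ∀ {m n} → m ℕ.* m ℕ.≤ n → m ℕ.≤ isqrt n
m*m≤n⇒m≤isqrt {n = n} le = ≤-squares⁻¹-ℕ (ℕₚ.≤-<-trans le (proj₂ (sqrtFuel-floor n n ℕₚ.≤-refl)))

isqrt-square : ∀ m → isqrt (m ℕ.* m) ≡ m
isqrt-square m = ℕₚ.≤-antisym
  (≤-squares⁻¹-ℕ {n = m} (ℕₚ.≤-<-trans (proj₁ (sqrtFuel-floor (m ℕ.* m) (m ℕ.* m) ℕₚ.≤-refl)) (ℕₚ.*-mono-< (ℕₚ.n<1+n m) (ℕₚ.n<1+n m))))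
  (m*m≤n⇒m≤isqrt ℕₚ.≤-refl)

m*n≤o⇒m≤o/n : ∀ m n o .{{_ : NonZero n}} → m ℕ.* n ℕ.≤ o → m ℕ.≤ o / n
m*n≤o⇒m≤o/n m n o le = subst (ℕ._≤ o / n) (m*n/n≡m m n) (/-monoˡ-≤ n le)

square≡ : ∀ i → i ℤ.* i ≡ + (∣ i ∣ ℕ.* ∣ i ∣)
square≡ (+ n)    = sym (ℤₚ.pos-* n n)
square≡ -[1+ n ] = refl

∈-± : ∀ i → i ∈ ± ∣ i ∣
∈-± (+ zero)  = here refl
∈-± (+ suc n) = here refl
∈-± -[1+ n ]  = there (here refl)

∈-interval : ∀ h i → ∣ i ∣ ℕ.≤ h → Σ ℕ λ k → k ∈ upTo (suc (2 ℕ.* h)) × k ℤ.⊖ h ≡ i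
∈-interval h (+ m) m≤h = m ℕ.+ h , ∈-upTo⁺ (s≤s (ℕₚ.≤-trans (ℕₚ.+-monoˡ-≤ h m≤h) (ℕₚ.≤-reflexive (cong (h ℕ.+_) (sym (ℕₚ.+-identityʳ h)))))) ,
  trans (ℤₚ.⊖-≥ (ℕₚ.m≤n+m h m)) (cong +_ (ℕₚ.m+n∸n≡m m h))
∈-interval h -[1+ m ] m<h = h ℕ.∸ suc m , ∈-upTo⁺ (s≤s (ℕₚ.≤-trans (ℕₚ.m∸n≤m h (suc m)) (ℕₚ.m≤m+n h _))) ,
  trans (ℤₚ.⊖-≤ (ℕₚ.m∸n≤m h (suc m))) (cong (λ k → ℤ.- (+ k)) (ℕₚ.m∸[m∸n]≡n m<h))

module Completeness (t c : ℤ) (d : ℕ) .{{_ : NonZero d}} (∣t∣≤1 : ∣ t ∣ ℕ.≤ 1) (Δ≡d : Order.Δ t c ≡ + d) where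
  open Order t c
  open Positivity t c using (tr-⊗)
  open Checker t c d

  nonNegative?-complete : ∀ z → NonNegative z → nonNegative? z ≡ true
  nonNegative?-complete z (p , q) rewrite T⇒≡true (ℤₚ.≤⇒≤ᵇ p) =
    T⇒≡true (ℤₚ.≤⇒≤ᵇ (subst (λ e → e ℤ.* (irr z ℤ.* irr z) ℤ.≤ tr z ℤ.* tr z) Δ≡d q))

  positive?-sound : ∀ z → positive? z ≡ true → Positive z
  positive?-sound z e = let (p , q) = ∧-true e in
    1≤⇒0< (ℤₚ.≤ᵇ⇒≤ (≡true⇒T p)) , subst (λ e → e ℤ.* (irr z ℤ.* irr z) ℤ.< tr z ℤ.* tr z) (sym Δ≡d) (ℤₚ.suc[i]≤j⇒i<j (ℤₚ.≤ᵇ⇒≤ (≡true⇒T q)))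
    where
    1≤⇒0< : ∀ {i} → + 1 ℤ.≤ i → + 0 ℤ.< i
    1≤⇒0< (+≤+ (s≤s p)) = +<+ (s≤s p)

  -- The sum of the two embedded inequalities, doubled: by `tr-⊗`, `2 tr (z ⊗ z)` is
  -- `(tr z)² + d (irr z)²`.
  square-bound : ∀ β z → NonNegative (β ⊝ z ⊗ z) → ∣ tr z ∣ ℕ.* ∣ tr z ∣ ℕ.+ d ℕ.* (∣ irr z ∣ ℕ.* ∣ irr z ∣) ℕ.≤ ∣ + 2 ℤ.* tr β ∣
  square-bound β z (0≤ , _) = +≤⇒≤∣∣ {i = + 2 ℤ.* tr β} (ℤₚ.0≤i-j⇒j≤i (subst (+ 0 ℤ.≤_) tr≡ (0≤*0≤ {+ 2} (+≤+ z≤n) 0≤)))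
    where
    +≤⇒≤∣∣ : ∀ {n i} → + n ℤ.≤ i → n ℕ.≤ ∣ i ∣
    +≤⇒≤∣∣ (+≤+ le) = le
    tr-⊝ : ∀ x y → tr (x ⊝ y) ≡ tr x ℤ.- tr y
    tr-⊝ (a + b ·ω) (a′ + b′ ·ω) = ℤS.solve 5 (λ a b a′ b′ t → ℤS.con (+ 2) ℤS.:* (a ℤS.:- a′) ℤS.:+ t ℤS.:* (b ℤS.:- b′)
      ℤS.:= (ℤS.con (+ 2) ℤS.:* a ℤS.:+ t ℤS.:* b) ℤS.:- (ℤS.con (+ 2) ℤS.:* a′ ℤS.:+ t ℤS.:* b′)) refl a b a′ b′ t
    x = ∣ tr z ∣ ; y = ∣ irr z ∣
    tr≡ : + 2 ℤ.* tr (β ⊝ z ⊗ z) ≡ + 2 ℤ.* tr β ℤ.- + (x ℕ.* x ℕ.+ d ℕ.* (y ℕ.* y))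
    tr≡ = begin
      + 2 ℤ.* tr (β ⊝ z ⊗ z)                 ≡⟨ cong (+ 2 ℤ.*_) (tr-⊝ β (z ⊗ z)) ⟩
      + 2 ℤ.* (tr β ℤ.- tr (z ⊗ z))          ≡⟨ ℤS.solve 2 (λ u v → ℤS.con (+ 2) ℤS.:* (u ℤS.:- v) ℤS.:= ℤS.con (+ 2) ℤS.:* u ℤS.:- ℤS.con (+ 2) ℤS.:* v) refl (tr β) (tr (z ⊗ z)) ⟩
      + 2 ℤ.* tr β ℤ.- + 2 ℤ.* tr (z ⊗ z)    ≡⟨ cong (λ w → + 2 ℤ.* tr β ℤ.- w) (trans (tr-⊗ z z) (cong₂ ℤ._+_ (square≡ (tr z)) (cong₂ ℤ._*_ Δ≡d (square≡ (irr z))))) ⟩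
      + 2 ℤ.* tr β ℤ.- (+ (x ℕ.* x) ℤ.+ + d ℤ.* + (y ℕ.* y)) ≡⟨ cong (λ w → + 2 ℤ.* tr β ℤ.- (+ (x ℕ.* x) ℤ.+ w)) (sym (ℤₚ.pos-* d (y ℕ.* y))) ⟩
      + 2 ℤ.* tr β ℤ.- + (x ℕ.* x ℕ.+ d ℕ.* (y ℕ.* y)) ∎
      where open ≡-Reasoning

  ∣t*b∣≤∣b∣ : ∀ b → ∣ t ℤ.* b ∣ ℕ.≤ ∣ b ∣
  ∣t*b∣≤∣b∣ b = subst (ℕ._≤ ∣ b ∣) (sym (ℤₚ.abs-* t b)) (ℕₚ.≤-trans (ℕₚ.*-monoˡ-≤ ∣ b ∣ ∣t∣≤1) (ℕₚ.≤-reflexive (ℕₚ.*-identityˡ ∣ b ∣)))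

  box-complete : ∀ β z → NonNegative (β ⊝ z ⊗ z) → z ∈ box β
  box-complete β z@(a + b ·ω) β-z² = ∈-concatMap (λ y → boxRow ((isqrt (n ℕ.∸ d ℕ.* (y ℕ.* y)) ℕ.+ y) / 2) y) y∈ z∈row
    where
    n = ∣ + 2 ℤ.* tr β ∣
    x = ∣ tr z ∣
    y = ∣ b ∣
    h = (isqrt (n ℕ.∸ d ℕ.* (y ℕ.* y)) ℕ.+ y) / 2
    bound = square-bound β z β-z²
    y∈ : y ∈ upTo (suc (isqrt (n / d)))
    y∈ = ∈-upTo⁺ (s≤s (m*m≤n⇒m≤isqrt (m*n≤o⇒m≤o/n (y ℕ.* y) d n
      (ℕₚ.≤-trans (ℕₚ.≤-reflexive (ℕₚ.*-comm (y ℕ.* y) d)) (ℕₚ.m+n≤o⇒n≤o (x ℕ.* x) bound)))))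
    x≤ : x ℕ.≤ isqrt (n ℕ.∸ d ℕ.* (y ℕ.* y))
    x≤ = m*m≤n⇒m≤isqrt (ℕₚ.m+n≤o⇒m≤o∸n (x ℕ.* x) bound)
    2a≡ : + 2 ℤ.* a ≡ tr z ℤ.- t ℤ.* b
    2a≡ = ℤS.solve 2 (λ u v → u ℤS.:= (u ℤS.:+ v) ℤS.:- v) refl (+ 2 ℤ.* a) (t ℤ.* b)
    a≤h : ∣ a ∣ ℕ.≤ h
    a≤h = m*n≤o⇒m≤o/n ∣ a ∣ 2 _ (begin
      ∣ a ∣ ℕ.* 2               ≡⟨ ℕₚ.*-comm ∣ a ∣ 2 ⟩
      2 ℕ.* ∣ a ∣               ≡⟨ sym (ℤₚ.abs-* (+ 2) a) ⟩
      ∣ + 2 ℤ.* a ∣             ≡⟨ cong ∣_∣ 2a≡ ⟩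
      ∣ tr z ℤ.- t ℤ.* b ∣      ≤⟨ ℤₚ.∣i-j∣≤∣i∣+∣j∣ (tr z) (t ℤ.* b) ⟩
      x ℕ.+ ∣ t ℤ.* b ∣         ≤⟨ ℕₚ.+-mono-≤ x≤ (∣t*b∣≤∣b∣ b) ⟩
      isqrt (n ℕ.∸ d ℕ.* (y ℕ.* y)) ℕ.+ y ∎)
      where open ℕₚ.≤-Reasoning
    z∈row : z ∈ boxRow h y
    z∈row =
      let (k , k∈ , k⊖h≡a) = ∈-interval h a a≤h
      in ∈-concatMap (λ k → map (λ b → (k ℤ.⊖ h) + b ·ω) (± y)) k∈
           (subst (λ a → (a + b ·ω) ∈ map (λ b → (k ℤ.⊖ h) + b ·ω) (± y)) k⊖h≡a (∈-map⁺ (λ b → (k ℤ.⊖ h) + b ·ω) (∈-± b)))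

  dividesℕ?-complete : ∀ m k → dividesℕ? m (m ℕ.* k) ≡ true
  dividesℕ?-complete zero    k = refl
  dividesℕ?-complete (suc m) k = ≡⇒≡ᵇ-true (trans (cong (_% suc m) (ℕₚ.*-comm (suc m) k)) (m*n%n≡0 k (suc m)))

  divides?-complete : ∀ x w → divides? x (x ⊗ w) ≡ true
  divides?-complete x@(a + b ·ω) w@(e + f ·ω) = cong₂ _∧_ (component e rat≡) (component f irr≡)
    where
    component : ∀ {i} j → i ≡ norm x ℤ.* j → dividesℕ? ∣ norm x ∣ ∣ i ∣ ≡ true
    component j refl = trans (cong (dividesℕ? ∣ norm x ∣) (ℤₚ.abs-* (norm x) j)) (dividesℕ?-complete ∣ norm x ∣ ∣ j ∣)
    open ℤS
    rat≡ : rat (x ⊗ w ⊗ conj x) ≡ norm x ℤ.* e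
    rat≡ = solve 6 (λ a b e f t c →
      let P₁ = a :* e :+ c :* (b :* f) ; P₂ = a :* f :+ b :* e :+ t :* (b :* f) ; C₁ = a :+ t :* b ; C₂ = :- b in
      P₁ :* C₁ :+ c :* (P₂ :* C₂) := (a :* a :+ t :* (a :* b) :- c :* (b :* b)) :* e) refl a b e f t c
    irr≡ : irr (x ⊗ w ⊗ conj x) ≡ norm x ℤ.* f
    irr≡ = solve 6 (λ a b e f t c →
      let P₁ = a :* e :+ c :* (b :* f) ; P₂ = a :* f :+ b :* e :+ t :* (b :* f) ; C₁ = a :+ t :* b ; C₂ = :- b in
      P₁ :* C₂ :+ P₂ :* C₁ :+ t :* (P₂ :* C₂) := (a :* a :+ t :* (a :* b) :- c :* (b :* b)) :* f) refl a b e f t c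

  zero?-complete : ∀ z → z ≡ int (+ 0) → zero? z ≡ true
  zero?-complete _ refl = refl

  x⊝x≡0 : ∀ x → x ⊝ x ≡ int (+ 0)
  x⊝x≡0 = CommutativeRing.-‿inverseʳ O-commutativeRing

  halves : ∀ a b → let k = a + b ·ω ; p = ∣ tr k ∣ ; q = ∣ b ∣ in
    ∣ a ∣ ∈ (∣ + p ℤ.+ t ℤ.* + q ∣ / 2 ∷ ∣ + p ℤ.- t ℤ.* + q ∣ / 2 ∷ [])
  halves a b = cases (tr (a + b ·ω)) b 2a≡
    where
    open ℤS
    2a≡ : + 2 ℤ.* a ≡ tr (a + b ·ω) ℤ.- t ℤ.* b
    2a≡ = solve 2 (λ u v → u := (u :+ v) :- v) refl (+ 2 ℤ.* a) (t ℤ.* b)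
    ∣a∣≡ : ∀ {i} → ∣ + 2 ℤ.* a ∣ ≡ ∣ i ∣ → ∣ a ∣ ≡ ∣ i ∣ / 2
    ∣a∣≡ e = trans (sym (m*n/n≡m ∣ a ∣ 2)) (cong (_/ 2) (trans (ℕₚ.*-comm ∣ a ∣ 2) (trans (sym (ℤₚ.abs-* (+ 2) a)) e)))
    neg-out : ∀ i j → i ≡ ℤ.- j → ∣ i ∣ ≡ ∣ j ∣
    neg-out i j refl = ℤₚ.∣-i∣≡∣i∣ j
    cases : ∀ x b → + 2 ℤ.* a ≡ x ℤ.- t ℤ.* b →
      ∣ a ∣ ∈ (∣ + ∣ x ∣ ℤ.+ t ℤ.* + ∣ b ∣ ∣ / 2 ∷ ∣ + ∣ x ∣ ℤ.- t ℤ.* + ∣ b ∣ ∣ / 2 ∷ [])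
    cases (+ p) (+ q) e = there (here (∣a∣≡ {+ p ℤ.- t ℤ.* + q} (cong ∣_∣ e)))
    cases (+ p) -[1+ q ] e = here (∣a∣≡ {+ p ℤ.+ t ℤ.* + suc q} (cong ∣_∣ (trans e
      (solve 3 (λ p t q → p :- t :* (:- q) := p :+ t :* q) refl (+ p) t (+ suc q)))))
    cases -[1+ p ] (+ q) e = here (∣a∣≡ {+ suc p ℤ.+ t ℤ.* + q} (neg-out (+ 2 ℤ.* a) (+ suc p ℤ.+ t ℤ.* + q) (trans e
      (solve 3 (λ p t q → :- p :- t :* q := :- (p :+ t :* q)) refl (+ suc p) t (+ q)))))
    cases -[1+ p ] -[1+ q ] e = there (here (∣a∣≡ {+ suc p ℤ.- t ℤ.* + suc q} (neg-out (+ 2 ℤ.* a) (+ suc p ℤ.- t ℤ.* + suc q) (trans e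
      (solve 3 (λ p t q → :- p :- t :* (:- q) := :- (p :- t :* q)) refl (+ suc p) t (+ suc q))))))

  rootsSplit-complete : ∀ z k → k ⊗ k ≡ z → ∀ u v → u ≡ ∣ tr k ∣ ℕ.* ∣ tr k ∣ → v ≡ d ℕ.* (∣ irr k ∣ ℕ.* ∣ irr k ∣) → k ∈ rootsSplit z u v
  rootsSplit-complete z k@(a + b ·ω) k² u v refl refl =
    ∈-when (cong₂ _∧_ (≡⇒≡ᵇ-true (cong (λ r → r ℕ.* r) p≡)) (≡⇒≡ᵇ-true (cong (λ r → d ℕ.* (r ℕ.* r)) q≡)))
      (subst₂ (λ p q → k ∈ rootsFrom z p q) (sym p≡) (sym q≡) k∈)
    where
    p = ∣ tr k ∣
    q = ∣ b ∣
    p≡ : isqrt (p ℕ.* p) ≡ p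
    p≡ = isqrt-square p
    q≡ : isqrt (d ℕ.* (q ℕ.* q) / d) ≡ q
    q≡ = trans (cong isqrt (trans (cong (_/ d) (ℕₚ.*-comm d (q ℕ.* q))) (m*n/n≡m (q ℕ.* q) d))) (isqrt-square q)
    k∈ : k ∈ rootsFrom z p q
    k∈ = ∈-concatMap (λ h → concatMap (λ a → concatMap (λ b → ifRoot z (a + b ·ω)) (± q)) (± h)) (halves a b)
      (∈-concatMap (λ a → concatMap (λ b → ifRoot z (a + b ·ω)) (± q)) (∈-± a) (∈-concatMap (λ b → ifRoot z (a + b ·ω)) (∈-± b)
      (∈-when (zero?-complete (k ⊗ k ⊝ z) (trans (cong (_⊝ z) k²) (x⊝x≡0 z))) (here refl))))

  roots-complete : ∀ z k → k ⊗ k ≡ z → k ∈ roots z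
  roots-complete z k@(a + b ·ω) refl = subst (λ n → k ∈ when (isqrt n ℕ.* isqrt n ≡ᵇ n) (split (isqrt n))) (sym nm≡)
      (subst (λ s → k ∈ when (s ℕ.* s ≡ᵇ ∣ e ∣ ℕ.* ∣ e ∣) (split s)) (sym (isqrt-square ∣ e ∣))
        (∈-when (≡ᵇ-refl (∣ e ∣ ℕ.* ∣ e ∣)) (by-sign e refl)))
    where
    open ℤS
    X = tr z
    x = tr k
    split : ℕ → List O
    split s = either (∣ X ℤ.+ + s ∣) (∣ X ℤ.- + s ∣)
      where
      either : ℕ → ℕ → List O
      either u v = rootsSplit z u v ++ rootsSplit z v u
    -- This is twice the norm of `k`. The search knows only its absolute value, so `by-sign` picks
    -- the order of the two arguments of `rootsSplit`.
    e = X ℤ.- + d ℤ.* (b ℤ.* b)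
    2X≡ : X ≡ x ℤ.* x ℤ.- e
    2X≡ = begin
      X ≡⟨ solve 2 (λ X w → X := con (+ 2) :* X :- w :- (X :- w)) refl X (+ d ℤ.* (b ℤ.* b)) ⟩
      + 2 ℤ.* X ℤ.- + d ℤ.* (b ℤ.* b) ℤ.- e ≡⟨ cong (λ w → w ℤ.- + d ℤ.* (b ℤ.* b) ℤ.- e) (trans (tr-⊗ k k) (cong (λ D → x ℤ.* x ℤ.+ D ℤ.* (b ℤ.* b)) Δ≡d)) ⟩
      x ℤ.* x ℤ.+ + d ℤ.* (b ℤ.* b) ℤ.- + d ℤ.* (b ℤ.* b) ℤ.- e ≡⟨ solve 3 (λ x w e → x :* x :+ w :- w :- e := x :* x :- e) refl x (+ d ℤ.* (b ℤ.* b)) e ⟩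
      x ℤ.* x ℤ.- e ∎
      where open ≡-Reasoning
    irr≡ : irr z ≡ b ℤ.* x
    irr≡ = solve 3 (λ a b t → a :* b :+ b :* a :+ t :* (b :* b) := b :* (con (+ 2) :* a :+ t :* b)) refl a b t
    nm≡ : ∣ X ℤ.* X ℤ.- + d ℤ.* (irr z ℤ.* irr z) ∣ ≡ ∣ e ∣ ℕ.* ∣ e ∣
    nm≡ = trans (cong ∣_∣ (begin
      X ℤ.* X ℤ.- + d ℤ.* (irr z ℤ.* irr z)       ≡⟨ cong (λ w → X ℤ.* X ℤ.- + d ℤ.* (w ℤ.* w)) irr≡ ⟩
      X ℤ.* X ℤ.- + d ℤ.* (b ℤ.* x ℤ.* (b ℤ.* x)) ≡⟨ solve 4 (λ X d b x → X :* X :- d :* (b :* x :* (b :* x)) := X :* X :- d :* (b :* b) :* (x :* x)) refl X (+ d) b x ⟩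
      X ℤ.* X ℤ.- + d ℤ.* (b ℤ.* b) ℤ.* (x ℤ.* x) ≡⟨ cong (λ w → X ℤ.* X ℤ.- + d ℤ.* (b ℤ.* b) ℤ.* w) x²≡ ⟩
      X ℤ.* X ℤ.- + d ℤ.* (b ℤ.* b) ℤ.* (X ℤ.+ e) ≡⟨ solve 2 (λ X w → X :* X :- w :* (X :+ (X :- w)) := (X :- w) :* (X :- w)) refl X (+ d ℤ.* (b ℤ.* b)) ⟩
      e ℤ.* e ∎)) (ℤₚ.abs-* e e)
      where
      open ≡-Reasoning
      x²≡ : x ℤ.* x ≡ X ℤ.+ e
      x²≡ = trans (solve 2 (λ x² e → x² := x² :- e :+ e) refl (x ℤ.* x) e) (cong (ℤ._+ e) (sym 2X≡))
    sum≡ : ∣ X ℤ.+ e ∣ ≡ ∣ x ∣ ℕ.* ∣ x ∣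
    sum≡ = trans (cong ∣_∣ (trans (cong (ℤ._+ e) 2X≡) (solve 2 (λ x² e → x² :- e :+ e := x²) refl (x ℤ.* x) e))) (ℤₚ.abs-* x x)
    diff≡ : ∣ X ℤ.- e ∣ ≡ d ℕ.* (∣ b ∣ ℕ.* ∣ b ∣)
    diff≡ = trans (cong ∣_∣ (solve 2 (λ X w → X :- (X :- w) := w) refl X (+ d ℤ.* (b ℤ.* b))))
      (trans (ℤₚ.abs-* (+ d) (b ℤ.* b)) (cong (d ℕ.*_) (ℤₚ.abs-* b b)))
    by-sign : ∀ e′ → e ≡ e′ → k ∈ split ∣ e′ ∣
    by-sign (+ s) e≡ = ∈-++⁺ˡ (rootsSplit-complete z k refl _ _
      (trans (cong (λ w → ∣ X ℤ.+ w ∣) (sym e≡)) sum≡) (trans (cong (λ w → ∣ X ℤ.- w ∣) (sym e≡)) diff≡))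
    by-sign -[1+ s ] e≡ = ∈-++⁺ʳ (rootsSplit z (∣ X ℤ.+ + suc s ∣) (∣ X ℤ.- + suc s ∣)) (rootsSplit-complete z k refl _ _
      (trans (cong (λ w → ∣ X ℤ.+ w ∣) (sym e≡)) sum≡) (trans (cong (λ w → ∣ X ℤ.- w ∣) (sym e≡)) diff≡))

  lexPositive?-total : ∀ x → lexPositive? x ≡ false → lexPositive? (⊖ x) ≡ true
  lexPositive?-total (+ zero + -[1+ b ] ·ω) _ = refl
  lexPositive?-total (-[1+ a ] + b ·ω)     _ = refl

  zero?-⊖ : ∀ x → zero? (⊖ x) ≡ zero? x
  zero?-⊖ (a + b ·ω) = cong₂ (λ u v → (u ≡ᵇ 0) ∧ (v ≡ᵇ 0)) (ℤₚ.∣-i∣≡∣i∣ a) (ℤₚ.∣-i∣≡∣i∣ b)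

  normalised?-total : ∀ x y → normalised? x y ≡ false → normalised? (⊖ x) (⊖ y) ≡ true
  normalised?-total x y e rewrite zero?-⊖ x with zero? x
  ... | true  = lexPositive?-total y e
  ... | false = lexPositive?-total x e

all-++ : ∀ {A : Set} (p : A → Bool) xs {ys} → all p (xs ++ ys) ≡ true → all p xs ≡ true × all p ys ≡ true
all-++ p []       e = refl , e
all-++ p (x ∷ xs) e = let (px , e′) = ∧-true {p x} e ; (l , r) = all-++ p xs e′ in cong₂ _∧_ px l , r

false≢true : false ≡ true → ⊥
false≢true ()

module Soundness (t c : ℤ) (d : ℕ) .{{_ : NonZero d}} (∣t∣≤1 : ∣ t ∣ ℕ.≤ 1) (Δ≡d : Order.Δ t c ≡ + d) (𝓜 : Positivity.Model t c) where
  open Order t c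
  open Positivity t c
  open Model 𝓜
  open Checker t c d
  open Completeness t c d ∣t∣≤1 Δ≡d
  open ModelFacts t c (subst (+ 0 ℤ.≤_) (sym Δ≡d) (+≤+ z≤n)) 𝓜
  private
    open OS using (solve; _:=_; _:+_; _:*_; _:-_; :-_; con)

    neg : V → V
    neg v = lin (int -[1+ 0 ]) v (int (+ 0)) v

    Q-neg : ∀ v → Q (neg v) ≡ Q v
    Q-neg v = trans (Q-lin (int -[1+ 0 ]) v (int (+ 0)) v)
      (solve 2 (λ q b → con -[1+ 0 ] :* con -[1+ 0 ] :* q :+ con -[1+ 0 ] :* con (+ 0) :* b :+ con (+ 0) :* con (+ 0) :* q := q) refl (Q v) (T v v))

    T-neg : ∀ u v → T u (neg v) ≡ ⊖ T u v
    T-neg u v = trans (T-lin u (int -[1+ 0 ]) v (int (+ 0)) v)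
      (solve 1 (λ b → con -[1+ 0 ] :* b :+ con (+ 0) :* b := :- b) refl (T u v))

    normalise : ∀ v₁ v₂ v → Σ V λ w → Q w ≡ Q v × normalised? (T v₁ w) (T v₂ w) ≡ true
    normalise v₁ v₂ v with normalised? (T v₁ v) (T v₂ v) in eq
    ... | true  = v , refl , eq
    ... | false = neg v , Q-neg v ,
      trans (cong₂ normalised? (T-neg v₁ v) (T-neg v₂ v)) (normalised?-total (T v₁ v) (T v₂ v) eq)

    normalise₁ : ∀ v₁ v → Σ V λ w → Q w ≡ Q v × lexPositive? (T v₁ w) ≡ true
    normalise₁ v₁ v with lexPositive? (T v₁ v) in eq
    ... | true  = v , refl , eq
    ... | false = neg v , Q-neg v , trans (cong lexPositive? (T-neg v₁ v)) (lexPositive?-total (T v₁ v) eq)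

  module _ (v₁ : V) (Qv₁ : Q v₁ ≡ int (+ 1)) (v₂ : V) where
    open Unit v₁ Qv₁
    open Second v₂
    open Search (Q v₂) (B v₂) (N v₂)

    candidateOf : V → Candidate
    candidateOf w = cand (B w) (M v₂ w) (N v₂ ⊗ N w ⊝ M v₂ w ⊗ M v₂ w)

    candidates-complete : ∀ w → normalised? (B w) (T v₂ w) ≡ true → candidateOf w ∈ candidates (Q w)
    candidates-complete w norm = ∈-concatMap (λ b → candidatesB xs b (int (+ 4) ⊗ Q w ⊝ b ⊗ b)) b∈
      (∈-when (nonNegative?-complete (N w) (N-nonNegative w)) (∈-concatMap (λ x → candidatesT (B w) (N w) x (int (+ 2) ⊗ x ⊝ B v₂ ⊗ B w)) x∈
        (∈-when (cong₂ _∧_ norm (nonNegative?-complete (N v₂ ⊗ N w ⊝ M v₂ w ⊗ M v₂ w) (M²≤NN v₂ w))) (here refl))))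
      where
      xs = box (int (+ 4) ⊗ Q v₂ ⊗ Q w)
      b∈ : B w ∈ box (int (+ 4) ⊗ Q w)
      b∈ = box-complete (int (+ 4) ⊗ Q w) (B w) (N-nonNegative w)
      x∈ : T v₂ w ∈ xs
      x∈ = box-complete (int (+ 4) ⊗ Q v₂ ⊗ Q w) (T v₂ w) (cauchySchwarz v₂ w)

    linked-complete : ∀ v w → K v w ∈ linked (candidateOf v) (candidateOf w)
    linked-complete v w = ∈-concatMap
      (λ k → when (divides? (int (+ 2) ⊗ N v₂) (k ⊕ (M v₂ v ⊗ M v₂ w ⊕ N v₂ ⊗ (B v ⊗ B w)))) (k ∷ []))
      (roots-complete _ (K v w) (trans (cong (K v w ⊗_) (K-sym v w)) (trans (K-exchange v w w v) (cong₂ _⊗_ (Kvv v) (Kvv w)))))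
      (∈-when (trans (cong (divides? (int (+ 2) ⊗ N v₂))
          (solve 5 (λ n x bb m m′ → (n :* (con (+ 2) :* x :- bb) :- m :* m′) :+ (m :* m′ :+ n :* bb) := (con (+ 2) :* n) :* x) refl
            (N v₂) (T v w) (B v ⊗ B w) (M v₂ v) (M v₂ w)))
        (divides?-complete (int (+ 2) ⊗ N v₂) (T v w))) (here refl))

    compatible?-complete : ∀ v w u → compatible? (candidateOf v) (candidateOf w , K v w) (candidateOf u , K v u) ≡ true
    compatible?-complete v w u = trans (cong (divides? _) (begin
        K v w ⊗ K v u ⊕ δ ⊗ (M v₂ w ⊗ M v₂ u ⊕ N v₂ ⊗ (B w ⊗ B u))
          ≡⟨ cong (_⊕ δ ⊗ (M v₂ w ⊗ M v₂ u ⊕ N v₂ ⊗ (B w ⊗ B u))) exchange ⟩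
        δ ⊗ K w u ⊕ δ ⊗ (M v₂ w ⊗ M v₂ u ⊕ N v₂ ⊗ (B w ⊗ B u))
          ≡⟨ solve 6 (λ e n x bb m m′ → e :* (n :* (con (+ 2) :* x :- bb) :- m :* m′) :+ e :* (m :* m′ :+ n :* bb) := (con (+ 2) :* n :* e) :* x) refl
               δ (N v₂) (T w u) (B w ⊗ B u) (M v₂ w) (M v₂ u) ⟩
        (int (+ 2) ⊗ N v₂ ⊗ δ) ⊗ T w u ∎))
      (divides?-complete (int (+ 2) ⊗ N v₂ ⊗ δ) (T w u))
      where
      open ≡-Reasoning
      δ = N v₂ ⊗ N v ⊝ M v₂ v ⊗ M v₂ v
      exchange : K v w ⊗ K v u ≡ δ ⊗ K w u
      exchange = trans (cong (_⊗ K v u) (K-sym v w)) (trans (K-exchange w v v u) (trans (cong₂ _⊗_ refl (Kvv v)) (CommutativeRing.*-comm O-commutativeRing (K w u) δ)))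

    Contains : List Candidate → Set
    Contains W = Σ V λ w → candidateOf w ∈ W

    Arises : V → Candidate × O → Set
    Arises v (e , k) = Σ V λ u → e ≡ candidateOf u × k ≡ K v u

    all-compatible : ∀ v w {chosen} → All (Arises v) chosen → all (compatible? (candidateOf v) (candidateOf w , K v w)) chosen ≡ true
    all-compatible v w []                       = refl
    all-compatible v w ((u , refl , refl) ∷ as) = cong₂ _∧_ (compatible?-complete v w u) (all-compatible v w as)

    -- The true value `K v w` is enumerated by `linked`, and it is compatible with every chosen pair
    -- because these also arise from vectors. The first alternative of the test is thereby ruled
    -- out.
    noneOf?-sound : ∀ v {chosen W} dead? → All (Arises v) chosen → noneOf? (candidateOf v) chosen W dead? ≡ true →
      ∀ {w} → candidateOf w ∈ W → dead? (candidateOf w , K v w) ≡ true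
    noneOf?-sound v {chosen} {W} dead? as e {w} w∈ = [ (λ incompatible → ⊥-elim (not-true incompatible (all-compatible v w as))) , id ]′
      (∨-true {not (all (compatible? (candidateOf v) (candidateOf w , K v w)) chosen)}
        (all-true (λ k → not (all (compatible? (candidateOf v) (candidateOf w , k)) chosen) ∨ dead? (candidateOf w , k))
          (all-true (λ w → all (λ k → not (all (compatible? (candidateOf v) (w , k)) chosen) ∨ dead? (w , k)) (linked (candidateOf v) w)) e w∈)
          (linked-complete v w)))

    leaves-sound : ∀ v {chosen leaves} → All (Arises v) chosen → All Contains leaves →
      any (λ W → noneOf? (candidateOf v) chosen W (λ _ → false)) leaves ≡ true → ⊥
    leaves-sound v {chosen} {leaves} as ls e =
      let (W , W∈ , none) = any-true (λ W → noneOf? (candidateOf v) chosen W (λ _ → false)) leaves e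
      in false≢true (noneOf?-sound v (λ _ → false) as none (proj₂ (All.lookup ls W∈)))

    refute-sound : ∀ v {chosen leaves branches} → All (Arises v) chosen → All Contains leaves → All Contains branches →
      refute (candidateOf v) chosen leaves branches ≡ true → ⊥
    refute-sound v as ls []             e = leaves-sound v as ls e
    refute-sound v {chosen} {leaves} {W ∷ branches} as ls ((w , w∈) ∷ bs) e =
      [ leaves-sound v as ls
      , (λ none → refute-sound v ((w , refl , refl) ∷ as) ls bs
          (noneOf?-sound v (λ wk → refute (candidateOf v) (wk ∷ chosen) leaves branches) as none w∈)) ]′
      (∨-true {any (λ W → noneOf? (candidateOf v) chosen W (λ _ → false)) leaves} e)

    contains : ∀ α → Positive α → Contains (candidates α)
    contains α α>0 =
      let (v , Qv≡)        = repr α α>0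
          (w , Qw≡ , norm) = normalise v₁ v₂ v
      in w , subst (λ α → candidateOf w ∈ candidates α) (trans Qw≡ Qv≡) (candidates-complete w norm)

    all-contained : ∀ αs → all positive? αs ≡ true → All Contains (map candidates αs)
    all-contained []       _ = []
    all-contained (α ∷ αs) e = let (p , q) = ∧-true e in contains α (positive?-sound α p) ∷ all-contained αs q

    checkEntry-sound : ∀ e → checkEntry (Q v₂) (B v₂) e ≡ true → ⊥
    checkEntry-sound (entry b₂ α₃ leaves branches) e =
      let e₁            = proj₂ (∧-true {zero? (B v₂ ⊝ b₂)} e)
          (pos , ref)   = ∧-true {all positive? (α₃ ∷ leaves ++ branches)} e₁
          (pos₃ , e₂)   = ∧-true {positive? α₃} pos
          (posˡ , posᵇ) = all-++ positive? leaves e₂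
          (v₃ , v₃∈)    = contains α₃ (positive?-sound α₃ pos₃)
      in refute-sound v₃ [] (all-contained leaves posˡ) (all-contained branches posᵇ)
           (all-true (λ v₃ → refute v₃ [] (map candidates leaves) (map candidates branches)) ref v₃∈)

  Positive-1 : Positive (int (+ 1))
  Positive-1 = subst (+ 0 ℤ.<_) (sym tr1) (+<+ (s≤s z≤n)) ,
    subst₂ ℤ._<_ (sym (ℤₚ.*-zeroʳ Δ)) (cong (λ u → u ℤ.* u) (sym tr1)) (+<+ (s≤s z≤n))
    where
    tr1 : tr (int (+ 1)) ≡ + 2
    tr1 = ℤS.solve 1 (λ t → ℤS.con (+ 2) ℤS.:* ℤS.con (+ 1) ℤS.:+ t ℤS.:* ℤS.con (+ 0) ℤS.:= ℤS.con (+ 2)) refl t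

  check-sound : ∀ cert → check cert ≡ true → ⊥
  check-sound (certificate α₂ entries) e = conclude (∨-true (all-true accepts (proj₂ (∧-true {positive? α₂} e)) b₂∈))
    where
    pos₂ = positive?-sound α₂ (proj₁ (∧-true {positive? α₂} e))
    v₁  = proj₁ (repr (int (+ 1)) Positive-1)
    Qv₁ = proj₂ (repr (int (+ 1)) Positive-1)
    open Unit v₁ Qv₁
    v₂-normal : Σ V λ w → Q w ≡ Q (proj₁ (repr α₂ pos₂)) × lexPositive? (T v₁ w) ≡ true
    v₂-normal = normalise₁ v₁ (proj₁ (repr α₂ pos₂))
    v₂ = proj₁ v₂-normal
    Qv₂≡ : Q v₂ ≡ α₂
    Qv₂≡ = trans (proj₁ (proj₂ v₂-normal)) (proj₂ (repr α₂ pos₂))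
    accepts : O → Bool
    accepts b₂ = not (lexPositive? b₂) ∨ not (nonNegative? (int (+ 4) ⊗ α₂ ⊝ b₂ ⊗ b₂)) ∨ any (checkEntry α₂ b₂) entries
    nonNeg : NonNegative (int (+ 4) ⊗ α₂ ⊝ B v₂ ⊗ B v₂)
    nonNeg = subst (λ q → NonNegative (int (+ 4) ⊗ q ⊝ B v₂ ⊗ B v₂)) Qv₂≡ (N-nonNegative v₂)
    b₂∈ : B v₂ ∈ box (int (+ 4) ⊗ α₂)
    b₂∈ = box-complete (int (+ 4) ⊗ α₂) (B v₂) nonNeg
    found-sound : any (checkEntry α₂ (B v₂)) entries ≡ true → ⊥
    found-sound found =
      let (en , _ , ok) = any-true (checkEntry α₂ (B v₂)) entries found
      in checkEntry-sound v₁ Qv₁ v₂ en (subst (λ α → checkEntry α (B v₂) en ≡ true) (sym Qv₂≡) ok)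
    conclude : not (lexPositive? (B v₂)) ≡ true
      ⊎ (not (nonNegative? (int (+ 4) ⊗ α₂ ⊝ B v₂ ⊗ B v₂)) ∨ any (checkEntry α₂ (B v₂)) entries) ≡ true → ⊥
    conclude (inj₁ notNorm) = not-true notNorm (proj₂ (proj₂ v₂-normal))
    conclude (inj₂ e″) = [ (λ notNonNeg → not-true notNonNeg (nonNegative?-complete (int (+ 4) ⊗ α₂ ⊝ B v₂ ⊗ B v₂) nonNeg)) , found-sound ]′
      (∨-true {not (nonNegative? (int (+ 4) ⊗ α₂ ⊝ B v₂ ⊗ B v₂))} e″)

-- Large discriminants

-- `X` is the trace of `a₀ + ω`. The inequality `d < X²` makes this element totally positive, and
-- `40 X < d` makes rational all the values of `T` that enter the contradiction.
module LargeDiscriminant (t c : ℤ) (d : ℕ) .{{_ : NonZero d}} (∣t∣≤1 : ∣ t ∣ ℕ.≤ 1) (Δ≡d : Order.Δ t c ≡ + d)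
  (𝓜 : Positivity.Model t c) (a₀ : ℤ) (X : ℕ) (X≡ : + 2 ℤ.* a₀ ℤ.+ t ℤ.* + 1 ≡ + X) (d<X² : d ℕ.< X ℕ.* X) (40X<d : 40 ℕ.* X ℕ.< d) where
  open Order t c
  open Positivity t c
  open Model 𝓜
  open Completeness t c d ∣t∣≤1 Δ≡d
  open ModelFacts t c (subst (+ 0 ℤ.≤_) (sym Δ≡d) (+≤+ z≤n)) 𝓜

  Rational : O → Set
  Rational z = Σ ℤ λ n → z ≡ int n

  int-⊗ : ∀ m n → int m ⊗ int n ≡ int (m ℤ.* n)
  int-⊗ m n = cong₂ _+_·ω
    (solve 3 (λ m n c → m :* n :+ c :* (con (+ 0) :* con (+ 0)) := m :* n) refl m n c)
    (solve 3 (λ m n t → m :* con (+ 0) :+ con (+ 0) :* n :+ t :* (con (+ 0) :* con (+ 0)) := con (+ 0)) refl m n t)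
    where open ℤS

  irr-int-⊗ : ∀ m z → irr (int m ⊗ z) ≡ m ℤ.* irr z
  irr-int-⊗ m (a + b ·ω) = solve 4 (λ m a b t → m :* b :+ con (+ 0) :* a :+ t :* (con (+ 0) :* b) := m :* b) refl m a b t
    where open ℤS

  irr-⊝ : ∀ x y → irr (x ⊝ y) ≡ irr x ℤ.- irr y
  irr-⊝ (a + b ·ω) (a′ + b′ ·ω) = refl

  irr≡0⇒Rational : ∀ z → irr z ≡ + 0 → Rational z
  irr≡0⇒Rational (a + .(+ 0) ·ω) refl = a , refl

  ⊗-Rational : ∀ {x y} → Rational x → Rational y → Rational (x ⊗ y)
  ⊗-Rational (m , refl) (n , refl) = m ℤ.* n , int-⊗ m n

  ⊝-Rational : ∀ {x y} → Rational x → Rational y → Rational (x ⊝ y)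
  ⊝-Rational (m , refl) (n , refl) = m ℤ.- n , refl

  -- By `square-bound`, a non-zero irrational coordinate would by itself contribute at least `d`.
  small⇒Rational : ∀ β z → NonNegative (β ⊝ z ⊗ z) → ∣ + 2 ℤ.* tr β ∣ ℕ.< d → Rational z
  small⇒Rational β z nn lt = irr≡0⇒Rational z (ℤₚ.∣i∣≡0⇒i≡0 (y≡0 ∣ irr z ∣
    (ℕₚ.≤-<-trans (ℕₚ.m+n≤o⇒n≤o (∣ tr z ∣ ℕ.* ∣ tr z ∣) (square-bound β z nn)) lt)))
    where
    y≡0 : ∀ y → d ℕ.* (y ℕ.* y) ℕ.< d → y ≡ 0
    y≡0 zero    _  = refl
    y≡0 (suc y) lt = ⊥-elim (ℕₚ.<⇒≱ lt (ℕₚ.m≤m*n d (suc y ℕ.* suc y)))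

  tr-int : ∀ n → tr (int n) ≡ + 2 ℤ.* n
  tr-int n = ℤS.solve 2 (λ n t → ℤS.con (+ 2) ℤS.:* n ℤS.:+ t ℤS.:* ℤS.con (+ 0) ℤS.:= ℤS.con (+ 2) ℤS.:* n) refl n t

  α : O
  α = a₀ + + 1 ·ω

  Positive-α : Positive α
  Positive-α = subst (+ 0 ℤ.<_) (sym X≡) (+<+ (X>0 X d<X²)) ,
    subst₂ ℤ._<_ (trans (sym (ℤₚ.*-identityʳ (+ d))) (cong (ℤ._* + 1) (sym Δ≡d))) (trans (ℤₚ.pos-* X X) (cong (λ x → x ℤ.* x) (sym X≡))) (+<+ d<X²)
    where
    X>0 : ∀ X → d ℕ.< X ℕ.* X → 0 ℕ.< X
    X>0 (suc X) _ = s≤s z≤n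

  Positive-int : ∀ n → Positive (int (+ suc n))
  Positive-int n = subst (+ 0 ℤ.<_) (sym (tr-int (+ suc n))) (+<+ (s≤s z≤n)) ,
    subst₂ ℤ._<_ (sym (ℤₚ.*-zeroʳ Δ)) (cong (λ x → x ℤ.* x) (sym (tr-int (+ suc n)))) (+<+ (s≤s z≤n))

  -- From `40 X < d < X²` follows `40 < X`, and then `40 · 40 < 40 X < d`.
  1600<d : 1600 ℕ.< d
  1600<d = ℕₚ.<-trans (ℕₚ.*-monoʳ-< 40 (ℕₚ.*-cancelʳ-< X 40 X (ℕₚ.<-trans 40X<d d<X²))) 40X<d

  -- The limit 40 is `4 · 2 · 5`, the bound on the square of `T v₂ v₃`; twice its trace is 160, well
  -- below `d`.
  small-int : ∀ n {β} z → β ≡ int (+ n) → n ℕ.≤ 40 → NonNegative (β ⊝ z ⊗ z) → Rational z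
  small-int n z refl n≤40 nn = small⇒Rational (int (+ n)) z nn
    (ℕₚ.≤-<-trans (ℕₚ.≤-reflexive (trans (cong (λ w → ∣ + 2 ℤ.* w ∣) (tr-int (+ n))) (trans (ℤₚ.abs-* (+ 2) (+ 2 ℤ.* + n)) (cong (2 ℕ.*_) (ℤₚ.abs-* (+ 2) (+ n))))))
      (ℕₚ.≤-<-trans (ℕₚ.*-monoʳ-≤ 2 (ℕₚ.*-monoʳ-≤ 2 n≤40)) (ℕₚ.<-trans (ℕₚ.≤ᵇ⇒≤ 161 1600 _) 1600<d)))

  -- The limit 20 is `4 · 5`, needed for `T v₃ w` when `Q v₃` is 5; twice the trace of `20 α` is
  -- `40 X`.
  small-α : ∀ n {β} z → β ≡ int (+ n) ⊗ α → n ℕ.≤ 20 → NonNegative (β ⊝ z ⊗ z) → Rational z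
  small-α n z refl n≤20 nn = small⇒Rational (int (+ n) ⊗ α) z nn (ℕₚ.≤-<-trans (ℕₚ.≤-reflexive abs≡)
    (ℕₚ.≤-<-trans (ℕₚ.≤-trans (ℕₚ.*-monoʳ-≤ 2 (ℕₚ.*-monoˡ-≤ X n≤20)) (ℕₚ.≤-reflexive (sym (ℕₚ.*-assoc 2 20 X)))) 40X<d))
    where
    tr≡ : tr (int (+ n) ⊗ α) ≡ + n ℤ.* + X
    tr≡ = trans (ℤS.solve 4 (λ n a t c → ℤS.con (+ 2) ℤS.:* (n ℤS.:* a ℤS.:+ c ℤS.:* (ℤS.con (+ 0) ℤS.:* ℤS.con (+ 1)))
        ℤS.:+ t ℤS.:* (n ℤS.:* ℤS.con (+ 1) ℤS.:+ ℤS.con (+ 0) ℤS.:* a ℤS.:+ t ℤS.:* (ℤS.con (+ 0) ℤS.:* ℤS.con (+ 1)))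
        ℤS.:= n ℤS.:* (ℤS.con (+ 2) ℤS.:* a ℤS.:+ t ℤS.:* ℤS.con (+ 1))) refl (+ n) a₀ t c)
      (cong (λ z → + n ℤ.* z) X≡)
    abs≡ : ∣ + 2 ℤ.* tr (int (+ n) ⊗ α) ∣ ≡ 2 ℕ.* (n ℕ.* X)
    abs≡ = trans (cong (λ w → ∣ + 2 ℤ.* w ∣) tr≡) (trans (ℤₚ.abs-* (+ 2) (+ n ℤ.* + X)) (cong (2 ℕ.*_) (ℤₚ.abs-* (+ n) (+ X))))

  squareBound : ∀ n b → NonNegative (int (+ n) ⊝ int b ⊗ int b) → ∣ b ∣ ℕ.* ∣ b ∣ ℕ.≤ n
  squareBound n b (0≤tr , _) = ℤₚ.drop‿+≤+ (ℤₚ.0≤i-j⇒j≤i (subst (+ 0 ℤ.≤_) (cong (λ z → + n ℤ.- z) (square≡ b))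
    (0≤-cancelˡ (+ 2) (+<+ (s≤s z≤n)) (subst (+ 0 ℤ.≤_) (trans (cong (λ w → tr (int (+ n) ⊝ w)) (int-⊗ b b)) (tr-int (+ n ℤ.- b ℤ.* b))) 0≤tr))))

  int-difference : ∀ n b → ∣ b ∣ ℕ.* ∣ b ∣ ℕ.≤ n → + n ℤ.- b ℤ.* b ≡ + (n ℕ.∸ ∣ b ∣ ℕ.* ∣ b ∣)
  int-difference n b le = trans (cong (λ z → + n ℤ.- z) (square≡ b)) (trans (ℤₚ.m-n≡m⊖n n (∣ b ∣ ℕ.* ∣ b ∣)) (ℤₚ.⊖-≥ le))

  -- The smallest positive integer not represented by the binary lattice with Gram data (1, 2; b₂) when ∣ b₂ ∣ = β ≤ 2.
  truant : ℕ → ℕ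
  truant zero    = 5
  truant (suc _) = 3

  truant≤5 : ∀ β → truant β ℕ.≤ 5
  truant≤5 zero    = ℕₚ.≤-refl
  truant≤5 (suc _) = ℕₚ.≤ᵇ⇒≤ 3 5 _

  truant-suc : ∀ β → Σ ℕ λ n → truant β ≡ suc n
  truant-suc zero    = 4 , refl
  truant-suc (suc _) = 2 , refl

  -- The product `N v₂ · N v₃` when T(v₁, v₂) and T(v₁, v₃) have absolute values `β` and `γ`.
  minor : ℕ → ℕ → ℕ
  minor β γ = (8 ℕ.∸ β ℕ.* β) ℕ.* (4 ℕ.* truant β ℕ.∸ γ ℕ.* γ)

  -- Equality would mean `K v₃ v₃ = 0`, that is, dependence of v₃ on v₁ and v₂; the choice of
  -- `truant` prevents it. Since `β ≤ 2` and `γ² ≤ 20`, only finitely many cases remain, and they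
  -- are decided by evaluation.
  minor-nonSquare : ∀ β γ m → β ℕ.* β ℕ.≤ 8 → γ ℕ.* γ ℕ.≤ 4 ℕ.* truant β → m ℕ.* m ≢ minor β γ
  minor-nonSquare β γ m β²≤8 γ²≤ m² = not-true
    (all-true (λ γ → not (isqrt (minor β γ) ℕ.* isqrt (minor β γ) ≡ᵇ minor β γ))
      (all-true (λ β → all (λ γ → not (isqrt (minor β γ) ℕ.* isqrt (minor β γ) ≡ᵇ minor β γ)) (upTo (suc (isqrt (4 ℕ.* truant β))))) {upTo 3} refl
        (∈-upTo⁺ (s≤s (≤-squares⁻¹-ℕ {β} {2} (s≤s β²≤8)))))
      (∈-upTo⁺ (s≤s (m*m≤n⇒m≤isqrt {γ} γ²≤))))
    (≡⇒≡ᵇ-true (subst (λ n → isqrt n ℕ.* isqrt n ≡ n) m² (cong (λ r → r ℕ.* r) (isqrt-square m))))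

  contradiction : ⊥
  contradiction = [ minor≢0 , (λ e → ℤₚ.<-irrefl (sym e) 0<4n₂) ]′ (ℤₚ.i*j≡0⇒i≡0∨j≡0 δ₃ irr-zero)
    where
    v₁  = proj₁ (repr (int (+ 1)) (Positive-int 0))
    Qv₁ = proj₂ (repr (int (+ 1)) (Positive-int 0))
    v₂  = proj₁ (repr (int (+ 2)) (Positive-int 1))
    Qv₂ = proj₂ (repr (int (+ 2)) (Positive-int 1))
    w   = proj₁ (repr α Positive-α)
    Qw  = proj₂ (repr α Positive-α)
    open Unit v₁ Qv₁
    open Second v₂

    N≡ : ∀ v n → Q v ≡ int (+ n) → N v ≡ int (+ (4 ℕ.* n)) ⊝ B v ⊗ B v
    N≡ v n Qv = cong (_⊝ B v ⊗ B v) (trans (cong (int (+ 4) ⊗_) Qv) (trans (int-⊗ (+ 4) (+ n)) (cong int (sym (ℤₚ.pos-* 4 n)))))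

    B-rational : ∀ v n → Q v ≡ int (+ n) → n ℕ.≤ 10 → Rational (B v)
    B-rational v n Qv n≤10 = small-int (4 ℕ.* n) (B v) refl (ℕₚ.*-monoʳ-≤ 4 n≤10) (subst NonNegative (N≡ v n Qv) (N-nonNegative v))

    b₂ = proj₁ (B-rational v₂ 2 Qv₂ (ℕₚ.≤ᵇ⇒≤ 2 10 _))
    B₂ = proj₂ (B-rational v₂ 2 Qv₂ (ℕₚ.≤ᵇ⇒≤ 2 10 _))
    s  = truant ∣ b₂ ∣

    Positive-s : Positive (int (+ s))
    Positive-s = subst (λ n → Positive (int (+ n))) (sym (proj₂ (truant-suc ∣ b₂ ∣))) (Positive-int (proj₁ (truant-suc ∣ b₂ ∣)))

    v₃  = proj₁ (repr (int (+ s)) Positive-s)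
    Qv₃ = proj₂ (repr (int (+ s)) Positive-s)
    b₃ = proj₁ (B-rational v₃ s Qv₃ (ℕₚ.≤-trans (truant≤5 ∣ b₂ ∣) (ℕₚ.≤ᵇ⇒≤ 5 10 _)))
    B₃ = proj₂ (B-rational v₃ s Qv₃ (ℕₚ.≤-trans (truant≤5 ∣ b₂ ∣) (ℕₚ.≤ᵇ⇒≤ 5 10 _)))

    N≡int : ∀ v n b → Q v ≡ int (+ n) → B v ≡ int b → N v ≡ int (+ (4 ℕ.* n) ℤ.- b ℤ.* b)
    N≡int v n b Qv Bv = trans (N≡ v n Qv) (trans (cong (λ x → int (+ (4 ℕ.* n)) ⊝ x ⊗ x) Bv) (cong (int (+ (4 ℕ.* n)) ⊝_) (int-⊗ b b)))

    b²≤ : ∀ v n b → Q v ≡ int (+ n) → B v ≡ int b → ∣ b ∣ ℕ.* ∣ b ∣ ℕ.≤ 4 ℕ.* n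
    b²≤ v n b Qv Bv = squareBound (4 ℕ.* n) b (subst NonNegative (trans (N≡ v n Qv) (cong (λ x → int (+ (4 ℕ.* n)) ⊝ x ⊗ x) Bv)) (N-nonNegative v))

    n₂ = 8 ℕ.∸ ∣ b₂ ∣ ℕ.* ∣ b₂ ∣
    n₃ = 4 ℕ.* s ℕ.∸ ∣ b₃ ∣ ℕ.* ∣ b₃ ∣

    N₂ : N v₂ ≡ int (+ n₂)
    N₂ = trans (N≡int v₂ 2 b₂ Qv₂ B₂) (cong int (int-difference 8 b₂ (b²≤ v₂ 2 b₂ Qv₂ B₂)))

    N₃ : N v₃ ≡ int (+ n₃)
    N₃ = trans (N≡int v₃ s b₃ Qv₃ B₃) (cong int (int-difference (4 ℕ.* s) b₃ (b²≤ v₃ s b₃ Qv₃ B₃)))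

    T₂₃ : Rational (T v₂ v₃)
    T₂₃ = small-int (8 ℕ.* s) (T v₂ v₃)
      (trans (cong₂ (λ x y → int (+ 4) ⊗ x ⊗ y) Qv₂ Qv₃) (trans (cong (_⊗ int (+ s)) (int-⊗ (+ 4) (+ 2))) (trans (int-⊗ (+ 8) (+ s)) (cong int (sym (ℤₚ.pos-* 8 s))))))
      (ℕₚ.*-monoʳ-≤ 8 (truant≤5 ∣ b₂ ∣)) (cauchySchwarz v₂ v₃)

    Bw : Rational (B w)
    Bw = small-α 4 (B w) (cong (int (+ 4) ⊗_) Qw) (ℕₚ.≤ᵇ⇒≤ 4 20 _) (N-nonNegative w)

    T-rational : ∀ v n → Q v ≡ int (+ n) → n ℕ.≤ 5 → Rational (T v w)
    T-rational v n Qv n≤5 = small-α (4 ℕ.* n) (T v w)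
      (cong₂ _⊗_ (trans (cong (int (+ 4) ⊗_) Qv) (trans (int-⊗ (+ 4) (+ n)) (cong int (sym (ℤₚ.pos-* 4 n))))) Qw) (ℕₚ.*-monoʳ-≤ 4 n≤5) (cauchySchwarz v w)

    M-rational : ∀ {u v} → Rational (T u v) → Rational (B u) → Rational (B v) → Rational (M u v)
    M-rational Tuv Bu Bv = ⊝-Rational (⊗-Rational (+ 2 , refl) Tuv) (⊗-Rational Bu Bv)

    m₂₃ = M-rational T₂₃ (b₂ , B₂) (b₃ , B₃)
    m₂w = M-rational (T-rational v₂ 2 Qv₂ (ℕₚ.≤ᵇ⇒≤ 2 5 _)) (b₂ , B₂) Bw

    K₃w : Rational (K v₃ w)
    K₃w = ⊝-Rational (⊗-Rational (_ , N₂) (M-rational (T-rational v₃ s Qv₃ (truant≤5 ∣ b₂ ∣)) (b₃ , B₃) Bw)) (⊗-Rational m₂₃ m₂w)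

    m = proj₁ m₂₃
    δ₃ = + n₂ ℤ.* + n₃ ℤ.- m ℤ.* m

    K₃₃ : K v₃ v₃ ≡ int δ₃
    K₃₃ = trans (Kvv v₃) (trans (cong₂ (λ x y → x ⊝ y ⊗ y) (trans (cong₂ _⊗_ N₂ N₃) (int-⊗ (+ n₂) (+ n₃))) (proj₂ m₂₃))
      (cong (int (+ n₂ ℤ.* + n₃) ⊝_) (int-⊗ m m)))

    minor≢0 : δ₃ ≡ + 0 → ⊥
    minor≢0 e = minor-nonSquare (∣ b₂ ∣) (∣ b₃ ∣) (∣ m ∣) (b²≤ v₂ 2 b₂ Qv₂ B₂) (b²≤ v₃ s b₃ Qv₃ B₃)
      (ℤₚ.+-injective (trans (sym (square≡ m)) (trans (sym (ℤₚ.i-j≡0⇒i≡j (+ n₂ ℤ.* + n₃) (m ℤ.* m) e)) (sym (ℤₚ.pos-* n₂ n₃)))))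

    0<4n₂ : + 0 ℤ.< + n₂ ℤ.* + 4
    0<4n₂ = 0<*0< (+<+ (ℕₚ.m<n⇒0<n∸m (ℕₚ.≤-<-trans (ℕₚ.*-mono-≤ β≤2 β≤2) (ℕₚ.≤ᵇ⇒≤ 5 8 _)))) (+<+ (s≤s z≤n))
      where
      β≤2 : ∣ b₂ ∣ ℕ.≤ 2
      β≤2 = ≤-squares⁻¹-ℕ {∣ b₂ ∣} {2} (s≤s (b²≤ v₂ 2 b₂ Qv₂ B₂))

    irr-Nw : irr (N w) ≡ + 4
    irr-Nw = trans (irr-⊝ (int (+ 4) ⊗ Q w) (B w ⊗ B w)) (cong₂ ℤ._-_ (trans (cong (λ q → irr (int (+ 4) ⊗ q)) Qw) (irr-int-⊗ (+ 4) α)) (cong irr (proj₂ (⊗-Rational Bw Bw))))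

    -- The sole irrational contribution comes from the term `4 Q w` of `N w`, as `Q w = α` has
    -- irrational coordinate 1.
    irr-Kww : irr (K w w) ≡ + n₂ ℤ.* + 4
    irr-Kww = trans (cong irr (Kvv w)) (trans (irr-⊝ (N v₂ ⊗ N w) (M v₂ w ⊗ M v₂ w))
      (trans (cong₂ ℤ._-_ (trans (cong (λ x → irr (x ⊗ N w)) N₂) (trans (irr-int-⊗ (+ n₂) (N w)) (cong (λ z → + n₂ ℤ.* z) irr-Nw))) (cong irr (proj₂ (⊗-Rational m₂w m₂w))))
        (ℤₚ.+-identityʳ (+ n₂ ℤ.* + 4))))

    irr-zero : δ₃ ℤ.* (+ n₂ ℤ.* + 4) ≡ + 0
    irr-zero = begin
      δ₃ ℤ.* (+ n₂ ℤ.* + 4)        ≡⟨ cong (δ₃ ℤ.*_) (sym irr-Kww) ⟩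
      δ₃ ℤ.* irr (K w w)           ≡⟨ sym (irr-int-⊗ δ₃ (K w w)) ⟩
      irr (int δ₃ ⊗ K w w)         ≡⟨ cong (λ x → irr (x ⊗ K w w)) (sym K₃₃) ⟩
      irr (K v₃ v₃ ⊗ K w w)        ≡⟨ cong irr (K-exchange v₃ v₃ w w) ⟩
      irr (K v₃ w ⊗ K w v₃)        ≡⟨ cong (λ x → irr (K v₃ w ⊗ x)) (K-sym w v₃) ⟩
      irr (K v₃ w ⊗ K v₃ w)        ≡⟨ cong irr (proj₂ (⊗-Rational K₃w K₃w)) ⟩
      + 0 ∎
      where open ≡-Reasoning

-- Certificates

nat : ℕ → O
nat n = + n + + 0 ·ω

-- Found by computer search: these are the D of discriminant at most 1720, outside the list, at which genericCertificate fails.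
exceptional : List (ℕ × Certificate)
exceptional =
  (11 , certificate (+ 4 + + 1 ·ω)
    (entry (nat 0) (+ 7 + -[1+ 1 ] ·ω) ((+ 10 + -[1+ 2 ] ·ω) ∷ (+ 17 + -[1+ 4 ] ·ω) ∷ []) ((+ 10 + -[1+ 2 ] ·ω) ∷ []) ∷
     entry (nat 1) (+ 5 + -[1+ 0 ] ·ω) ((+ 4 + -[1+ 0 ] ·ω) ∷ (+ 17 + -[1+ 4 ] ·ω) ∷ []) ([]) ∷
     entry (+ 2 + + 1 ·ω) (+ 5 + -[1+ 0 ] ·ω) ((+ 17 + -[1+ 4 ] ·ω) ∷ []) ([]) ∷ [])) ∷
  (14 , certificate (+ 4 + + 1 ·ω)
    (entry (nat 0) (+ 4 + -[1+ 0 ] ·ω) (nat 2 ∷ (+ 7 + -[1+ 0 ] ·ω) ∷ (+ 21 + -[1+ 4 ] ·ω) ∷ []) ([]) ∷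
     entry (nat 1) (nat 5) ((+ 21 + -[1+ 4 ] ·ω) ∷ (+ 14 + -[1+ 2 ] ·ω) ∷ (+ 16 + -[1+ 2 ] ·ω) ∷ []) ([]) ∷ [])) ∷
  (15 , certificate (nat 2)
    (entry (nat 0) (+ 8 + -[1+ 1 ] ·ω) ((+ 4 + -[1+ 0 ] ·ω) ∷ (+ 12 + -[1+ 2 ] ·ω) ∷ []) ((+ 4 + -[1+ 0 ] ·ω) ∷ []) ∷
     entry (nat 1) (+ 4 + -[1+ 0 ] ·ω) ((+ 8 + -[1+ 1 ] ·ω) ∷ []) ([]) ∷
     entry (nat 2) (+ 4 + -[1+ 0 ] ·ω) ((+ 7 + -[1+ 0 ] ·ω) ∷ []) (nat 3 ∷ []) ∷ [])) ∷
  (19 , certificate (nat 2)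
    (entry (nat 0) (+ 9 + -[1+ 1 ] ·ω) ((+ 5 + -[1+ 0 ] ·ω) ∷ []) ([]) ∷
     entry (nat 1) (+ 9 + -[1+ 1 ] ·ω) ((+ 5 + -[1+ 0 ] ·ω) ∷ nat 5 ∷ []) ([]) ∷
     entry (nat 2) (+ 5 + -[1+ 0 ] ·ω) ((+ 5 + + 1 ·ω) ∷ []) ([]) ∷ [])) ∷
  (22 , certificate (nat 2)
    (entry (nat 0) (+ 6 + + 1 ·ω) ((+ 5 + -[1+ 0 ] ·ω) ∷ (+ 6 + -[1+ 0 ] ·ω) ∷ (+ 17 + -[1+ 2 ] ·ω) ∷ (+ 197 + -[1+ 41 ] ·ω) ∷ []) ((+ 24 + -[1+ 4 ] ·ω) ∷ []) ∷
     entry (nat 1) (+ 5 + -[1+ 0 ] ·ω) ((+ 5 + + 1 ·ω) ∷ []) ([]) ∷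
     entry (nat 2) (+ 5 + + 1 ·ω) ((+ 5 + -[1+ 0 ] ·ω) ∷ (+ 17 + -[1+ 2 ] ·ω) ∷ []) ([]) ∷ [])) ∷
  (23 , certificate (nat 2)
    (entry (nat 0) (+ 10 + -[1+ 1 ] ·ω) ((+ 5 + -[1+ 0 ] ·ω) ∷ (+ 24 + -[1+ 4 ] ·ω) ∷ []) ((+ 5 + -[1+ 0 ] ·ω) ∷ []) ∷
     entry (nat 1) (+ 5 + -[1+ 0 ] ·ω) ((+ 5 + + 1 ·ω) ∷ []) ([]) ∷
     entry (nat 2) (+ 5 + -[1+ 0 ] ·ω) ((+ 5 + + 1 ·ω) ∷ []) ([]) ∷ [])) ∷
  (26 , certificate (nat 2)
    (entry (nat 0) (+ 7 + -[1+ 0 ] ·ω) ((+ 6 + + 1 ·ω) ∷ (+ 11 + -[1+ 1 ] ·ω) ∷ (+ 10 + -[1+ 0 ] ·ω) ∷ []) ([]) ∷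
     entry (nat 1) (+ 6 + -[1+ 0 ] ·ω) ((+ 6 + + 1 ·ω) ∷ (+ 10 + -[1+ 0 ] ·ω) ∷ []) ([]) ∷
     entry (nat 2) (+ 6 + -[1+ 0 ] ·ω) ((+ 6 + + 1 ·ω) ∷ []) ([]) ∷ [])) ∷
  (29 , certificate (nat 2)
    (entry (nat 0) (+ 4 + -[1+ 0 ] ·ω) ((+ 3 + + 1 ·ω) ∷ (+ 7 + -[1+ 1 ] ·ω) ∷ []) ([]) ∷
     entry (nat 1) (+ 4 + -[1+ 0 ] ·ω) ((+ 3 + + 1 ·ω) ∷ nat 3 ∷ nat 6 ∷ []) ([]) ∷
     entry (nat 2) (+ 4 + -[1+ 0 ] ·ω) ((+ 3 + + 1 ·ω) ∷ []) ([]) ∷ [])) ∷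
  (30 , certificate (nat 2)
    (entry (nat 0) (+ 11 + -[1+ 1 ] ·ω) ((+ 6 + -[1+ 0 ] ·ω) ∷ (+ 17 + -[1+ 2 ] ·ω) ∷ (+ 7 + -[1+ 0 ] ·ω) ∷ []) ((+ 6 + -[1+ 0 ] ·ω) ∷ []) ∷
     entry (nat 1) (+ 6 + -[1+ 0 ] ·ω) ((+ 6 + + 1 ·ω) ∷ []) ([]) ∷
     entry (nat 2) (+ 11 + -[1+ 1 ] ·ω) (nat 3 ∷ []) ([]) ∷ [])) ∷
  (31 , certificate (nat 2)
    (entry (nat 0) (+ 6 + -[1+ 0 ] ·ω) ((+ 6 + + 1 ·ω) ∷ (+ 14 + -[1+ 0 ] ·ω) ∷ []) ([]) ∷
     entry (nat 1) (+ 6 + -[1+ 0 ] ·ω) ((+ 6 + + 1 ·ω) ∷ nat 3 ∷ []) ([]) ∷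
     entry (nat 2) (+ 6 + -[1+ 0 ] ·ω) ((+ 6 + + 1 ·ω) ∷ []) ([]) ∷ [])) ∷
  (35 , certificate (nat 2)
    (entry (nat 0) (+ 12 + -[1+ 1 ] ·ω) ((+ 6 + -[1+ 0 ] ·ω) ∷ (+ 18 + -[1+ 2 ] ·ω) ∷ []) ((+ 6 + -[1+ 0 ] ·ω) ∷ []) ∷
     entry (nat 1) (+ 6 + -[1+ 0 ] ·ω) (nat 3 ∷ []) ([]) ∷
     entry (nat 2) (+ 6 + -[1+ 0 ] ·ω) ((+ 12 + -[1+ 1 ] ·ω) ∷ []) ([]) ∷ [])) ∷
  (37 , certificate (nat 2)
    (entry (nat 0) (+ 4 + -[1+ 0 ] ·ω) ((+ 3 + + 1 ·ω) ∷ []) ([]) ∷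
     entry (nat 1) (+ 4 + -[1+ 0 ] ·ω) ((+ 3 + + 1 ·ω) ∷ nat 3 ∷ []) ([]) ∷
     entry (nat 2) (+ 4 + -[1+ 0 ] ·ω) ((+ 3 + + 1 ·ω) ∷ []) ([]) ∷ [])) ∷
  (38 , certificate (nat 2)
    (entry (nat 0) (+ 8 + + 1 ·ω) ((+ 7 + -[1+ 0 ] ·ω) ∷ (+ 8 + -[1+ 0 ] ·ω) ∷ (+ 44 + -[1+ 6 ] ·ω) ∷ []) ([]) ∷
     entry (nat 1) (+ 7 + -[1+ 0 ] ·ω) ((+ 7 + + 1 ·ω) ∷ []) ([]) ∷
     entry (nat 2) (+ 7 + -[1+ 0 ] ·ω) ((+ 7 + + 1 ·ω) ∷ (+ 44 + -[1+ 6 ] ·ω) ∷ []) ([]) ∷ [])) ∷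
  (39 , certificate (nat 2)
    (entry (nat 0) (+ 13 + -[1+ 1 ] ·ω) ((+ 25 + -[1+ 3 ] ·ω) ∷ []) ([]) ∷
     entry (nat 1) (+ 7 + -[1+ 0 ] ·ω) ((+ 7 + + 1 ·ω) ∷ []) ([]) ∷
     entry (nat 2) (+ 7 + -[1+ 0 ] ·ω) ((+ 7 + + 1 ·ω) ∷ []) ([]) ∷ [])) ∷
  (42 , certificate (nat 2)
    (entry (nat 0) (+ 13 + -[1+ 1 ] ·ω) ((+ 7 + -[1+ 0 ] ·ω) ∷ []) ([]) ∷
     entry (nat 1) (+ 7 + -[1+ 0 ] ·ω) ((+ 7 + + 1 ·ω) ∷ []) ([]) ∷
     entry (nat 2) (+ 13 + -[1+ 1 ] ·ω) ((+ 7 + -[1+ 0 ] ·ω) ∷ []) ([]) ∷ [])) ∷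
  (46 , certificate (nat 2)
    (entry (nat 0) (+ 7 + -[1+ 0 ] ·ω) ((+ 7 + + 1 ·ω) ∷ (+ 23 + -[1+ 2 ] ·ω) ∷ []) ([]) ∷
     entry (nat 1) (+ 7 + -[1+ 0 ] ·ω) ((+ 7 + + 1 ·ω) ∷ []) ([]) ∷
     entry (nat 2) (+ 7 + -[1+ 0 ] ·ω) ((+ 7 + + 1 ·ω) ∷ []) ([]) ∷ [])) ∷
  (51 , certificate (nat 2)
    (entry (nat 0) (+ 8 + -[1+ 0 ] ·ω) ((+ 8 + + 1 ·ω) ∷ (+ 9 + -[1+ 0 ] ·ω) ∷ []) ([]) ∷
     entry (nat 1) (+ 8 + -[1+ 0 ] ·ω) ((+ 8 + + 1 ·ω) ∷ []) ([]) ∷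
     entry (nat 2) (+ 8 + -[1+ 0 ] ·ω) ((+ 8 + + 1 ·ω) ∷ []) ([]) ∷ [])) ∷
  (53 , certificate (nat 2)
    (entry (nat 0) (+ 5 + -[1+ 0 ] ·ω) ((+ 4 + + 1 ·ω) ∷ (+ 5 + + 1 ·ω) ∷ (+ 6 + -[1+ 0 ] ·ω) ∷ []) ([]) ∷
     entry (nat 1) (+ 5 + -[1+ 0 ] ·ω) ((+ 4 + + 1 ·ω) ∷ (+ 9 + -[1+ 1 ] ·ω) ∷ []) ([]) ∷
     entry (nat 2) (+ 5 + -[1+ 0 ] ·ω) ((+ 4 + + 1 ·ω) ∷ []) ([]) ∷ [])) ∷
  (55 , certificate (nat 2)
    (entry (nat 0) (+ 9 + -[1+ 0 ] ·ω) ((+ 8 + + 1 ·ω) ∷ nat 5 ∷ []) ([]) ∷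
     entry (nat 1) (+ 8 + -[1+ 0 ] ·ω) (nat 3 ∷ []) ([]) ∷
     entry (nat 2) (+ 8 + + 1 ·ω) ((+ 8 + -[1+ 0 ] ·ω) ∷ (+ 13 + -[1+ 0 ] ·ω) ∷ (+ 11 + -[1+ 0 ] ·ω) ∷ []) ([]) ∷ [])) ∷
  (57 , certificate (nat 2)
    (entry (nat 0) (+ 5 + -[1+ 0 ] ·ω) ((+ 4 + + 1 ·ω) ∷ (+ 9 + -[1+ 1 ] ·ω) ∷ []) ([]) ∷
     entry (nat 1) (+ 171 + -[1+ 39 ] ·ω) ((+ 5 + -[1+ 0 ] ·ω) ∷ []) ([]) ∷
     entry (nat 2) (+ 5 + -[1+ 0 ] ·ω) ((+ 4 + + 1 ·ω) ∷ []) ([]) ∷ [])) ∷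
  (58 , certificate (nat 2)
    (entry (nat 0) (+ 8 + -[1+ 0 ] ·ω) ((+ 8 + + 1 ·ω) ∷ (+ 12 + -[1+ 0 ] ·ω) ∷ []) ([]) ∷
     entry (nat 1) (+ 8 + -[1+ 0 ] ·ω) ((+ 8 + + 1 ·ω) ∷ []) ([]) ∷
     entry (nat 2) (+ 8 + -[1+ 0 ] ·ω) ((+ 8 + + 1 ·ω) ∷ []) ([]) ∷ [])) ∷
  (61 , certificate (nat 2)
    (entry (nat 0) (+ 9 + -[1+ 1 ] ·ω) ((+ 7 + + 2 ·ω) ∷ []) ([]) ∷
     entry (nat 1) (+ 9 + -[1+ 1 ] ·ω) ((+ 5 + -[1+ 0 ] ·ω) ∷ (+ 172 + -[1+ 38 ] ·ω) ∷ []) ([]) ∷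
     entry (nat 2) (+ 9 + -[1+ 1 ] ·ω) ((+ 7 + + 2 ·ω) ∷ []) ([]) ∷ [])) ∷
  (62 , certificate (nat 2)
    (entry (nat 0) (+ 8 + -[1+ 0 ] ·ω) ((+ 8 + + 1 ·ω) ∷ (+ 63 + -[1+ 7 ] ·ω) ∷ []) ([]) ∷
     entry (nat 1) (+ 8 + -[1+ 0 ] ·ω) ((+ 8 + + 1 ·ω) ∷ []) ([]) ∷
     entry (nat 2) (+ 8 + -[1+ 0 ] ·ω) ((+ 8 + + 1 ·ω) ∷ []) ([]) ∷ [])) ∷
  (66 , certificate (nat 2)
    (entry (nat 0) (+ 11 + -[1+ 0 ] ·ω) ((+ 41 + -[1+ 4 ] ·ω) ∷ (+ 10 + -[1+ 0 ] ·ω) ∷ []) ([]) ∷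
     entry (nat 1) (+ 9 + -[1+ 0 ] ·ω) ((+ 9 + + 1 ·ω) ∷ []) ([]) ∷
     entry (nat 2) (+ 9 + -[1+ 0 ] ·ω) ((+ 10 + + 1 ·ω) ∷ (+ 14 + -[1+ 0 ] ·ω) ∷ []) ([]) ∷ [])) ∷
  (69 , certificate (nat 2)
    (entry (nat 0) (+ 14 + -[1+ 2 ] ·ω) ((+ 5 + -[1+ 0 ] ·ω) ∷ []) ([]) ∷
     entry (nat 1) (+ 14 + -[1+ 2 ] ·ω) ((+ 5 + -[1+ 0 ] ·ω) ∷ []) ([]) ∷
     entry (nat 2) (+ 5 + -[1+ 0 ] ·ω) ((+ 4 + + 1 ·ω) ∷ []) ([]) ∷ [])) ∷
  (70 , certificate (nat 2)
    (entry (nat 0) (+ 9 + -[1+ 0 ] ·ω) ((+ 9 + + 1 ·ω) ∷ (+ 11 + -[1+ 0 ] ·ω) ∷ []) ([]) ∷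
     entry (nat 1) (+ 9 + -[1+ 0 ] ·ω) ((+ 9 + + 1 ·ω) ∷ []) ([]) ∷
     entry (nat 2) (+ 10 + -[1+ 0 ] ·ω) ((+ 9 + + 1 ·ω) ∷ []) ([]) ∷ [])) ∷
  (73 , certificate (nat 2)
    (entry (nat 0) (+ 5 + -[1+ 0 ] ·ω) ((+ 4 + + 1 ·ω) ∷ []) ([]) ∷
     entry (nat 1) (+ 5 + -[1+ 0 ] ·ω) ((+ 4 + + 1 ·ω) ∷ nat 6 ∷ []) ([]) ∷
     entry (nat 2) (+ 5 + -[1+ 0 ] ·ω) ((+ 4 + + 1 ·ω) ∷ []) ([]) ∷ [])) ∷
  (74 , certificate (nat 2)
    (entry (nat 0) (+ 9 + -[1+ 0 ] ·ω) ((+ 9 + + 1 ·ω) ∷ (+ 13 + -[1+ 0 ] ·ω) ∷ []) ([]) ∷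
     entry (nat 1) (+ 9 + -[1+ 0 ] ·ω) ((+ 9 + + 1 ·ω) ∷ []) ([]) ∷
     entry (nat 2) (+ 9 + -[1+ 0 ] ·ω) ((+ 9 + + 1 ·ω) ∷ []) ([]) ∷ [])) ∷
  (78 , certificate (nat 2)
    (entry (nat 0) (+ 53 + -[1+ 5 ] ·ω) ((+ 9 + -[1+ 0 ] ·ω) ∷ []) ([]) ∷
     entry (nat 1) (+ 9 + -[1+ 0 ] ·ω) ((+ 9 + + 1 ·ω) ∷ []) ([]) ∷
     entry (nat 2) (+ 9 + -[1+ 0 ] ·ω) ((+ 9 + + 1 ·ω) ∷ []) ([]) ∷ [])) ∷
  (85 , certificate (nat 2)
    (entry (nat 0) (+ 5 + + 1 ·ω) ((+ 6 + -[1+ 0 ] ·ω) ∷ (+ 8 + -[1+ 0 ] ·ω) ∷ (+ 12 + -[1+ 1 ] ·ω) ∷ []) ([]) ∷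
     entry (nat 1) (+ 6 + -[1+ 0 ] ·ω) ((+ 5 + + 1 ·ω) ∷ (+ 12 + -[1+ 1 ] ·ω) ∷ (+ 47 + -[1+ 8 ] ·ω) ∷ []) ([]) ∷
     entry (nat 2) (+ 6 + -[1+ 0 ] ·ω) ((+ 5 + + 1 ·ω) ∷ nat 3 ∷ []) ([]) ∷ [])) ∷
  (87 , certificate (nat 2)
    (entry (nat 0) (+ 10 + -[1+ 0 ] ·ω) ((+ 10 + + 1 ·ω) ∷ (+ 14 + -[1+ 0 ] ·ω) ∷ []) ([]) ∷
     entry (nat 1) (+ 10 + -[1+ 0 ] ·ω) ((+ 10 + + 1 ·ω) ∷ nat 3 ∷ []) ([]) ∷
     entry (nat 2) (+ 10 + -[1+ 0 ] ·ω) ((+ 10 + + 1 ·ω) ∷ []) ([]) ∷ [])) ∷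
  (89 , certificate (nat 2)
    (entry (nat 0) (+ 11 + -[1+ 1 ] ·ω) ((+ 5 + + 1 ·ω) ∷ []) ([]) ∷
     entry (nat 1) (+ 6 + -[1+ 0 ] ·ω) ((+ 5 + + 1 ·ω) ∷ nat 3 ∷ []) ([]) ∷
     entry (nat 2) (+ 6 + -[1+ 0 ] ·ω) ((+ 5 + + 1 ·ω) ∷ []) ([]) ∷ [])) ∷
  (91 , certificate (nat 2)
    (entry (nat 0) (+ 10 + -[1+ 0 ] ·ω) ((+ 10 + + 1 ·ω) ∷ nat 10 ∷ []) ([]) ∷
     entry (nat 1) (+ 10 + -[1+ 0 ] ·ω) ((+ 10 + + 1 ·ω) ∷ nat 3 ∷ []) ([]) ∷
     entry (nat 2) (+ 10 + -[1+ 0 ] ·ω) ((+ 10 + + 1 ·ω) ∷ nat 3 ∷ []) ([]) ∷ [])) ∷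
  (93 , certificate (nat 2)
    (entry (nat 0) (+ 16 + -[1+ 2 ] ·ω) ((+ 6 + -[1+ 0 ] ·ω) ∷ []) ([]) ∷
     entry (nat 1) (+ 16 + -[1+ 2 ] ·ω) ((+ 6 + -[1+ 0 ] ·ω) ∷ []) ([]) ∷
     entry (nat 2) (+ 6 + -[1+ 0 ] ·ω) ((+ 5 + + 1 ·ω) ∷ []) ([]) ∷ [])) ∷
  (94 , certificate (nat 2)
    (entry (nat 0) (+ 10 + -[1+ 0 ] ·ω) ((+ 35 + -[1+ 2 ] ·ω) ∷ []) ([]) ∷
     entry (nat 1) (+ 10 + -[1+ 0 ] ·ω) ((+ 10 + + 1 ·ω) ∷ []) ([]) ∷
     entry (nat 2) (+ 10 + -[1+ 0 ] ·ω) ((+ 10 + + 1 ·ω) ∷ []) ([]) ∷ [])) ∷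
  (95 , certificate (nat 2)
    (entry (nat 0) (+ 11 + -[1+ 0 ] ·ω) ((+ 10 + + 1 ·ω) ∷ []) ([]) ∷
     entry (nat 1) (+ 10 + -[1+ 0 ] ·ω) ((+ 10 + + 1 ·ω) ∷ []) ([]) ∷
     entry (nat 2) (+ 10 + -[1+ 0 ] ·ω) (nat 3 ∷ []) ([]) ∷ [])) ∷
  (97 , certificate (nat 2)
    (entry (nat 0) (+ 11 + -[1+ 1 ] ·ω) ((+ 9 + + 2 ·ω) ∷ []) ([]) ∷
     entry (nat 1) (+ 11 + -[1+ 1 ] ·ω) ((+ 9 + + 2 ·ω) ∷ []) ([]) ∷
     entry (nat 2) (+ 11 + -[1+ 1 ] ·ω) (nat 3 ∷ []) ([]) ∷ [])) ∷
  (101 , certificate (nat 2)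
    (entry (nat 0) (+ 6 + -[1+ 0 ] ·ω) ((+ 5 + + 1 ·ω) ∷ []) ([]) ∷
     entry (nat 1) (+ 6 + -[1+ 0 ] ·ω) ((+ 5 + + 1 ·ω) ∷ nat 3 ∷ []) ([]) ∷
     entry (nat 2) (+ 6 + -[1+ 0 ] ·ω) ((+ 5 + + 1 ·ω) ∷ []) ([]) ∷ [])) ∷
  (102 , certificate (nat 2)
    (entry (nat 0) (+ 11 + -[1+ 0 ] ·ω) ((+ 11 + + 1 ·ω) ∷ (+ 12 + -[1+ 0 ] ·ω) ∷ []) ([]) ∷
     entry (nat 1) (+ 11 + -[1+ 0 ] ·ω) ((+ 11 + + 1 ·ω) ∷ []) ([]) ∷
     entry (nat 2) (+ 11 + -[1+ 0 ] ·ω) ((+ 11 + + 1 ·ω) ∷ []) ([]) ∷ [])) ∷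
  (105 , certificate (nat 2)
    (entry (nat 0) (+ 45 + -[1+ 7 ] ·ω) ((+ 23 + -[1+ 3 ] ·ω) ∷ []) ([]) ∷
     entry (nat 1) (+ 45 + -[1+ 7 ] ·ω) ((+ 6 + -[1+ 0 ] ·ω) ∷ nat 3 ∷ []) ([]) ∷
     entry (nat 2) (+ 45 + -[1+ 7 ] ·ω) (nat 3 ∷ []) ([]) ∷ [])) ∷
  (106 , certificate (nat 2)
    (entry (nat 0) (+ 11 + -[1+ 0 ] ·ω) ((+ 11 + + 1 ·ω) ∷ (+ 15 + -[1+ 0 ] ·ω) ∷ []) ([]) ∷
     entry (nat 1) (+ 11 + -[1+ 0 ] ·ω) ((+ 11 + + 1 ·ω) ∷ []) ([]) ∷
     entry (nat 2) (+ 11 + -[1+ 0 ] ·ω) ((+ 11 + + 1 ·ω) ∷ []) ([]) ∷ [])) ∷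
  (110 , certificate (nat 2)
    (entry (nat 0) (+ 11 + -[1+ 0 ] ·ω) ((+ 21 + -[1+ 1 ] ·ω) ∷ []) ([]) ∷
     entry (nat 1) (+ 11 + -[1+ 0 ] ·ω) ((+ 11 + + 1 ·ω) ∷ []) ([]) ∷
     entry (nat 2) (+ 12 + -[1+ 0 ] ·ω) ((+ 11 + + 1 ·ω) ∷ []) ([]) ∷ [])) ∷
  (111 , certificate (nat 2)
    (entry (nat 0) (+ 11 + -[1+ 0 ] ·ω) ((+ 11 + + 1 ·ω) ∷ (+ 15 + -[1+ 0 ] ·ω) ∷ []) ([]) ∷
     entry (nat 1) (+ 11 + -[1+ 0 ] ·ω) ((+ 11 + + 1 ·ω) ∷ []) ([]) ∷
     entry (nat 2) (+ 11 + -[1+ 0 ] ·ω) ((+ 11 + + 1 ·ω) ∷ []) ([]) ∷ [])) ∷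
  (114 , certificate (nat 2)
    (entry (nat 0) (+ 12 + -[1+ 0 ] ·ω) ((+ 11 + + 1 ·ω) ∷ []) ([]) ∷
     entry (nat 1) (+ 11 + -[1+ 0 ] ·ω) ((+ 11 + + 1 ·ω) ∷ []) ([]) ∷
     entry (nat 2) (+ 11 + -[1+ 0 ] ·ω) (nat 3 ∷ []) ([]) ∷ [])) ∷
  (115 , certificate (nat 2)
    (entry (nat 0) (+ 12 + -[1+ 0 ] ·ω) ((+ 11 + + 1 ·ω) ∷ []) ([]) ∷
     entry (nat 1) (+ 11 + -[1+ 0 ] ·ω) ((+ 11 + + 1 ·ω) ∷ []) ([]) ∷
     entry (nat 2) (+ 11 + -[1+ 0 ] ·ω) (nat 3 ∷ []) ([]) ∷ [])) ∷
  (122 , certificate (nat 2)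
    (entry (nat 0) (+ 12 + -[1+ 0 ] ·ω) ((+ 12 + + 1 ·ω) ∷ (+ 16 + -[1+ 0 ] ·ω) ∷ []) ([]) ∷
     entry (nat 1) (+ 12 + -[1+ 0 ] ·ω) ((+ 12 + + 1 ·ω) ∷ []) ([]) ∷
     entry (nat 2) (+ 12 + -[1+ 0 ] ·ω) ((+ 12 + + 1 ·ω) ∷ []) ([]) ∷ [])) ∷
  (129 , certificate (nat 2)
    (entry (nat 0) (+ 7 + -[1+ 0 ] ·ω) ((+ 6 + + 1 ·ω) ∷ []) ([]) ∷
     entry (nat 1) (+ 7 + -[1+ 0 ] ·ω) ((+ 6 + + 1 ·ω) ∷ nat 3 ∷ []) ([]) ∷
     entry (nat 2) (+ 7 + -[1+ 0 ] ·ω) ((+ 6 + + 1 ·ω) ∷ []) ([]) ∷ [])) ∷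
  (130 , certificate (nat 2)
    (entry (nat 0) (+ 12 + -[1+ 0 ] ·ω) ((+ 12 + + 1 ·ω) ∷ (+ 14 + -[1+ 0 ] ·ω) ∷ []) ([]) ∷
     entry (nat 1) (+ 12 + -[1+ 0 ] ·ω) ((+ 12 + + 1 ·ω) ∷ []) ([]) ∷
     entry (nat 2) (+ 13 + -[1+ 0 ] ·ω) ((+ 12 + + 1 ·ω) ∷ []) ([]) ∷ [])) ∷
  (133 , certificate (nat 2)
    (entry (nat 0) (+ 7 + -[1+ 0 ] ·ω) ((+ 6 + + 1 ·ω) ∷ (+ 10 + -[1+ 0 ] ·ω) ∷ (+ 20 + -[1+ 1 ] ·ω) ∷ []) ([]) ∷
     entry (nat 1) (nat 3) ((+ 7 + -[1+ 0 ] ·ω) ∷ (+ 10 + -[1+ 0 ] ·ω) ∷ (+ 20 + -[1+ 1 ] ·ω) ∷ []) ([]) ∷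
     entry (nat 2) (+ 7 + -[1+ 0 ] ·ω) ((+ 6 + + 1 ·ω) ∷ (+ 10 + -[1+ 0 ] ·ω) ∷ []) ([]) ∷ [])) ∷
  (145 , certificate (nat 2)
    (entry (nat 0) (+ 7 + -[1+ 0 ] ·ω) ((+ 6 + + 1 ·ω) ∷ (+ 11 + -[1+ 0 ] ·ω) ∷ []) ([]) ∷
     entry (nat 1) (+ 7 + -[1+ 0 ] ·ω) ((+ 6 + + 1 ·ω) ∷ []) ([]) ∷
     entry (nat 2) (+ 7 + -[1+ 0 ] ·ω) ((+ 6 + + 1 ·ω) ∷ []) ([]) ∷ [])) ∷
  (155 , certificate (nat 2)
    (entry (nat 0) (+ 13 + -[1+ 0 ] ·ω) ((+ 13 + + 1 ·ω) ∷ (+ 14 + -[1+ 0 ] ·ω) ∷ []) ([]) ∷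
     entry (nat 1) (+ 13 + -[1+ 0 ] ·ω) ((+ 13 + + 1 ·ω) ∷ []) ([]) ∷
     entry (nat 2) (+ 13 + -[1+ 0 ] ·ω) ((+ 13 + + 1 ·ω) ∷ nat 3 ∷ []) ([]) ∷ [])) ∷
  (161 , certificate (nat 2)
    (entry (nat 0) (+ 7 + -[1+ 0 ] ·ω) ((+ 6 + + 1 ·ω) ∷ (+ 30 + -[1+ 3 ] ·ω) ∷ []) ([]) ∷
     entry (nat 1) (+ 7 + -[1+ 0 ] ·ω) ((+ 6 + + 1 ·ω) ∷ []) ([]) ∷
     entry (nat 2) (+ 7 + -[1+ 0 ] ·ω) ((+ 6 + + 1 ·ω) ∷ []) ([]) ∷ [])) ∷
  (165 , certificate (nat 2)
    (entry (nat 0) (+ 7 + -[1+ 0 ] ·ω) ((+ 12 + -[1+ 0 ] ·ω) ∷ []) ([]) ∷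
     entry (nat 1) (+ 7 + -[1+ 0 ] ·ω) (nat 3 ∷ []) ([]) ∷
     entry (nat 2) (+ 7 + -[1+ 0 ] ·ω) ((+ 10 + -[1+ 0 ] ·ω) ∷ []) ([]) ∷ [])) ∷
  (170 , certificate (nat 2)
    (entry (nat 0) (+ 14 + -[1+ 0 ] ·ω) ((+ 14 + + 1 ·ω) ∷ (+ 16 + -[1+ 0 ] ·ω) ∷ []) ([]) ∷
     entry (nat 1) (+ 14 + -[1+ 0 ] ·ω) ((+ 14 + + 1 ·ω) ∷ []) ([]) ∷
     entry (nat 2) (+ 15 + -[1+ 0 ] ·ω) ((+ 14 + + 1 ·ω) ∷ []) ([]) ∷ [])) ∷
  (185 , certificate (nat 2)
    (entry (nat 0) (+ 8 + -[1+ 0 ] ·ω) ((+ 7 + + 1 ·ω) ∷ (+ 12 + -[1+ 0 ] ·ω) ∷ []) ([]) ∷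
     entry (nat 1) (+ 8 + -[1+ 0 ] ·ω) ((+ 7 + + 1 ·ω) ∷ []) ([]) ∷
     entry (nat 2) (+ 8 + -[1+ 0 ] ·ω) ((+ 7 + + 1 ·ω) ∷ []) ([]) ∷ [])) ∷
  (209 , certificate (nat 2)
    (entry (nat 0) (+ 8 + -[1+ 0 ] ·ω) ((+ 7 + + 1 ·ω) ∷ (+ 13 + -[1+ 0 ] ·ω) ∷ []) ([]) ∷
     entry (nat 1) (+ 8 + -[1+ 0 ] ·ω) (nat 3 ∷ []) ([]) ∷
     entry (nat 2) (+ 8 + -[1+ 0 ] ·ω) ((+ 7 + + 1 ·ω) ∷ (+ 11 + -[1+ 0 ] ·ω) ∷ []) ([]) ∷ [])) ∷
  (217 , certificate (nat 2)
    (entry (nat 0) (+ 8 + -[1+ 0 ] ·ω) ((+ 7 + + 1 ·ω) ∷ (+ 16 + -[1+ 0 ] ·ω) ∷ []) ([]) ∷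
     entry (nat 1) (+ 8 + -[1+ 0 ] ·ω) ((+ 7 + + 1 ·ω) ∷ []) ([]) ∷
     entry (nat 2) (+ 8 + -[1+ 0 ] ·ω) ((+ 7 + + 1 ·ω) ∷ []) ([]) ∷ [])) ∷
  (221 , certificate (nat 2)
    (entry (nat 0) (+ 8 + -[1+ 0 ] ·ω) ((+ 13 + -[1+ 0 ] ·ω) ∷ []) ([]) ∷
     entry (nat 1) (+ 8 + -[1+ 0 ] ·ω) (nat 3 ∷ []) ([]) ∷
     entry (nat 2) (+ 8 + -[1+ 0 ] ·ω) (nat 3 ∷ []) ([]) ∷ [])) ∷
  (253 , certificate (nat 2)
    (entry (nat 0) (+ 8 + + 1 ·ω) ((+ 14 + -[1+ 0 ] ·ω) ∷ (+ 29 + -[1+ 2 ] ·ω) ∷ []) ([]) ∷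
     entry (nat 1) (+ 9 + -[1+ 0 ] ·ω) ((+ 8 + + 1 ·ω) ∷ nat 3 ∷ []) ([]) ∷
     entry (nat 2) (+ 9 + -[1+ 0 ] ·ω) ((+ 8 + + 1 ·ω) ∷ (+ 12 + -[1+ 0 ] ·ω) ∷ []) ([]) ∷ [])) ∷
  (273 , certificate (nat 2)
    (entry (nat 0) (+ 9 + -[1+ 0 ] ·ω) (nat 5 ∷ (+ 38 + -[1+ 3 ] ·ω) ∷ []) ([]) ∷
     entry (nat 1) (+ 9 + -[1+ 0 ] ·ω) ((+ 8 + + 1 ·ω) ∷ nat 3 ∷ []) ([]) ∷
     entry (nat 2) (+ 9 + -[1+ 0 ] ·ω) (nat 3 ∷ []) ([]) ∷ [])) ∷
  (285 , certificate (nat 2)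
    (entry (nat 0) (+ 9 + -[1+ 0 ] ·ω) ((+ 14 + -[1+ 0 ] ·ω) ∷ []) ([]) ∷
     entry (nat 1) (+ 9 + -[1+ 0 ] ·ω) (nat 3 ∷ []) ([]) ∷
     entry (nat 2) (+ 9 + -[1+ 0 ] ·ω) (nat 3 ∷ []) ([]) ∷ [])) ∷
  (329 , certificate (nat 2)
    (entry (nat 0) (+ 10 + -[1+ 0 ] ·ω) ((+ 9 + + 1 ·ω) ∷ (+ 32 + -[1+ 2 ] ·ω) ∷ []) ([]) ∷
     entry (nat 1) (+ 10 + -[1+ 0 ] ·ω) ((+ 9 + + 1 ·ω) ∷ []) ([]) ∷
     entry (nat 2) (+ 10 + -[1+ 0 ] ·ω) ((+ 9 + + 1 ·ω) ∷ []) ([]) ∷ [])) ∷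
  (341 , certificate (nat 2)
    (entry (nat 0) (+ 10 + -[1+ 0 ] ·ω) ((+ 49 + -[1+ 4 ] ·ω) ∷ []) ([]) ∷
     entry (nat 1) (+ 10 + -[1+ 0 ] ·ω) ((+ 9 + + 1 ·ω) ∷ []) ([]) ∷
     entry (nat 2) (+ 10 + -[1+ 0 ] ·ω) ((+ 9 + + 1 ·ω) ∷ []) ([]) ∷ [])) ∷
  (357 , certificate (nat 2)
    (entry (nat 0) (+ 10 + -[1+ 0 ] ·ω) ((+ 15 + -[1+ 0 ] ·ω) ∷ []) ([]) ∷
     entry (nat 1) (+ 10 + -[1+ 0 ] ·ω) (nat 3 ∷ []) ([]) ∷
     entry (nat 2) (+ 10 + -[1+ 0 ] ·ω) (nat 3 ∷ []) ([]) ∷ [])) ∷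
  (377 , certificate (nat 2)
    (entry (nat 0) (+ 10 + + 1 ·ω) ((+ 11 + -[1+ 0 ] ·ω) ∷ (+ 15 + -[1+ 0 ] ·ω) ∷ nat 5 ∷ []) ([]) ∷
     entry (nat 1) (+ 11 + -[1+ 0 ] ·ω) ((+ 10 + + 1 ·ω) ∷ nat 3 ∷ []) ([]) ∷
     entry (nat 2) (+ 11 + -[1+ 0 ] ·ω) ((+ 10 + + 1 ·ω) ∷ nat 3 ∷ []) ([]) ∷ [])) ∷
  (385 , certificate (nat 2)
    (entry (nat 0) (+ 11 + -[1+ 0 ] ·ω) ((+ 10 + + 1 ·ω) ∷ (+ 19 + -[1+ 0 ] ·ω) ∷ []) ([]) ∷
     entry (nat 1) (+ 11 + -[1+ 0 ] ·ω) ((+ 10 + + 1 ·ω) ∷ []) ([]) ∷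
     entry (nat 2) (+ 11 + -[1+ 0 ] ·ω) ((+ 10 + + 1 ·ω) ∷ []) ([]) ∷ [])) ∷
  (429 , certificate (nat 2)
    (entry (nat 0) (+ 11 + -[1+ 0 ] ·ω) ((+ 10 + + 1 ·ω) ∷ nat 13 ∷ []) ([]) ∷
     entry (nat 1) (+ 11 + -[1+ 0 ] ·ω) ((+ 10 + + 1 ·ω) ∷ nat 3 ∷ []) ([]) ∷
     entry (nat 2) (+ 11 + -[1+ 0 ] ·ω) ((+ 10 + + 1 ·ω) ∷ []) ([]) ∷ [])) ∷
  (437 , certificate (nat 2)
    (entry (nat 0) (+ 11 + -[1+ 0 ] ·ω) ((+ 16 + -[1+ 0 ] ·ω) ∷ []) ([]) ∷
     entry (nat 1) (+ 11 + -[1+ 0 ] ·ω) (nat 3 ∷ []) ([]) ∷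
     entry (nat 2) (+ 11 + -[1+ 0 ] ·ω) (nat 3 ∷ []) ([]) ∷ [])) ∷
  (465 , certificate (nat 2)
    (entry (nat 0) (+ 12 + -[1+ 0 ] ·ω) ((+ 23 + -[1+ 1 ] ·ω) ∷ []) ([]) ∷
     entry (nat 1) (+ 12 + -[1+ 0 ] ·ω) ((+ 11 + + 1 ·ω) ∷ nat 3 ∷ []) ([]) ∷
     entry (nat 2) (+ 12 + -[1+ 0 ] ·ω) ((+ 11 + + 1 ·ω) ∷ nat 3 ∷ []) ([]) ∷ [])) ∷
  (481 , certificate (nat 2)
    (entry (nat 0) (+ 12 + -[1+ 0 ] ·ω) ((+ 11 + + 1 ·ω) ∷ (+ 16 + -[1+ 0 ] ·ω) ∷ []) ([]) ∷
     entry (nat 1) (+ 12 + -[1+ 0 ] ·ω) ((+ 11 + + 1 ·ω) ∷ []) ([]) ∷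
     entry (nat 2) (+ 12 + -[1+ 0 ] ·ω) ((+ 11 + + 1 ·ω) ∷ []) ([]) ∷ [])) ∷
  (493 , certificate (nat 2)
    (entry (nat 0) (+ 12 + -[1+ 0 ] ·ω) ((+ 11 + + 1 ·ω) ∷ (+ 17 + -[1+ 0 ] ·ω) ∷ []) ([]) ∷
     entry (nat 1) (+ 12 + -[1+ 0 ] ·ω) ((+ 11 + + 1 ·ω) ∷ nat 3 ∷ []) ([]) ∷
     entry (nat 2) (+ 12 + -[1+ 0 ] ·ω) ((+ 11 + + 1 ·ω) ∷ nat 3 ∷ []) ([]) ∷ [])) ∷
  (561 , certificate (nat 2)
    (entry (nat 0) (+ 13 + -[1+ 0 ] ·ω) ((+ 12 + + 1 ·ω) ∷ (+ 18 + -[1+ 0 ] ·ω) ∷ []) ([]) ∷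
     entry (nat 1) (+ 13 + -[1+ 0 ] ·ω) ((+ 12 + + 1 ·ω) ∷ nat 3 ∷ []) ([]) ∷
     entry (nat 2) (+ 13 + -[1+ 0 ] ·ω) ((+ 12 + + 1 ·ω) ∷ nat 3 ∷ []) ([]) ∷ [])) ∷
  (589 , certificate (nat 2)
    (entry (nat 0) (+ 13 + -[1+ 0 ] ·ω) ((+ 12 + + 1 ·ω) ∷ (+ 18 + -[1+ 0 ] ·ω) ∷ []) ([]) ∷
     entry (nat 1) (+ 13 + -[1+ 0 ] ·ω) ((+ 12 + + 1 ·ω) ∷ nat 3 ∷ []) ([]) ∷
     entry (nat 2) (+ 13 + -[1+ 0 ] ·ω) ((+ 12 + + 1 ·ω) ∷ nat 3 ∷ []) ([]) ∷ [])) ∷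
  (629 , certificate (nat 2)
    (entry (nat 0) (+ 13 + + 1 ·ω) ((+ 14 + -[1+ 0 ] ·ω) ∷ (+ 18 + -[1+ 0 ] ·ω) ∷ (+ 19 + -[1+ 0 ] ·ω) ∷ []) ([]) ∷
     entry (nat 1) (+ 14 + -[1+ 0 ] ·ω) ((+ 13 + + 1 ·ω) ∷ nat 3 ∷ []) ([]) ∷
     entry (nat 2) (+ 14 + -[1+ 0 ] ·ω) ((+ 13 + + 1 ·ω) ∷ nat 3 ∷ []) ([]) ∷ [])) ∷
  (665 , certificate (nat 2)
    (entry (nat 0) (+ 14 + -[1+ 0 ] ·ω) ((+ 13 + + 1 ·ω) ∷ (+ 19 + -[1+ 0 ] ·ω) ∷ []) ([]) ∷
     entry (nat 1) (+ 14 + -[1+ 0 ] ·ω) ((+ 13 + + 1 ·ω) ∷ nat 3 ∷ []) ([]) ∷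
     entry (nat 2) (+ 14 + -[1+ 0 ] ·ω) ((+ 13 + + 1 ·ω) ∷ nat 3 ∷ []) ([]) ∷ [])) ∷
  (741 , certificate (nat 2)
    (entry (nat 0) (+ 15 + -[1+ 0 ] ·ω) ((+ 14 + + 1 ·ω) ∷ (+ 20 + -[1+ 0 ] ·ω) ∷ nat 13 ∷ []) ([]) ∷
     entry (nat 1) (+ 15 + -[1+ 0 ] ·ω) ((+ 14 + + 1 ·ω) ∷ nat 3 ∷ []) ([]) ∷
     entry (nat 2) (+ 15 + -[1+ 0 ] ·ω) ((+ 14 + + 1 ·ω) ∷ nat 3 ∷ []) ([]) ∷ [])) ∷
  []

find : ℕ → Certificate → List (ℕ × Certificate) → Certificate
find D default []             = default
find D default ((n , e) ∷ es) = if D ≡ᵇ n then e else find D default es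

-- a + ω is the least totally positive element of this shape, where ∣ t ∣ is 0 or 1.
leastShift : ℕ → ℕ → ℕ
leastShift τ d = (isqrt d ℕ.+ 2 ℕ.∸ τ) / 2

-- The large-discriminant argument with the last two vectors interchanged: v₃ represents the least
-- `a + ω`, and then 3 or 5 cannot be represented. A rational T(v₁, v₂) has square at most 8, so 0,
-- 1 and 2 are its normalised values.
genericCertificate : ℕ → ℕ → Certificate
genericCertificate τ d = certificate (nat 2) (map (λ b → entry (nat b) (+ leastShift τ d + + 1 ·ω) (nat 3 ∷ nat 5 ∷ []) []) (0 ∷ 1 ∷ 2 ∷ []))

4*-nonZero : ∀ D .{{_ : NonZero D}} → NonZero (4 ℕ.* D)
4*-nonZero D = ℕₚ.m*n≢0 4 D

-- If `D` is 1 modulo 4, then ω² = ω + (D - 1) / 4, where rounding down turns `D / 4` into that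
-- constant, and the discriminant is `D`. Otherwise ω² = `D` and the discriminant is `4 D`.
acceptedBy : (D : ℕ) .{{_ : NonZero D}} → Certificate → Certificate → Bool
acceptedBy D cert₁ cert₀ = if D % 4 ≡ᵇ 1
  then Checker.check (+ 1) (+ (D / 4)) D cert₁
  else Checker.check (+ 0) (+ D) (4 ℕ.* D) {{4*-nonZero D}} cert₀

accepted : ℕ → Bool
accepted zero      = false
accepted D@(suc _) = acceptedBy D (find D (genericCertificate 1 D) exceptional) (find D (genericCertificate 0 (4 ℕ.* D)) exceptional)

listed : List ℕ
listed = 2 ∷ 3 ∷ 5 ∷ 6 ∷ 7 ∷ 10 ∷ 13 ∷ 17 ∷ 21 ∷ 33 ∷ 41 ∷ 65 ∷ 77 ∷ []

-- The square divisors tried are those of 2 to 41. The next square, 1764, already exceeds 1720, the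
-- largest `D` examined.
excused : ℕ → Bool
excused D = (D ℕ.≤ᵇ 1) ∨ any (D ≡ᵇ_) listed ∨ any (λ m → D % (suc (suc m) ℕ.* suc (suc m)) ≡ᵇ 0) (upTo 40)

-- For `D` not 1 modulo 4 the discriminant `4 D` exceeds 1720 from `D = 431` on, where the general
-- argument takes over.
settled : ℕ → Bool
settled D = excused D ∨ ((431 ℕ.≤ᵇ D) ∧ not (D % 4 ≡ᵇ 1)) ∨ accepted D

-- The entire finite search is carried out here, by evaluation.
all-settled : all settled (upTo 1721) ≡ true
all-settled = refl

-- Assembly of the large and the small discriminants

module Disproof (D : ℕ) (s t c : ℤ) (0<s : + 0 ℤ.< s) (s²D : s ℤ.* s ℤ.* + D ≡ t ℤ.* t ℤ.+ + 4 ℤ.* c)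
  (re-ω : re (QuadField.ω D) ℚ.+ re (QuadField.ω D) ≡ ι t) (im-ω : im (QuadField.ω D) ℚ.+ im (QuadField.ω D) ≡ ι s)
  (d : ℕ) .{{_ : NonZero d}} (∣t∣≤1 : ∣ t ∣ ℕ.≤ 1) (Δ≡d : Order.Δ t c ≡ + d) where
  open QuadField D using (ExistsUniversalTernary)

  model : ExistsUniversalTernary → Positivity.Model t c
  model (a , n , g , isLattice , _ , isUniversal) =
    FromLattice.latticeModel D s t c 0<s s²D re-ω im-ω a n g isLattice isUniversal

  certified : ∀ cert → Checker.check t c d cert ≡ true → ¬ ExistsUniversalTernary
  certified cert ok ex = Soundness.check-sound t c d ∣t∣≤1 Δ≡d (model ex) cert ok

  large : (τ : ℕ) → t ≡ + τ → 1720 ℕ.< d → ¬ ExistsUniversalTernary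
  large τ refl 1720<d ex = LargeDiscriminant.contradiction t c d ∣t∣≤1 Δ≡d (model ex) (+ leastShift τ d) X X≡
    (ℕₚ.<-≤-trans (proj₂ floor) (ℕₚ.*-mono-≤ r<X r<X)) 40X<d
    where
    r = isqrt d
    floor = sqrtFuel-floor d d ℕₚ.≤-refl
    h = leastShift τ d
    X = 2 ℕ.* h ℕ.+ τ
    X≡ : + 2 ℤ.* + h ℤ.+ + τ ℤ.* + 1 ≡ + X
    X≡ = cong₂ ℤ._+_ (sym (ℤₚ.pos-* 2 h)) (ℤₚ.*-identityʳ (+ τ))
    τ≤r+2 : τ ℕ.≤ r ℕ.+ 2
    τ≤r+2 = ℕₚ.≤-trans ∣t∣≤1 (ℕₚ.≤-trans (s≤s z≤n) (ℕₚ.m≤n+m 2 r))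
    e = r ℕ.+ 2 ℕ.∸ τ
    e+τ : e ℕ.+ τ ≡ r ℕ.+ 2
    e+τ = ℕₚ.m∸n+n≡m τ≤r+2
    X≤r+2 : X ℕ.≤ r ℕ.+ 2
    X≤r+2 = ℕₚ.≤-trans (ℕₚ.+-monoˡ-≤ τ (ℕₚ.≤-trans (ℕₚ.≤-reflexive (ℕₚ.*-comm 2 h)) (m/n*n≤m e 2))) (ℕₚ.≤-reflexive e+τ)
    -- Halving `e` loses at most 1, so `X` is at least `r + 1`; the 2 in `leastShift` compensates
    -- for this rounding.
    r<X : r ℕ.< X
    r<X = ℕₚ.≤-pred (ℕₚ.≤-trans (ℕₚ.≤-reflexive (trans (ℕₚ.+-comm 2 r) (sym e+τ))) (ℕₚ.+-monoˡ-≤ τ (ℕₚ.≤-trans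
      (ℕₚ.≤-reflexive (m≡m%n+[m/n]*n e 2)) (ℕₚ.+-mono-≤ (ℕₚ.≤-pred (m%n<n e 2)) (ℕₚ.≤-reflexive (ℕₚ.*-comm h 2))))))
    open +-*-Solver
    quadratic : ∀ k → 40 ℕ.* (42 ℕ.+ k ℕ.+ 2) ℕ.< (42 ℕ.+ k) ℕ.* (42 ℕ.+ k)
    quadratic k = ℕₚ.≤-trans (ℕₚ.m≤m+n (suc (40 ℕ.* (42 ℕ.+ k ℕ.+ 2))) (3 ℕ.+ 44 ℕ.* k ℕ.+ k ℕ.* k)) (ℕₚ.≤-reflexive (solve 1 (λ k →
      con 1 :+ con 40 :* (con 42 :+ k :+ con 2) :+ (con 3 :+ con 44 :* k :+ k :* k) := (con 42 :+ k) :* (con 42 :+ k)) refl k))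
    40X<d : 40 ℕ.* X ℕ.< d
    40X<d = ℕₚ.≤-<-trans (ℕₚ.*-monoʳ-≤ 40 X≤r+2) ([
        -- The threshold originates here: for `r ≤ 41` the bound is `40 · 43 = 1720`. From `r = 42`
        -- on, `40 (r + 2) < r² ≤ d` holds automatically.
        (λ r≤41 → ℕₚ.≤-<-trans (ℕₚ.*-monoʳ-≤ 40 (ℕₚ.+-monoˡ-≤ 2 r≤41)) 1720<d) ,
        (λ 41<r → ℕₚ.<-≤-trans (subst (λ r → 40 ℕ.* (r ℕ.+ 2) ℕ.< r ℕ.* r) (ℕₚ.m+[n∸m]≡n 41<r) (quadratic (r ℕ.∸ 42))) (proj₁ floor)) ]′
      (ℕₚ.≤-<-connex r 41))

D%4≡1⇒ω : ∀ D → D % 4 ≡ 1 → QuadField.ω D ≡ ½ + ½ √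
D%4≡1⇒ω D e with D % 4 | e
... | .1 | refl = refl

D%4≢1⇒ω : ∀ D → D % 4 ≢ 1 → QuadField.ω D ≡ 0ℚ + 1ℚ √
D%4≢1⇒ω D e with D % 4
... | 0           = refl
... | 1           = ⊥-elim (e refl)
... | suc (suc _) = refl

module _ (D : ℕ) .{{_ : NonZero D}} where
  private
    module One (D%4≡1 : D % 4 ≡ 1) where
      Δ≡D : Order.Δ (+ 1) (+ (D / 4)) ≡ + D
      Δ≡D = trans (cong (λ w → + 1 ℤ.+ w) (sym (ℤₚ.pos-* 4 (D / 4))))
        (cong +_ (trans (cong₂ ℕ._+_ (sym D%4≡1) (ℕₚ.*-comm 4 (D / 4))) (sym (m≡m%n+[m/n]*n D 4))))

      open Disproof D (+ 1) (+ 1) (+ (D / 4)) (+<+ (s≤s z≤n)) (trans (ℤₚ.*-identityˡ (+ D)) (sym Δ≡D))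
        (cong (λ w → re w ℚ.+ re w) (D%4≡1⇒ω D D%4≡1)) (cong (λ w → im w ℚ.+ im w) (D%4≡1⇒ω D D%4≡1))
        D (s≤s z≤n) Δ≡D public

    module NotOne (D%4≢1 : D % 4 ≢ 1) where
      Δ≡4D : Order.Δ (+ 0) (+ D) ≡ + (4 ℕ.* D)
      Δ≡4D = trans (ℤₚ.+-identityˡ (+ 4 ℤ.* + D)) (sym (ℤₚ.pos-* 4 D))

      open Disproof D (+ 2) (+ 0) (+ D) (+<+ (s≤s z≤n)) (sym (ℤₚ.+-identityˡ (+ 4 ℤ.* + D)))
        (cong (λ w → re w ℚ.+ re w) (D%4≢1⇒ω D D%4≢1)) (cong (λ w → im w ℚ.+ im w) (D%4≢1⇒ω D D%4≢1))
        (4 ℕ.* D) {{4*-nonZero D}} z≤n Δ≡4D public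

  large-disproof₀ : D % 4 ≢ 1 → 430 ℕ.< D → ¬ QuadField.ExistsUniversalTernary D
  large-disproof₀ D%4≢1 430<D = NotOne.large D%4≢1 0 refl (ℕₚ.*-monoʳ-< 4 430<D)

  large-disproof : Dec (D % 4 ≡ 1) → 1720 ℕ.< D → ¬ QuadField.ExistsUniversalTernary D
  large-disproof (yes D%4≡1) 1720<D = One.large D%4≡1 1 refl 1720<D
  large-disproof (no  D%4≢1) 1720<D = large-disproof₀ D%4≢1 (ℕₚ.<-trans (ℕₚ.≤ᵇ⇒≤ 431 1720 _) 1720<D)

  certified-disproof : ∀ cert₁ cert₀ →
    acceptedBy D cert₁ cert₀ ≡ true →
    ¬ QuadField.ExistsUniversalTernary D
  certified-disproof cert₁ cert₀ ok = [
      (λ (e , ok₁) → One.certified (ℕₚ.≡ᵇ⇒≡ (D % 4) 1 (≡true⇒T e)) cert₁ ok₁) ,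
      (λ (e , ok₀) → NotOne.certified (λ D%4≡1 → false≢true (trans (sym e) (≡⇒≡ᵇ-true D%4≡1))) cert₀ ok₀) ]′
    (if-true (D % 4 ≡ᵇ 1) ok)
    where
    if-true : ∀ b {x y} → (if b then x else y) ≡ true → (b ≡ true × x ≡ true) ⊎ (b ≡ false × y ≡ true)
    if-true true  e = inj₁ (refl , e)
    if-true false e = inj₂ (refl , e)

accepted-disproof : ∀ D → accepted D ≡ true → ¬ QuadField.ExistsUniversalTernary D
accepted-disproof D@(suc _) = certified-disproof D
  (find D (genericCertificate 1 D) exceptional) (find D (genericCertificate 0 (4 ℕ.* D)) exceptional)

excused⇒listed : ∀ D → 1 ℕ.< D → SquareFree D → excused D ≡ true → D ∈ listed
excused⇒listed D 1<D squareFree e = [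
    (λ D≤1 → ⊥-elim (ℕₚ.<⇒≱ 1<D (ℕₚ.≤ᵇ⇒≤ D 1 (≡true⇒T D≤1)))) ,
    (λ e′ → [
        (λ e″ → let (g , g∈ , D≡g) = any-true (D ≡ᵇ_) listed e″ in subst (_∈ listed) (sym (ℕₚ.≡ᵇ⇒≡ D g (≡true⇒T D≡g))) g∈) ,
        (λ e″ → let (m , _ , m²∣D) = any-true squareDivides (upTo 40) e″
                    2+m≡1 = squareFree (2 ℕ.+ m) (m%n≡0⇒n∣m D _ (ℕₚ.≡ᵇ⇒≡ _ 0 (≡true⇒T m²∣D)))
                in ⊥-elim (ℕₚ.1+n≢0 (ℕₚ.suc-injective 2+m≡1))) ]′
      (∨-true {any (D ≡ᵇ_) listed} e′)) ]′
  (∨-true {D ℕ.≤ᵇ 1} e)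
  where
  squareDivides : ℕ → Bool
  squareDivides m = D % (suc (suc m) ℕ.* suc (suc m)) ≡ᵇ 0

settled⇒listed : ∀ D → 1 ℕ.< D → SquareFree D → QuadField.ExistsUniversalTernary D → settled D ≡ true → D ∈ listed
settled⇒listed D 1<D squareFree ex e = [
    excused⇒listed D 1<D squareFree ,
    (λ e′ → ⊥-elim ([
        (λ e″ → let (430<D , D%4≢1) = ∧-true {431 ℕ.≤ᵇ D} e″ in
          large-disproof₀ D {{D-nonZero}} (λ D%4≡1 → not-true D%4≢1 (≡⇒≡ᵇ-true D%4≡1)) (ℕₚ.≤ᵇ⇒≤ 431 D (≡true⇒T 430<D)) ex) ,
        (λ acc → accepted-disproof D acc ex) ]′
      (∨-true {(431 ℕ.≤ᵇ D) ∧ not (D % 4 ≡ᵇ 1)} e′))) ]′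
  (∨-true {excused D} e)
  where
  D-nonZero : NonZero D
  D-nonZero = ℕ.>-nonZero (ℕₚ.<-trans (s≤s z≤n) 1<D)

theorem1p1 : (D : ℕ) → 1 < D → SquareFree D →
    QuadField.ExistsUniversalTernary D →
    D ∈ (2 ∷ 3 ∷ 5 ∷ 6 ∷ 7 ∷ 10 ∷ 13 ∷ 17 ∷ 21 ∷ 33 ∷ 41 ∷ 65 ∷ 77 ∷ [])
theorem1p1 D 1<D squareFree ex = [
    (λ D<1721 → settled⇒listed D 1<D squareFree ex (all-true settled {upTo 1721} {D} all-settled (∈-upTo⁺ {n = 1721} D<1721))) ,
    (λ 1720<D → ⊥-elim (large-disproof D {{ℕ.>-nonZero (ℕₚ.<-trans (s≤s z≤n) 1<D)}} (D % 4 ℕ.≟ 1) 1720<D ex)) ]′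
  (ℕₚ.<-≤-connex D 1721)
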